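{- Let $O$ be a finite basis of Boolean functions. Under the cryptographic assumptions, $\mathsf{PL}_O$ is efficiently learnable from statistical queries if and only if $O\preceq\{\wedge,\top,\bot\}$, $O\preceq\{\vee,\top,\bot\}$ or $O\preceq\{\neg,\top,\bot\}$. The same holds with $\mathsf{CIR}_O$ in place of $\mathsf{PL}_O$.
   Context: A basis is a finite set $O$ of Boolean functions, each of fixed arity (the truth constants $\top=1$, $\bot=0$ may be members, as $0$-ary functions). A $\mathsf{PL}_O$-formula over $x_1,\dots,x_n$ is a finite tree whose leaves are labeled by variables and whose internal nodes of arity $r$ are labeled by $r$-ary members of $O$ (a truth constant labels a node without children). A $\mathsf{CIR}_O$-circuit is the same object with fan-out allowed to exceed one. The size of a formula is its number of nodes; the size of a circuit is its number of gates and inputs. $[O]$ denotes the clone generated by $O$, i.e. the set of Boolean functions computed by $\mathsf{PL}_O$-formulas, and $O\preceq O'$ means $[O]\subseteq[O']$. Statistical query model: fix a target $f$ computed by a member of the class of size at most $s$ over $n$ variables, and a distribution $D$ on $\{0,1\}^n$. The learner is given $n$, $s$ and $\varepsilon$ and sees no examples; it may ask, for any polynomial-time predicate $\chi(\mathbf a,b)$ of a point and a label and any tolerance $\tau>0$, for a number within $\tau$ of $\Pr_{\mathbf a\sim D}[\chi(\mathbf a,f(\mathbf a))=1]$. It must output a (polynomial-time evaluable) hypothesis whose error under $D$ with respect to $f$ is at most $\varepsilon$ (with probability at least $1-\delta$ if the learner is randomized). The class is efficiently learnable from statistical queries if there is such a learner, working for all targets and distributions and all admissible answers, that runs in polynomial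 time and uses polynomially many queries, each of tolerance at least $1/p(n,s,1/\varepsilon)$ for a fixed polynomial $p$. Cryptographic assumptions: at least one of the following problems is intractable: testing quadratic residuosity modulo a composite, inverting RSA encryption, factoring Blum integers (products of two primes congruent to $3$ modulo $4$). Intractability is meant in the usual cryptographic sense: on random instances built from two random $\ell$-bit primes, every probabilistic polynomial-time algorithm has only negligible success probability (for residuosity: negligible advantage over $1/2$, on random elements of Jacobi symbol $1$). -}

module Defs where

open import Data.Bool.Base using (Bool; true; false; T; _∧_; _∨_; not; _xor_; if_then_else_)
open import Data.Fin.Base using (Fin; zero; suc; toℕ)
open import Data.Fin.Properties using (any?)
open import Data.Integer.Base using (ℤ; +_; -[1+_])
import Data.Integer.Base as ℤ
import Data.Integer.Properties as ℤₚ
open import Data.List.Base using (List; []; _∷_; foldl; foldr; filter; length; map; replicate; upTo)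
open import Data.List.Relation.Unary.All using (All)
open import Data.Maybe.Base using (Maybe; just; nothing)
open import Data.Nat.Base using (ℕ; zero; suc; _+_; _*_; _∸_; _^_; _≤_; _%_; ∣_-_∣)
import Data.Nat.Properties as ℕₚ
open import Data.Nat.Coprimality using (coprime?)
open import Data.Nat.Divisibility using (_∣_; _∣?_)
open import Data.Nat.Primality using (Prime; prime?)
open import Data.Digit using (toNatDigits)
open import Data.Product.Base using (Σ; ∃; ∃-syntax; Σ-syntax; _×_; _,_; proj₁; proj₂)
open import Data.Rational.Base as ℚ using (ℚ; 0ℚ; 1ℚ; ½)
open import Data.Sum.Base using (_⊎_)
open import Data.Vec.Base as Vec using (Vec; []; _∷_; _++_; lookup; zipWith; toList)
open import Function.Base using (_∘_)
open import Relation.Binary.PropositionalEquality using (_≡_)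
open import Relation.Nullary.Decidable using (Dec; does; ¬?; _×-dec_)

------------------------------------------------------------------------
-- Bases, formulas, circuits

record Basis : Set where
  field
    size  : ℕ
    arity : Fin size → ℕ
    op    : (i : Fin size) → Vec Bool (arity i) → Bool

data Formula (O : Basis) (n : ℕ) : Set where
  var  : Fin n → Formula O n
  node : (i : Fin (Basis.size O)) → Vec (Formula O n) (Basis.arity O i) → Formula O n

module _ {O : Basis} {n : ℕ} where

  mutual
    evalFormula : Formula O n → Vec Bool n → Bool
    evalFormula (var x)     a = lookup a x
    evalFormula (node i φs) a = Basis.op O i (evalFormulas φs a)

    evalFormulas : ∀ {r} → Vec (Formula O n) r → Vec Bool n → Vec Bool r
    evalFormulas []       a = []
    evalFormulas (φ ∷ φs) a = evalFormula φ a ∷ evalFormulas φs a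

  mutual
    formulaSize : Formula O n → ℕ
    formulaSize (var x)     = 1
    formulaSize (node i φs) = suc (formulaSizes φs)

    formulaSizes : ∀ {r} → Vec (Formula O n) r → ℕ
    formulaSizes []       = 0
    formulaSizes (φ ∷ φs) = formulaSize φ + formulaSizes φs

-- A circuit is a directed acyclic graph listed in topological order:
-- each new node refers only to earlier ones, index zero being the most
-- recent.  `Nodes O n m` are the circuits with m nodes (inputs and gates).
data Label (O : Basis) (n m : ℕ) : Set where
  input : Fin n → Label O n m
  gate  : (i : Fin (Basis.size O)) → Vec (Fin m) (Basis.arity O i) → Label O n m

infixl 5 _▸_

data Nodes (O : Basis) (n : ℕ) : ℕ → Set where
  ∅   : Nodes O n 0
  _▸_ : ∀ {m} → Nodes O n m → Label O n m → Nodes O n (suc m)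

module _ {O : Basis} {n : ℕ} where

  label-value : ∀ {m} → Label O n m → Vec Bool n → Vec Bool m → Bool
  label-value (input x)   a vs = lookup a x
  label-value (gate i js) a vs = Basis.op O i (Vec.map (lookup vs) js)

  values : ∀ {m} → Nodes O n m → Vec Bool n → Vec Bool m
  values ∅        a = []
  values (ns ▸ l) a = label-value l a (values ns a) ∷ values ns a

record Circuit (O : Basis) (n : ℕ) : Set where
  field
    {numNodes} : ℕ
    nodes      : Nodes O n numNodes
    output     : Fin numNodes

record RepresentationClass : Set₁ where
  field
    Member : ℕ → Set
    size   : ∀ {n} → Member n → ℕ
    eval   : ∀ {n} → Member n → Vec Bool n → Bool

PL : Basis → RepresentationClass
PL O = record { Member = Formula O ; size = formulaSize ; eval = evalFormula }

CIR : Basis → RepresentationClass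
CIR O = record
  { Member = Circuit O
  ; size   = λ C → Circuit.numNodes C
  ; eval   = λ C a → lookup (values (Circuit.nodes C) a) (Circuit.output C)
  }

_∈[_] : ∀ {n} → (Vec Bool n → Bool) → Basis → Set
_∈[_] {n} f O = Σ[ φ ∈ Formula O n ] (∀ a → evalFormula φ a ≡ f a)

infix 4 _⪯_

_⪯_ : Basis → Basis → Set
O ⪯ O′ = ∀ {n} (f : Vec Bool n → Bool) → f ∈[ O ] → f ∈[ O′ ]

-- A single connective together with both truth constants.
with-⊤⊥ : (r : ℕ) → (Vec Bool r → Bool) → Basis
with-⊤⊥ r g = record { size = 3 ; arity = ar ; op = ops }
  where
  ar : Fin 3 → ℕ
  ar zero    = r
  ar (suc _) = 0

  ops : (i : Fin 3) → Vec Bool (ar i) → Bool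
  ops zero             = g
  ops (suc zero)       = λ _ → true
  ops (suc (suc zero)) = λ _ → false

⟨∧,⊤,⊥⟩ : Basis
⟨∧,⊤,⊥⟩ = with-⊤⊥ 2 λ { (x ∷ y ∷ []) → x ∧ y }

⟨∨,⊤,⊥⟩ : Basis
⟨∨,⊤,⊥⟩ = with-⊤⊥ 2 λ { (x ∷ y ∷ []) → x ∨ y }

⟨¬,⊤,⊥⟩ : Basis
⟨¬,⊤,⊥⟩ = with-⊤⊥ 1 λ { (x ∷ []) → not x }

------------------------------------------------------------------------
-- Numerals and polynomials

bit : Bool → ℕ
bit b = if b then 1 else 0

-- Binary numerals have the most significant digit first.
toBits : ℕ → List Bool
toBits n = map (λ d → does (d ℕₚ.≟ 1)) (toNatDigits 2 n)

fromBits : List Bool → ℕ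
fromBits = foldl (λ m b → bit b + 2 * m) 0

unary : ℕ → List Bool
unary n = replicate n true

ℕ→ℚ : ℕ → ℚ
ℕ→ℚ n = + n ℚ./ 1

-- The number 0.b₁b₂…bₘ written in binary.
fraction : List Bool → ℚ
fraction []       = 0ℚ
fraction (b ∷ bs) = ½ ℚ.* (ℕ→ℚ (bit b) ℚ.+ fraction bs)

-- ⌈1/q⌉
⌈1/_⌉ : (q : ℚ) → {0ℚ ℚ.< q} → ℕ
⌈1/ q ⌉ {q>0} = ℤ.∣ ℚ.ceiling ((ℚ.1/ q) {{ℚ.>-nonZero q>0}}) ∣

-- Natural coefficients suffice, as polynomials only serve as upper bounds.
data Polynomial (k : ℕ) : Set where
  con       : ℕ → Polynomial k
  var       : Fin k → Polynomial k
  _:+_ _:*_ : Polynomial k → Polynomial k → Polynomial k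

⟦_⟧ : ∀ {k} → Polynomial k → Vec ℕ k → ℕ
⟦ con c ⟧  xs = c
⟦ var i ⟧  xs = lookup xs i
⟦ p :+ q ⟧ xs = ⟦ p ⟧ xs + ⟦ q ⟧ xs
⟦ p :* q ⟧ xs = ⟦ p ⟧ xs * ⟦ q ⟧ xs

------------------------------------------------------------------------
-- Finite probability

sumCube : ∀ n → (Vec Bool n → ℚ) → ℚ
sumCube zero    g = g []
sumCube (suc n) g = sumCube n (g ∘ (false ∷_)) ℚ.+ sumCube n (g ∘ (true ∷_))

Pr : ∀ {n} → (Vec Bool n → ℚ) → (Vec Bool n → Bool) → ℚ
Pr {n} w A = sumCube n λ a → if A a then w a else 0ℚ

uniform : ∀ t → Vec Bool t → ℚ
uniform t _ = (+ 1 ℚ./ (2 ^ t)) {{ℕₚ.m^n≢0 2 t}}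

1/1+_ : ℕ → ℚ
1/1+ k = + 1 ℚ./ suc k

-- A distribution on {0,1}ⁿ with real weights, given by a regular Cauchy
-- sequence (in ℓ¹ distance) of distributions with rational weights.
record Distribution (n : ℕ) : Set where
  field
    approx : ℕ → Vec Bool n → ℚ
    nonneg : ∀ k a → 0ℚ ℚ.≤ approx k a
    total  : ∀ k → sumCube n (approx k) ≡ 1ℚ
    cauchy : ∀ j k → sumCube n (λ a → ℚ.∣ approx j a ℚ.- approx k a ∣)
                     ℚ.≤ 1/1+ j ℚ.+ 1/1+ k

-- |v - Pr_D[A]| ≤ τ  and  Pr_D[A] ≤ ε, for the real number Pr_D[A]: the
-- k-th approximation to Pr_D[A] is off by at most 1/(k+1).
module _ {n : ℕ} (D : Distribution n) (A : Vec Bool n → Bool) where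

  PrWithin : ℚ → ℚ → Set
  PrWithin τ v = ∀ k → ℚ.∣ v ℚ.- Pr (Distribution.approx D k) A ∣ ℚ.≤ τ ℚ.+ 1/1+ k

  PrAtMost : ℚ → Set
  PrAtMost ε = ∀ k → Pr (Distribution.approx D k) A ℚ.≤ ε ℚ.+ 1/1+ k

-- Expectation for a uniformly random element of a list.
mean : ∀ {A : Set} → List A → (A → ℚ) → ℚ
mean []       g = 0ℚ
mean (x ∷ xs) g = foldr (λ y s → g y ℚ.+ s) 0ℚ (x ∷ xs) ℚ.* 1/1+ length xs

syntax mean xs (λ x → e) = 𝔼[ x ← xs ] e

Negligible : (ℕ → ℚ) → Set
Negligible g = ∀ c → ∃[ L ] (∀ ℓ → L ≤ ℓ → g ℓ ℚ.* ℕ→ℚ (ℓ ^ c) ℚ.≤ 1ℚ)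

------------------------------------------------------------------------
-- Multitape Turing machines, optionally with coin tosses and with
-- statistical queries

Symbol : Set
Symbol = Maybe Bool   -- `nothing` is the blank

data Direction : Set where
  left right stay : Direction

-- A two-way infinite tape, blank outside the two lists; the first list is
-- to the left of the head, nearest cell first, and the second starts at
-- the scanned cell.
record Tape : Set where
  constructor _◂_
  field
    before : List Symbol
    after  : List Symbol

uncons : List Symbol → Symbol × List Symbol
uncons []       = nothing , []
uncons (x ∷ xs) = x , xs

read : Tape → Symbol
read (ls ◂ rs) = proj₁ (uncons rs)

act : Symbol × Direction → Tape → Tape
act (x , stay)  (ls ◂ rs) = ls ◂ (x ∷ proj₂ (uncons rs))
act (x , right) (ls ◂ rs) = (x ∷ ls) ◂ proj₂ (uncons rs)
act (x , left)  (ls ◂ rs) =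
  proj₂ (uncons ls) ◂ (proj₁ (uncons ls) ∷ x ∷ proj₂ (uncons rs))

load : List Bool → Tape
load bs = [] ◂ map just bs

-- The word starting at the head and extending to the first blank.
contents : Tape → List Bool
contents (ls ◂ rs) = word rs
  where
  word : List Symbol → List Bool
  word (just b ∷ xs)  = b ∷ word xs
  word (nothing ∷ xs) = []
  word []             = []

-- The flags say whether the machine may toss coins and ask queries.
data Instruction (coins queries : Bool) (tapes states : ℕ) : Set where
  halt : Instruction coins queries tapes states
  move : Vec (Symbol × Direction) tapes → Fin states → Instruction coins queries tapes states
  toss : T coins → (Bool → Fin states) → Instruction coins queries tapes states
  ask  : T queries → Fin states → Instruction coins queries tapes states

-- The tapes are: output (also holding the word of a query); tolerance,
-- integer part; tolerance, fractional part; answer, integer part; answer,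
-- fractional part; then the input tapes and the work tapes.
tapeCount : ℕ → ℕ → ℕ
tapeCount inputs work = 5 + (inputs + work)

record Machine (coins queries : Bool) (inputs : ℕ) : Set where
  field
    work   : ℕ
    states : ℕ
    start  : Fin states
    δ      : Fin states → Vec Symbol (tapeCount inputs work) →
             Instruction coins queries (tapeCount inputs work) states

record Query : Set where
  constructor query
  field
    word      : List Bool
    tolerance : ℚ

-- Numbers are communicated in binary: `answer z bs` stands for z + 0.bs.
record Answer : Set where
  constructor answer
  field
    whole      : ℤ
    fractional : List Bool

answer-value : Answer → ℚ
answer-value (answer z bs) = (z ℚ./ 1) ℚ.+ fraction bs

-- The answer to the current query may depend on the earlier ones (most
-- recent first).
Oracle : Set
Oracle = Query → List Query → Answer

signedBits : ℤ → List Bool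
signedBits (+ n)    = false ∷ toBits n
signedBits -[1+ n ] = true ∷ toBits (suc n)

module Execution {coins queries : Bool} {inputs : ℕ} (M : Machine coins queries inputs) where
  open Machine M

  record Configuration : Set where
    field
      state : Fin states
      tapes : Vec Tape (tapeCount inputs work)
      asked : List Query   -- most recent first

  open Configuration public

  initial : Vec (List Bool) inputs → Configuration
  initial xs = record
    { state = start
    ; tapes = Vec.replicate 5 (load []) ++ (Vec.map load xs ++ Vec.replicate work (load []))
    ; asked = []
    }

  instruction : (c : Configuration) → Instruction coins queries (tapeCount inputs work) states
  instruction c = δ (state c) (Vec.map read (tapes c))

  submit : Oracle → Fin states → Configuration → Configuration
  submit 𝒪 s c with tapes c
  ... | w ∷ τᵢ ∷ τᶠ ∷ _ ∷ _ ∷ rest = record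
    { state = s
    ; tapes = w ∷ τᵢ ∷ τᶠ ∷ load (signedBits (Answer.whole v)) ∷ load (Answer.fractional v) ∷ rest
    ; asked = q ∷ asked c
    }
    where
    q : Query
    q = query (contents w) (ℕ→ℚ (fromBits (contents τᵢ)) ℚ.+ fraction (contents τᶠ))
    v : Answer
    v = 𝒪 q (asked c)

  step : Oracle → Bool → Configuration → Configuration
  step 𝒪 coin c with instruction c
  ... | halt      = c
  ... | move as s = record c { state = s ; tapes = zipWith act as (tapes c) }
  ... | toss _ s  = record c { state = s coin }
  ... | ask _ s   = submit 𝒪 s c

  -- A fresh coin is supplied for every step, whether used or not; t steps
  -- thus correspond to the probability space {0,1}ᵗ with uniform weights.
  run : ∀ {t} → Oracle → Vec Bool t → Configuration → Configuration
  run 𝒪 []       c = c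
  run 𝒪 (b ∷ bs) c = run 𝒪 bs (step 𝒪 b c)

  Halted : Configuration → Set
  Halted c = instruction c ≡ halt

  output : Configuration → List Bool
  output c = contents (Vec.head (tapes c))

no-oracle : Oracle
no-oracle _ _ = answer (+ 0) []

totalLength : ∀ {i} → Vec (List Bool) i → ℕ
totalLength xs = Vec.sum (Vec.map length xs)

-- An algorithm whose running time is polynomial in the length of its input.
record PolyTime (coins : Bool) (inputs : ℕ) : Set where
  field
    machine : Machine coins false inputs
    bound   : Polynomial 1

  open Execution machine

  time : Vec (List Bool) inputs → ℕ
  time xs = ⟦ bound ⟧ (totalLength xs ∷ [])

  field
    halts : ∀ xs (cs : Vec Bool (time xs)) → Halted (run no-oracle cs (initial xs))

  result : (xs : Vec (List Bool) inputs) → Vec Bool (time xs) → List Bool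
  result xs cs = output (run no-oracle cs (initial xs))

accepting : List Bool → Bool
accepting []      = false
accepting (b ∷ _) = b

decide : ∀ {i} → PolyTime false i → Vec (List Bool) i → Bool
decide P xs = accepting (PolyTime.result P xs (Vec.replicate (PolyTime.time P xs) false))

------------------------------------------------------------------------
-- Learning from statistical queries

-- A query word w denotes the predicate χ(a,b) = E(w,a,b) and an output
-- word h the hypothesis a ↦ H(h,a), where E and H are polynomial-time
-- algorithms belonging to the learner.
record SQLearner : Set where
  field
    learner        : Machine true true 4
    E              : PolyTime false 3
    H              : PolyTime false 2
    timeBound      : Polynomial 4
    queryBound     : Polynomial 4
    toleranceBound : Polynomial 3

  χ : ∀ {n} → List Bool → Vec Bool n → Bool → Bool
  χ w a b = decide E (w ∷ toList a ∷ (b ∷ []) ∷ [])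

  hypothesis : ∀ {n} → List Bool → Vec Bool n → Bool
  hypothesis h a = decide H (h ∷ toList a ∷ [])

-- The accuracy ε and the confidence parameter δ are finite binary
-- fractions in (0,1), given to the learner by their digits.
module Run (L : SQLearner) {n : ℕ} (s : ℕ) (f : Vec Bool n → Bool) (D : Distribution n)
           (εs δs : List Bool) (ε>0 : 0ℚ ℚ.< fraction εs) (δ>0 : 0ℚ ℚ.< fraction δs)
           (𝒪 : Oracle) where
  open SQLearner L
  open Execution learner using (Configuration; Halted; asked; run; initial; output)

  Admissible : Set
  Admissible = ∀ w τ earlier → 0ℚ ℚ.< τ →
    PrWithin D (λ a → χ w a (f a)) τ (answer-value (𝒪 (query w τ) earlier))

  1/ε 1/δ steps : ℕ
  1/ε   = ⌈1/ fraction εs ⌉ {ε>0}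
  1/δ   = ⌈1/ fraction δs ⌉ {δ>0}
  steps = ⟦ timeBound ⟧ (n ∷ s ∷ 1/ε ∷ 1/δ ∷ [])

  final : Vec Bool steps → Configuration
  final cs = run 𝒪 cs (initial (unary n ∷ unary s ∷ εs ∷ δs ∷ []))

  Efficient : Vec Bool steps → Set
  Efficient cs =
    Halted (final cs) ×
    length (asked (final cs)) ≤ ⟦ queryBound ⟧ (n ∷ s ∷ 1/ε ∷ 1/δ ∷ []) ×
    All (λ q → 1ℚ ℚ.≤ Query.tolerance q ℚ.* ℕ→ℚ (⟦ toleranceBound ⟧ (n ∷ s ∷ 1/ε ∷ [])))
        (asked (final cs))

  Accurate : Vec Bool steps → Set
  Accurate cs = PrAtMost D (λ a → hypothesis (output (final cs)) a xor f a) (fraction εs)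

  -- Accuracy is a statement about real numbers, hence not decidable; its
  -- probability is bounded below by that of a decidable event implying it.
  AccurateWithConfidence : Set
  AccurateWithConfidence =
    Σ[ S ∈ (Vec Bool steps → Bool) ]
      (∀ cs → S cs ≡ true → Accurate cs) ×
      1ℚ ℚ.- fraction δs ℚ.≤ Pr (uniform steps) S

-- A deterministic learner is one that never tosses coins and ignores δ.
EfficientlySQLearnable : RepresentationClass → Set
EfficientlySQLearnable 𝒞 =
  Σ[ L ∈ SQLearner ]
    ∀ {n} s (c : Member n) → size c ≤ s → (D : Distribution n) →
    ∀ εs δs (ε>0 : 0ℚ ℚ.< fraction εs) (δ>0 : 0ℚ ℚ.< fraction δs) (𝒪 : Oracle) →
    let module R = Run L s (eval c) D εs δs ε>0 δ>0 𝒪 in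
    R.Admissible → (∀ cs → R.Efficient cs) × R.AccurateWithConfidence
  where open RepresentationClass 𝒞

------------------------------------------------------------------------
-- Cryptographic assumptions

-- ℓ-bit numbers p satisfy 2^(ℓ-1) ≤ p < 2^ℓ.
primes : ℕ → List ℕ
primes ℓ = filter (λ p → (2 ^ ℓ ℕₚ.≤? 2 * p) ×-dec prime? p) (upTo (2 ^ ℓ))

-- The primes in the list other than p: a modulus is a product of two
-- distinct primes.
_excluding_ : List ℕ → ℕ → List ℕ
ps excluding p = filter (λ q → ¬? (q ℕₚ.≟ p)) ps

_mod_ : ℕ → ℕ → ℕ
a mod zero  = a
a mod suc m = a % suc m

Square : ℕ → ℕ → Set
Square m x = Σ[ y ∈ Fin m ] (m ∣ ∣ toℕ y * toℕ y - x ∣)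

square? : ∀ m x → Dec (Square m x)
square? m x = any? λ y → m ∣? ∣ toℕ y * toℕ y - x ∣

legendre : ℕ → ℕ → ℤ
legendre x p = if does (p ∣? x) then + 0 else (if does (square? p x) then + 1 else -[1+ 0 ])

-- The Jacobi symbol of x modulo p q, for odd primes p and q.
jacobi : ℕ → ℕ → ℕ → ℤ
jacobi x p q = legendre x p ℤ.* legendre x q

jacobi-one : ℕ → ℕ → List ℕ
jacobi-one p q = filter (λ x → jacobi x p q ℤₚ.≟ + 1) (upTo (p * q))

-- Probability, over the coins of the algorithm, that its output passes the test.
prob : ∀ {i} → PolyTime true i → Vec (List Bool) i → (List Bool → Bool) → ℚ
prob A xs test = Pr (uniform (PolyTime.time A xs)) (λ cs → test (PolyTime.result A xs cs))

ResiduosityIntractable : Set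
ResiduosityIntractable = (A : PolyTime true 2) → Negligible λ ℓ → success A ℓ ℚ.- ½
  where
  success : PolyTime true 2 → ℕ → ℚ
  success A ℓ =
    𝔼[ p ← primes ℓ ] 𝔼[ q ← primes ℓ excluding p ] 𝔼[ x ← jacobi-one p q ]
      prob A (toBits (p * q) ∷ toBits x ∷ [])
             (λ out → not (accepting out xor does (square? (p * q) x)))

-- The public exponent e is uniform among the units modulo φ(N), and the
-- plaintext x is uniform modulo N.
RSAIntractable : Set
RSAIntractable = (A : PolyTime true 3) → Negligible (success A)
  where
  exponents : ℕ → List ℕ
  exponents φ = filter (λ e → coprime? e φ) (upTo φ)

  success : PolyTime true 3 → ℕ → ℚ
  success A ℓ =
    𝔼[ p ← primes ℓ ] 𝔼[ q ← primes ℓ excluding p ]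
    𝔼[ e ← exponents ((p ∸ 1) * (q ∸ 1)) ] 𝔼[ x ← upTo (p * q) ]
      prob A (toBits (p * q) ∷ toBits e ∷ toBits ((x ^ e) mod (p * q)) ∷ [])
             (λ out → does (fromBits out ℕₚ.≟ x))

BlumFactoringIntractable : Set
BlumFactoringIntractable = (A : PolyTime true 1) → Negligible (success A)
  where
  blumPrimes : ℕ → List ℕ
  blumPrimes ℓ = filter (λ p → p % 4 ℕₚ.≟ 3) (primes ℓ)

  success : PolyTime true 1 → ℕ → ℚ
  success A ℓ =
    𝔼[ p ← blumPrimes ℓ ] 𝔼[ q ← blumPrimes ℓ excluding p ]
      prob A (toBits (p * q) ∷ [])
             (λ out → does (fromBits out ℕₚ.≟ p) ∨ does (fromBits out ℕₚ.≟ q))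

CryptographicAssumptions : Set
CryptographicAssumptions =
  ResiduosityIntractable ⊎ RSAIntractable ⊎ BlumFactoringIntractable

{-# OPTIONS --safe #-}

-- Learnability: a function of one of the three clones is a conjunction or
-- a disjunction of literals and constants.  For a conjunction f it suffices
-- to estimate, for each literal x, the probability that x fails while f
-- holds, and to return the conjunction of the literals for which this is
-- negligible: no literal of f is lost, and the errors add up to at most ε.
-- Disjunctions are dual.
--
-- Unlearnability: outside the three clones, the connectives applied to
-- literals and constants yield the exclusive or.  Over the image of the
-- uniform distribution under b ↦ (1, 0, b, ¬b), literals and constants are
-- variables, and balanced formulas of polynomial size compute all parities
-- of b.  By Parseval, for a given query only few parities have an answer
-- that differs noticeably from the average over both labels; on the others
-- a learner that is always told this average learns nothing.
module Submission where

open import Defs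
open import Data.Bool.Base using (Bool; true; false; _∧_; _∨_; not; _xor_; if_then_else_)
open import Data.Bool.Properties using (∧-assoc; ∧-identityʳ; ∨-identityʳ; ∨-zeroʳ; not-distribˡ-xor; not-involutive; xor-assoc; xor-identityʳ)
open import Data.Empty using (⊥; ⊥-elim)
open import Data.Fin.Base using (Fin; zero; suc; toℕ; _↑ˡ_; _↑ʳ_)
open import Data.Fin.Patterns
import Data.Fin.Properties as Finₚ
open import Data.Integer.Base using (ℤ; +_; -[1+_])
import Data.Integer.Base as ℤ
import Data.Integer.DivMod as ℤ
import Data.Integer.Properties as ℤₚ
open import Data.List.Base as List using (List; []; _∷_; length; _++_; _ʳ++_; reverse)
import Data.List.Properties as Listₚ
open import Data.List.Membership.Propositional using (_∈_)
open import Data.List.Membership.Propositional.Properties using (∈-map⁺)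
open import Data.List.Relation.Unary.All as All using (All; []; _∷_)
import Data.List.Relation.Unary.All.Properties as Allₚ
open import Data.List.Relation.Unary.Any using (here; there)
open import Data.Maybe.Base using (just; nothing)
open import Data.Nat.Base using (ℕ; zero; suc; _+_; _*_; _∸_; _^_; _≤_; _<_; z≤n; s≤s)
import Data.Nat.Base as ℕ
import Data.Nat.DivMod as ℕ
import Data.Nat.Properties as ℕₚ
open import Data.Nat.Tactic.RingSolver using (solve-∀)
open import Data.Product.Base using (Σ; Σ-syntax; _×_; _,_; proj₁; proj₂)
open import Data.Rational.Base as ℚ using (ℚ; 0ℚ; 1ℚ; ½)
import Data.Rational.Properties as ℚₚ
open import Data.Rational.Solver using (module +-*-Solver)
open +-*-Solver using (solve; _:=_) renaming (_:+_ to _⊞_; _:*_ to _⊠_; :-_ to ⊟_; con to κ)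
import Data.Rational.Unnormalised.Base as ℚᵘ
import Data.Rational.Unnormalised.Properties as ℚᵘₚ
open import Data.Sum.Base as Sum using (_⊎_; inj₁; inj₂)
open import Data.Unit.Base using (tt)
open import Data.Vec.Base as Vec using (Vec; []; _∷_; toList; lookup; map; zipWith; replicate)
import Data.Vec.Properties as Vecₚ
open import Function.Base using (_∘_; id)
open import Function.Bundles using (_⇔_; mk⇔)
open import Relation.Binary.PropositionalEquality
open import Relation.Nullary using (¬_; Dec; yes; no; contradiction)
open import Relation.Nullary.Decidable using (toWitness; does)

-- Formulas

-- The learner is an explicit Turing machine whose data format spares it arithmetic. Its output tape
-- holds one bit per candidate decided so far, newest first; the same word is the next query, where
-- only its length counts, and in the end the hypothesis. One tape holds the numeral 0^k 1, at once
-- the tolerance 2^-(k+1) and a ruler for the threshold 2^-k: an answer with integer part 0 is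
-- accepted when its first k fractional digits vanish. Of ε only the leading zeros are read, as the
-- length of its numeral is not bounded in terms of 1/ε.
--
-- In the lower bound, always answering with the average need not be admissible, so the guarantee of
-- the learner is applied to an oracle that leaves the average only when forced to. Its run equals
-- the neutral one unless the target is detected, and for fixed coins the neutral run and its tests
-- are the same for all targets; counting pairs of targets and coins then bounds the number of
-- parities. Parities have 2^d bits because an exclusive-or gate may repeat its arguments: each
-- level of the tree costs a constant factor c, and c^d is polynomial in 2^d.

module _ {O : Basis} where

  mutual
    substitute : ∀ {k n} → Formula O k → Vec (Formula O n) k → Formula O n
    substitute (var x)     σ = lookup σ x
    substitute (node i φs) σ = node i (substitutes φs σ)

    substitutes : ∀ {k n r} → Vec (Formula O k) r → Vec (Formula O n) k → Vec (Formula O n) r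
    substitutes []       σ = []
    substitutes (φ ∷ φs) σ = substitute φ σ ∷ substitutes φs σ

  lookup-evalFormulas : ∀ {n r} (φs : Vec (Formula O n) r) x a →
    lookup (evalFormulas φs a) x ≡ evalFormula (lookup φs x) a
  lookup-evalFormulas (φ ∷ φs) zero    a = refl
  lookup-evalFormulas (φ ∷ φs) (suc x) a = lookup-evalFormulas φs x a

  evalFormulas-map-lookup : ∀ {n k r} (φs : Vec (Formula O n) k) (σ : Vec (Fin k) r) a →
    evalFormulas (map (lookup φs) σ) a ≡ map (lookup (evalFormulas φs a)) σ
  evalFormulas-map-lookup φs []      a = refl
  evalFormulas-map-lookup φs (x ∷ σ) a =
    cong₂ _∷_ (sym (lookup-evalFormulas φs x a)) (evalFormulas-map-lookup φs σ a)

  evalFormulas-map-var : ∀ {n r} (σ : Vec (Fin n) r) (a : Vec Bool n) →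
    evalFormulas {O} (map var σ) a ≡ map (lookup a) σ
  evalFormulas-map-var []      a = refl
  evalFormulas-map-var (x ∷ σ) a = cong (lookup a x ∷_) (evalFormulas-map-var σ a)

  mutual
    eval-substitute : ∀ {k n} (φ : Formula O k) (σ : Vec (Formula O n) k) a →
      evalFormula (substitute φ σ) a ≡ evalFormula φ (evalFormulas σ a)
    eval-substitute (var x)     σ a = sym (lookup-evalFormulas σ x a)
    eval-substitute (node i φs) σ a = cong (Basis.op O i) (eval-substitutes φs σ a)

    eval-substitutes : ∀ {k n r} (φs : Vec (Formula O k) r) (σ : Vec (Formula O n) k) a →
      evalFormulas (substitutes φs σ) a ≡ evalFormulas φs (evalFormulas σ a)
    eval-substitutes []       σ a = refl
    eval-substitutes (φ ∷ φs) σ a = cong₂ _∷_ (eval-substitute φ σ a) (eval-substitutes φs σ a)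

  module _ {k n M} (σ : Vec (Formula O n) k) (1≤M : 1 ≤ M)
           (σ≤M : ∀ x → formulaSize (lookup σ x) ≤ M) where
    open ℕₚ.≤-Reasoning

    mutual
      -- Every node of φ is charged M: a variable becomes a formula of size at most M, and a gate
      -- keeps its one node, which `1≤M` covers.
      size-substitute : ∀ φ → formulaSize (substitute φ σ) ≤ formulaSize φ * M
      size-substitute (var x)     = ℕₚ.≤-trans (σ≤M x) (ℕₚ.≤-reflexive (sym (ℕₚ.+-identityʳ M)))
      size-substitute (node i φs) = ℕₚ.+-mono-≤ 1≤M (size-substitutes φs)

      size-substitutes : ∀ {r} (φs : Vec (Formula O k) r) →
        formulaSizes (substitutes φs σ) ≤ formulaSizes φs * M
      size-substitutes []       = z≤n
      size-substitutes (φ ∷ φs) = begin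
        formulaSize (substitute φ σ) + formulaSizes (substitutes φs σ)
          ≤⟨ ℕₚ.+-mono-≤ (size-substitute φ) (size-substitutes φs) ⟩
        formulaSize φ * M + formulaSizes φs * M
          ≡⟨ ℕₚ.*-distribʳ-+ M (formulaSize φ) (formulaSizes φs) ⟨
        (formulaSize φ + formulaSizes φs) * M ∎

∈[]-cong : ∀ {O n} {f g : Vec Bool n → Bool} → (∀ a → f a ≡ g a) → f ∈[ O ] → g ∈[ O ]
∈[]-cong f≗g (φ , φ≗f) = φ , λ a → trans (φ≗f a) (f≗g a)

module _ {O O′ : Basis} (ops∈ : ∀ i → Basis.op O i ∈[ O′ ]) where

  mutual
    translate : ∀ {n} → Formula O n → Formula O′ n
    translate (var x)     = var x
    translate (node i φs) = substitute (proj₁ (ops∈ i)) (translates φs)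

    translates : ∀ {n r} → Vec (Formula O n) r → Vec (Formula O′ n) r
    translates []       = []
    translates (φ ∷ φs) = translate φ ∷ translates φs

  mutual
    eval-translate : ∀ {n} (φ : Formula O n) a → evalFormula (translate φ) a ≡ evalFormula φ a
    eval-translate (var x)     a = refl
    eval-translate (node i φs) a = begin
      evalFormula (substitute (proj₁ (ops∈ i)) (translates φs)) a
        ≡⟨ eval-substitute (proj₁ (ops∈ i)) (translates φs) a ⟩
      evalFormula (proj₁ (ops∈ i)) (evalFormulas (translates φs) a)
        ≡⟨ cong (evalFormula (proj₁ (ops∈ i))) (eval-translates φs a) ⟩
      evalFormula (proj₁ (ops∈ i)) (evalFormulas φs a)
        ≡⟨ proj₂ (ops∈ i) _ ⟩
      Basis.op O i (evalFormulas φs a) ∎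
      where open ≡-Reasoning

    eval-translates : ∀ {n r} (φs : Vec (Formula O n) r) a →
      evalFormulas (translates φs) a ≡ evalFormulas φs a
    eval-translates []       a = refl
    eval-translates (φ ∷ φs) a = cong₂ _∷_ (eval-translate φ a) (eval-translates φs a)

  ⪯-from-ops : O ⪯ O′
  ⪯-from-ops f (φ , φ≗f) = translate φ , λ a → trans (eval-translate φ a) (φ≗f a)

weaken-∈[] : ∀ {O r} {g : Vec Bool (suc r) → Bool} → (g ∘ (false ∷_)) ∈[ O ] →
  (∀ a → g (false ∷ a) ≡ g (true ∷ a)) → g ∈[ O ]
weaken-∈[] {O} {r} {g} (φ , φ≗g) same = substitute φ vars , correct
  where
  vars : Vec (Formula O (suc r)) r
  vars = map var (Vec.tabulate suc)

  same′ : ∀ b a → g (false ∷ a) ≡ g (b ∷ a)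
  same′ false a = refl
  same′ true  a = same a

  correct : ∀ a → evalFormula (substitute φ vars) a ≡ g a
  correct (b ∷ a) = begin
    evalFormula (substitute φ vars) (b ∷ a)   ≡⟨ eval-substitute φ vars (b ∷ a) ⟩
    evalFormula φ (evalFormulas vars (b ∷ a)) ≡⟨ cong (evalFormula φ) eq ⟩
    evalFormula φ a                           ≡⟨ φ≗g a ⟩
    g (false ∷ a)                             ≡⟨ same′ b a ⟩
    g (b ∷ a)                                 ∎
    where
    open ≡-Reasoning
    eq : evalFormulas vars (b ∷ a) ≡ a
    eq = begin
      evalFormulas vars (b ∷ a)                       ≡⟨ evalFormulas-map-var (Vec.tabulate suc) (b ∷ a) ⟩
      map (lookup (b ∷ a)) (Vec.tabulate suc)         ≡⟨ Vecₚ.tabulate-∘ (lookup (b ∷ a)) suc ⟨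
      Vec.tabulate (lookup a)                         ≡⟨ Vecₚ.tabulate∘lookup a ⟩
      a                                               ∎

-- Classification of the connectives

search : ∀ {r} (P : Vec Bool r → Bool) → (Σ[ a ∈ Vec Bool r ] P a ≡ true) ⊎ (∀ a → P a ≡ false)
search {zero}  P with P [] in eq
... | true  = inj₁ ([] , eq)
... | false = inj₂ λ { [] → eq }
search {suc r} P with search (P ∘ (false ∷_)) | search (P ∘ (true ∷_))
... | inj₁ (a , Pa) | _             = inj₁ (false ∷ a , Pa)
... | inj₂ _        | inj₁ (a , Pa) = inj₁ (true ∷ a , Pa)
... | inj₂ none₀    | inj₂ none₁    = inj₂ λ { (false ∷ a) → none₀ a ; (true ∷ a) → none₁ a }

xor-true : ∀ {x y} → x xor y ≡ true → y ≡ not x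
xor-true {true}  {false} _ = refl
xor-true {false} {true}  _ = refl

xor-false : ∀ {x y} → x xor y ≡ false → x ≡ y
xor-false {true}  {true}  _ = refl
xor-false {false} {false} _ = refl

rails : Bool → Bool → Vec Bool 6
rails p q = p ∷ not p ∷ q ∷ not q ∷ true ∷ false ∷ []

-- The entries of σ choose among p, ¬p, q, ¬q and the constants.  Up to its
-- value at (1,1), the binary function obtained is a disjunction or an
-- exclusive or, possibly negated.
Corner : ∀ {r} → Bool → (Vec Bool r → Bool) → Set
Corner {r} u g = Σ[ σ ∈ Vec (Fin 6) r ]
  g (map (lookup (rails false false)) σ) ≡ u ×
  g (map (lookup (rails true false)) σ) ≡ not u ×
  g (map (lookup (rails false true)) σ) ≡ not u

-- Such a σ exists exactly when g is not monotone: it fixes the arguments on which two comparable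
-- points agree and lets the others follow x.
Negating : ∀ {r} → (Vec Bool r → Bool) → Set
Negating {r} g = Σ[ σ ∈ Vec (Fin 3) r ] (∀ x → g (map (lookup (x ∷ true ∷ false ∷ [])) σ) ≡ not x)

const₆ : Bool → Fin 6
const₆ b = if b then 4F else 5F

const₃ : Bool → Fin 3
const₃ b = if b then 1F else 2F

lookup-const₆ : ∀ p q b → lookup (rails p q) (const₆ b) ≡ b
lookup-const₆ p q true  = refl
lookup-const₆ p q false = refl

lookup-const₃ : ∀ x b → lookup (x ∷ true ∷ false ∷ []) (const₃ b) ≡ b
lookup-const₃ x true  = refl
lookup-const₃ x false = refl

map-const₃ : ∀ {r} x (a : Vec Bool r) → map (lookup (x ∷ true ∷ false ∷ [])) (map const₃ a) ≡ a
map-const₃ x []      = refl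
map-const₃ x (b ∷ a) = cong₂ _∷_ (lookup-const₃ x b) (map-const₃ x a)

corner-∷ : ∀ {r u} {g : Vec Bool (suc r) → Bool} b → Corner u (g ∘ (b ∷_)) → Corner u g
corner-∷ {g = g} b (σ , e₀ , e₁ , e₂) = const₆ b ∷ σ ,
  trans (cong (λ c → g (c ∷ _)) (lookup-const₆ false false b)) e₀ ,
  trans (cong (λ c → g (c ∷ _)) (lookup-const₆ true false b)) e₁ ,
  trans (cong (λ c → g (c ∷ _)) (lookup-const₆ false true b)) e₂

negating-∷ : ∀ {r} {g : Vec Bool (suc r) → Bool} b → Negating (g ∘ (b ∷_)) → Negating g
negating-∷ {g = g} b (σ , e) = const₃ b ∷ σ ,
  λ x → trans (cong (λ c → g (c ∷ _)) (lookup-const₃ x b)) (e x)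

-- The Boolean treats ∧ and ∨ by one argument: `d` is the neutral element of `meet d`, and `not d`
-- the absorbing one.
meet : Bool → Bool → Bool → Bool
meet true  = _∧_
meet false = _∨_

lattice : Bool → Basis
lattice true  = ⟨∧,⊤,⊥⟩
lattice false = ⟨∨,⊤,⊥⟩

map-zipWith-≡ : ∀ {A : Set} {r} {f : A → Bool} {h k} → (∀ x y → f (h x y) ≡ k x y) →
  ∀ (b c : Vec Bool r) → map f (zipWith h b c) ≡ zipWith k b c
map-zipWith-≡ eq []      []      = refl
map-zipWith-≡ eq (x ∷ b) (y ∷ c) = cong₂ _∷_ (eq x y) (map-zipWith-≡ eq b c)

map-zipWith-left : ∀ {A : Set} {r} {f : A → Bool} {h} → (∀ x y → f (h x y) ≡ x) →
  ∀ (b c : Vec Bool r) → map f (zipWith h b c) ≡ b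
map-zipWith-left eq []      []      = refl
map-zipWith-left eq (x ∷ b) (y ∷ c) = cong₂ _∷_ (eq x y) (map-zipWith-left eq b c)

map-zipWith-right : ∀ {A : Set} {r} {f : A → Bool} {h} → (∀ x y → f (h x y) ≡ y) →
  ∀ (b c : Vec Bool r) → map f (zipWith h b c) ≡ c
map-zipWith-right eq []      []      = refl
map-zipWith-right eq (x ∷ b) (y ∷ c) = cong₂ _∷_ (eq x y) (map-zipWith-right eq b c)

-- The rail whose values at (0,0), (1,0) and (0,1) are the meet, x and y. It exists because the meet
-- is always x or y.
meet-literal : Bool → Bool → Bool → Fin 6
meet-literal d     true  true  = 4F
meet-literal d     false false = 5F
meet-literal true  true  false = 0F
meet-literal true  false true  = 2F
meet-literal false true  false = 3F
meet-literal false false true  = 1F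

meet-literal-base : ∀ d x y → lookup (rails false false) (meet-literal d x y) ≡ meet d x y
meet-literal-base true  true  true  = refl
meet-literal-base true  true  false = refl
meet-literal-base true  false true  = refl
meet-literal-base true  false false = refl
meet-literal-base false true  true  = refl
meet-literal-base false true  false = refl
meet-literal-base false false true  = refl
meet-literal-base false false false = refl

meet-literal-left : ∀ d x y → lookup (rails true false) (meet-literal d x y) ≡ x
meet-literal-left d     true  true  = refl
meet-literal-left d     false false = refl
meet-literal-left true  true  false = refl
meet-literal-left true  false true  = refl
meet-literal-left false true  false = refl
meet-literal-left false false true  = refl

meet-literal-right : ∀ d x y → lookup (rails false true) (meet-literal d x y) ≡ y
meet-literal-right d     true  true  = refl
meet-literal-right d     false false = refl
meet-literal-right true  true  false = refl
meet-literal-right true  false true  = refl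
meet-literal-right false true  false = refl
meet-literal-right false false true  = refl

-- One coordinate of the segment from the meet of two points to the second point, run through as the
-- variable goes from `not d` to `d`; it moves only where the meet differs from y.
meet-path : Bool → Bool → Bool → Fin 3
meet-path true  false true  = 0F
meet-path false true  false = 0F
meet-path d     x     y     = const₃ y

meet-path-start : ∀ d x y → lookup (not d ∷ true ∷ false ∷ []) (meet-path d x y) ≡ meet d x y
meet-path-start true  true  true  = refl
meet-path-start true  true  false = refl
meet-path-start true  false true  = refl
meet-path-start true  false false = refl
meet-path-start false true  true  = refl
meet-path-start false true  false = refl
meet-path-start false false true  = refl
meet-path-start false false false = refl

meet-path-end : ∀ d x y → lookup (d ∷ true ∷ false ∷ []) (meet-path d x y) ≡ y
meet-path-end true  true  true  = refl
meet-path-end true  true  false = refl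
meet-path-end true  false true  = refl
meet-path-end true  false false = refl
meet-path-end false true  true  = refl
meet-path-end false true  false = refl
meet-path-end false false true  = refl
meet-path-end false false false = refl

both-ends : ∀ {d} {h : Bool → Bool} → h (not d) ≡ d → h d ≡ not d → ∀ x → h x ≡ not x
both-ends {true}  e₀ e₁ true  = e₁
both-ends {true}  e₀ e₁ false = e₀
both-ends {false} e₀ e₁ true  = e₀
both-ends {false} e₀ e₁ false = e₁

constant : ∀ {n} d b → (λ (_ : Vec Bool n) → b) ∈[ lattice d ]
constant true  true  = node 1F [] , λ _ → refl
constant true  false = node 2F [] , λ _ → refl
constant false true  = node 1F [] , λ _ → refl
constant false false = node 2F [] , λ _ → refl

-- By absorption g is `meet d` of its first argument and its restriction to `d`.
meet-variable : ∀ {r} d {g : Vec Bool (suc r) → Bool} → (∀ a → g (not d ∷ a) ≡ not d) →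
  (g ∘ (d ∷_)) ∈[ lattice d ] → g ∈[ lattice d ]
meet-variable {r} d {g} absorbs (φ , φ≗g) = form d φ , λ { (b ∷ a) → correct d φ absorbs φ≗g b a }
  where
  form : ∀ d → Formula (lattice d) r → Formula (lattice d) (suc r)
  form true  φ = node 0F (var 0F ∷ substitute φ (map var (Vec.tabulate suc)) ∷ [])
  form false φ = node 0F (var 0F ∷ substitute φ (map var (Vec.tabulate suc)) ∷ [])

  weak : ∀ {O} (φ : Formula O r) b a →
    evalFormula (substitute φ (map var (Vec.tabulate suc))) (b ∷ a) ≡ evalFormula φ a
  weak φ b a = proj₂ (weaken-∈[] {g = evalFormula φ ∘ Vec.tail} (φ , λ _ → refl) (λ _ → refl)) (b ∷ a)

  correct : ∀ d (φ : Formula (lattice d) r) → (∀ a → g (not d ∷ a) ≡ not d) →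
    (∀ a → evalFormula φ a ≡ g (d ∷ a)) → ∀ b a → evalFormula (form d φ) (b ∷ a) ≡ g (b ∷ a)
  correct true  φ abs eq true  a = trans (weak φ true a) (eq a)
  correct true  φ abs eq false a = sym (abs a)
  correct false φ abs eq true  a = sym (abs a)
  correct false φ abs eq false a = trans (weak φ false a) (eq a)

module _ {r : ℕ} (d : Bool) (g : Vec Bool (suc r) → Bool) where

  -- The point c witnesses that g depends on its first argument, and b that
  -- the value not d of that argument does not determine g.
  meet-defect : ∀ {b c} → g (not d ∷ b) ≡ d → g (d ∷ c) ≡ not (g (not d ∷ c)) →
    Negating g ⊎ Corner (not d) g
  meet-defect {b} {c} gb gc with g (not d ∷ c) in gc₀ | g (not d ∷ zipWith (meet d) b c) in ge
  ... | v | w = go d v w refl gb gc gc₀ ge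
    where
    -- Let e be the meet of b and c, with first argument `not d` throughout. If g is d at e and
    -- `not d` at c, the segment between these comparable points exhibits a negation.
    path : ∀ d → g (not d ∷ zipWith (meet d) b c) ≡ d → g (not d ∷ c) ≡ not d → Negating g
    path d e₀ e₁ = negating-∷ {g = g} (not d) (zipWith (meet-path d) b c ,
      both-ends {d} {λ x → g (not d ∷ map (lookup (x ∷ true ∷ false ∷ [])) (zipWith (meet-path d) b c))}
        (trans (cong (g ∘ (not d ∷_)) (map-zipWith-≡ (meet-path-start d) b c)) e₀)
        (trans (cong (g ∘ (not d ∷_)) (map-zipWith-right (meet-path-end d) b c)) e₁))

    flip : ∀ d → g (not d ∷ c) ≡ d → g (d ∷ c) ≡ not d → Negating g
    flip d e₀ e₁ = 0F ∷ map const₃ c , both-ends {d} {λ x → g (x ∷ map (lookup (x ∷ true ∷ false ∷ [])) (map const₃ c))}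
      (trans (cong (g ∘ (not d ∷_)) (map-const₃ (not d) c)) e₀)
      (trans (cong (g ∘ (d ∷_)) (map-const₃ d c)) e₁)

    -- Here g is `not d` at e but d at b and, once the first argument is switched, at c. With e at
    -- the origin these are the three points of a corner; q also drives the first argument.
    corner : ∀ d → g (not d ∷ zipWith (meet d) b c) ≡ not d → g (not d ∷ b) ≡ d → g (d ∷ c) ≡ d →
      Corner (not d) g
    corner true e₀ e₁ e₂ = 2F ∷ zipWith (meet-literal true) b c ,
      trans (cong (g ∘ (false ∷_)) (map-zipWith-≡ (meet-literal-base true) b c)) e₀ ,
      trans (cong (g ∘ (false ∷_)) (map-zipWith-left (meet-literal-left true) b c)) e₁ ,
      trans (cong (g ∘ (true ∷_)) (map-zipWith-right (meet-literal-right true) b c)) e₂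
    corner false e₀ e₁ e₂ = 3F ∷ zipWith (meet-literal false) b c ,
      trans (cong (g ∘ (true ∷_)) (map-zipWith-≡ (meet-literal-base false) b c)) e₀ ,
      trans (cong (g ∘ (true ∷_)) (map-zipWith-left (meet-literal-left false) b c)) e₁ ,
      trans (cong (g ∘ (false ∷_)) (map-zipWith-right (meet-literal-right false) b c)) e₂

    go : ∀ d′ v w → d′ ≡ d → g (not d ∷ b) ≡ d → g (d ∷ c) ≡ not v → g (not d ∷ c) ≡ v →
      g (not d ∷ zipWith (meet d) b c) ≡ w → Negating g ⊎ Corner (not d) g
    go true  true  w     refl gb gc gc₀ ge = inj₁ (flip true gc₀ gc)
    go false false w     refl gb gc gc₀ ge = inj₁ (flip false gc₀ gc)
    go true  false true  refl gb gc gc₀ ge = inj₁ (path true ge gc₀)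
    go true  false false refl gb gc gc₀ ge = inj₂ (corner true ge gb gc)
    go false true  true  refl gb gc gc₀ ge = inj₂ (corner false ge gb gc)
    go false true  false refl gb gc gc₀ ge = inj₁ (path false ge gc₀)

-- Induction on the arity, restricting the first argument to the neutral element. A restriction in
-- the clone extends to g if g ignores its first argument or is absorbed by `not d`; if neither
-- holds, the two witnesses found by `search` are those of `meet-defect`.
classify-meet : ∀ {r} d (g : Vec Bool r → Bool) → g ∈[ lattice d ] ⊎ (Negating g ⊎ Corner (not d) g)
classify-meet {zero} d g = inj₁ (∈[]-cong (λ { [] → refl }) (constant d (g [])))
classify-meet {suc r} d g
  with classify-meet d (g ∘ (d ∷_))
... | inj₂ bad = inj₂ (Sum.map (negating-∷ {g = g} d) (corner-∷ {g = g} d) bad)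
... | inj₁ φ
  with search (λ a → g (false ∷ a) xor g (true ∷ a))
... | inj₂ same = inj₁ (weaken-∈[] (∈[]-cong (λ a → agree d a) φ) λ a → xor-false (same a))
  where
  agree : ∀ d a → g (d ∷ a) ≡ g (false ∷ a)
  agree true  a = sym (xor-false (same a))
  agree false a = refl
... | inj₁ (c , differ)
  with search (λ a → g (not d ∷ a) xor not d)
... | inj₂ absorbs = inj₁ (meet-variable d (λ a → xor-false (absorbs a)) φ)
... | inj₁ (b , gb) = inj₂ (meet-defect d g
        (trans (sym (not-involutive _)) (trans (cong not (sym (xor-true {g (not d ∷ b)} gb))) (not-involutive d)))
        (flipped d))
  where
  flipped : ∀ d → g (d ∷ c) ≡ not (g (not d ∷ c))
  flipped true  = xor-true differ
  flipped false = trans (sym (not-involutive _)) (cong not (sym (xor-true {g (false ∷ c)} differ)))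

path-literal : Bool → Bool → Fin 6
path-literal true  true  = 4F
path-literal false false = 5F
path-literal false true  = 2F
path-literal true  false = 3F

path-literal-start : ∀ p x y → lookup (rails p false) (path-literal x y) ≡ x
path-literal-start p true  true  = refl
path-literal-start p true  false = refl
path-literal-start p false true  = refl
path-literal-start p false false = refl

path-literal-end : ∀ x y → lookup (rails false true) (path-literal x y) ≡ y
path-literal-end true  true  = refl
path-literal-end true  false = refl
path-literal-end false true  = refl
path-literal-end false false = refl

literal∈ : ∀ {r} {g : Vec Bool (suc r) → Bool} u →
  (∀ a → g (false ∷ a) ≡ u) → (∀ a → g (true ∷ a) ≡ not u) → g ∈[ ⟨¬,⊤,⊥⟩ ]
literal∈ false g₀ g₁ = var 0F , λ { (false ∷ a) → sym (g₀ a) ; (true ∷ a) → sym (g₁ a) }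
literal∈ true  g₀ g₁ = node 0F (var 0F ∷ []) , λ { (false ∷ a) → sym (g₀ a) ; (true ∷ a) → sym (g₁ a) }

-- Suppose g depends on its first argument at c. If on one of the two faces some b has another value
-- than c, then p switches the first argument and q moves c to b; both change the value, so their
-- common origin is a corner. Without such a b, g is constant on each face and hence a literal.
classify-literal : ∀ {r} (g : Vec Bool r → Bool) → g ∈[ ⟨¬,⊤,⊥⟩ ] ⊎ Σ[ u ∈ Bool ] Corner u g
classify-literal {zero} g with g [] in eq
... | true  = inj₁ (node 1F [] , λ { [] → sym eq })
... | false = inj₁ (node 2F [] , λ { [] → sym eq })
classify-literal {suc r} g with search (λ a → g (false ∷ a) xor g (true ∷ a))
... | inj₂ same = Sum.map (λ φ → weaken-∈[] φ λ a → xor-false (same a))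
                          (λ { (u , σ) → u , corner-∷ {g = g} false σ })
                          (classify-literal (g ∘ (false ∷_)))
... | inj₁ (c , differ)
  with search (λ a → g (false ∷ c) xor g (false ∷ a)) | search (λ a → g (true ∷ c) xor g (true ∷ a))
... | inj₁ (b , gb) | _ = inj₂ (g (false ∷ c) , 0F ∷ zipWith path-literal c b ,
        cong (g ∘ (false ∷_)) (map-zipWith-left (path-literal-start false) c b) ,
        trans (cong (g ∘ (true ∷_)) (map-zipWith-left (path-literal-start true) c b)) (xor-true differ) ,
        trans (cong (g ∘ (false ∷_)) (map-zipWith-right path-literal-end c b)) (xor-true gb))
... | inj₂ _ | inj₁ (b , gb) = inj₂ (g (true ∷ c) , 1F ∷ zipWith path-literal c b ,
        cong (g ∘ (true ∷_)) (map-zipWith-left (path-literal-start false) c b) ,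
        trans (cong (g ∘ (false ∷_)) (map-zipWith-left (path-literal-start true) c b))
              (trans (sym (not-involutive _)) (cong not (sym (xor-true {g (false ∷ c)} differ)))) ,
        trans (cong (g ∘ (true ∷_)) (map-zipWith-right path-literal-end c b)) (xor-true gb))
... | inj₂ const₀ | inj₂ const₁ = inj₁ (literal∈ (g (false ∷ c))
        (λ a → sym (xor-false (const₀ a)))
        (λ a → trans (sym (xor-false (const₁ a))) (xor-true differ)))

-- Contexts over literals

Context : Basis → Bool → Set
Context O u = Σ[ φ ∈ Formula O 6 ]
  evalFormula φ (rails false false) ≡ u ×
  evalFormula φ (rails true false) ≡ not u ×
  evalFormula φ (rails false true) ≡ not u

XorContext : Basis → Set
XorContext O = Σ[ φ ∈ Formula O 6 ] (∀ p q → evalFormula φ (rails p q) ≡ p xor q)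

corner⇒context : ∀ {O u} i → Corner u (Basis.op O i) → Context O u
corner⇒context {O} i (σ , e₀ , e₁ , e₂) = node i (map var σ) ,
  trans (cong (Basis.op O i) (evalFormulas-map-var σ _)) e₀ ,
  trans (cong (Basis.op O i) (evalFormulas-map-var σ _)) e₁ ,
  trans (cong (Basis.op O i) (evalFormulas-map-var σ _)) e₂

negate-context : ∀ {O u} i → Negating (Basis.op O i) → Context O u → Context O (not u)
negate-context {O} {u} i (σ , neg) (φ , e₀ , e₁ , e₂) =
  node i (map (lookup args) σ) , value e₀ , value e₁ , value e₂
  where
  args : Vec (Formula O 6) 3
  args = φ ∷ var 4F ∷ var 5F ∷ []

  value : ∀ {p q v} → evalFormula φ (rails p q) ≡ v →
    evalFormula (node i (map (lookup args) σ)) (rails p q) ≡ not v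
  value {p} {q} {v} e = begin
    Basis.op O i (evalFormulas (map (lookup args) σ) (rails p q))
      ≡⟨ cong (Basis.op O i) (evalFormulas-map-lookup args σ (rails p q)) ⟩
    Basis.op O i (map (lookup (evalFormula φ (rails p q) ∷ true ∷ false ∷ [])) σ)
      ≡⟨ neg _ ⟩
    not (evalFormula φ (rails p q))
      ≡⟨ cong not e ⟩
    not v ∎
    where open ≡-Reasoning

module _ {O : Basis} where

  swap-left : Vec (Formula O 6) 6
  swap-left = var 1F ∷ var 0F ∷ var 2F ∷ var 3F ∷ var 4F ∷ var 5F ∷ []

  swap-right : Vec (Formula O 6) 6
  swap-right = var 0F ∷ var 1F ∷ var 3F ∷ var 2F ∷ var 4F ∷ var 5F ∷ []

  eval-swap-left : ∀ φ p q → evalFormula (substitute φ swap-left) (rails p q) ≡ evalFormula φ (rails (not p) q)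
  eval-swap-left φ p q = trans (eval-substitute φ swap-left (rails p q))
    (cong (λ x → evalFormula φ (not p ∷ x ∷ q ∷ not q ∷ true ∷ false ∷ [])) (sym (not-involutive p)))

  eval-swap-right : ∀ φ p q → evalFormula (substitute φ swap-right) (rails p q) ≡ evalFormula φ (rails p (not q))
  eval-swap-right φ p q = trans (eval-substitute φ swap-right (rails p q))
    (cong (λ x → evalFormula φ (p ∷ not p ∷ not q ∷ x ∷ true ∷ false ∷ [])) (sym (not-involutive q)))

  -- Only the values at (1,1) are open. If α is 0 there, it is the exclusive or; if β is 1 there, it
  -- is the negated one, repaired by exchanging the rails of p. Otherwise α is "or" and β is "nor",
  -- and α is applied to p ∧ ¬q and ¬p ∧ q, each accompanied by its negation.
  contexts⇒xor : Context O false → Context O true → XorContext O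
  contexts⇒xor (α , α₀₀ , α₁₀ , α₀₁) (β , β₀₀ , β₁₀ , β₀₁)
    with evalFormula α (rails true true) in α₁₁ | evalFormula β (rails true true) in β₁₁
  ... | false | _     = α , λ { false false → α₀₀ ; false true → α₀₁ ; true false → α₁₀ ; true true → α₁₁ }
  ... | true  | true  = substitute β swap-left , λ
    { false false → trans (eval-swap-left β false false) β₁₀
    ; false true  → trans (eval-swap-left β false true) β₁₁
    ; true  false → trans (eval-swap-left β true false) β₀₀
    ; true  true  → trans (eval-swap-left β true true) β₀₁ }
  ... | true  | false = substitute α parts , correct
    where
    α-or : ∀ p q → evalFormula α (rails p q) ≡ p ∨ q
    α-or false false = α₀₀
    α-or false true  = α₀₁
    α-or true  false = α₁₀
    α-or true  true  = α₁₁

    β-nor : ∀ p q → evalFormula β (rails p q) ≡ not (p ∨ q)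
    β-nor false false = β₀₀
    β-nor false true  = β₀₁
    β-nor true  false = β₁₀
    β-nor true  true  = β₁₁

    parts : Vec (Formula O 6) 6
    parts = substitute β swap-left ∷ substitute α swap-left
          ∷ substitute β swap-right ∷ substitute α swap-right ∷ var 4F ∷ var 5F ∷ []

    combine : ∀ {p q a ā b b̄} → a ≡ not (not p ∨ q) → ā ≡ not p ∨ q →
      b ≡ not (p ∨ not q) → b̄ ≡ p ∨ not q →
      evalFormula α (a ∷ ā ∷ b ∷ b̄ ∷ true ∷ false ∷ []) ≡ p xor q
    combine {false} {false} refl refl refl refl = α-or false false
    combine {false} {true}  refl refl refl refl = α-or false true
    combine {true}  {false} refl refl refl refl = α-or true false
    combine {true}  {true}  refl refl refl refl = α-or false false

    correct : ∀ p q → evalFormula (substitute α parts) (rails p q) ≡ p xor q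
    correct p q = trans (eval-substitute α parts (rails p q)) (combine {p} {q}
      (trans (eval-swap-left β p q) (β-nor (not p) q))
      (trans (eval-swap-left α p q) (α-or (not p) q))
      (trans (eval-swap-right β p q) (β-nor p (not q)))
      (trans (eval-swap-right α p q) (α-or p (not q))))

all-or-some : ∀ {n} {P Q : Fin n → Set} → (∀ i → P i ⊎ Q i) → (∀ i → P i) ⊎ Σ (Fin n) Q
all-or-some {zero}  dec = inj₁ λ ()
all-or-some {suc n} dec with dec zero | all-or-some (dec ∘ suc)
... | inj₂ q | _            = inj₂ (zero , q)
... | inj₁ p | inj₂ (i , q) = inj₂ (suc i , q)
... | inj₁ p | inj₁ ps      = inj₁ λ { zero → p ; (suc i) → ps i }

Tractable : Basis → Set
Tractable O = O ⪯ ⟨∧,⊤,⊥⟩ ⊎ O ⪯ ⟨∨,⊤,⊥⟩ ⊎ O ⪯ ⟨¬,⊤,⊥⟩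

-- Leaving the ∧-clone yields a negation or a corner of value false, leaving the ∨-clone a negation
-- or a corner of value true, and leaving the ¬-clone some corner. Either both corners come from the
-- first two, or a negation turns the third into the missing one.
tractable-or-xor : ∀ O → Tractable O ⊎ XorContext O
tractable-or-xor O
  with all-or-some (λ i → classify-meet true (Basis.op O i))
     | all-or-some (λ i → classify-meet false (Basis.op O i))
     | all-or-some (λ i → classify-literal (Basis.op O i))
... | inj₁ ∧s | _ | _ = inj₁ (inj₁ (⪯-from-ops ∧s))
... | inj₂ _ | inj₁ ∨s | _ = inj₁ (inj₂ (inj₁ (⪯-from-ops ∨s)))
... | inj₂ _ | inj₂ _ | inj₁ ¬s = inj₁ (inj₂ (inj₂ (⪯-from-ops ¬s)))
... | inj₂ (i , inj₂ α) | inj₂ (j , inj₂ β) | inj₂ _ =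
  inj₂ (contexts⇒xor (corner⇒context i α) (corner⇒context j β))
... | inj₂ (i , inj₁ neg) | _ | inj₂ (k , false , γ) =
  inj₂ (contexts⇒xor (corner⇒context k γ) (negate-context i neg (corner⇒context k γ)))
... | inj₂ (i , inj₁ neg) | _ | inj₂ (k , true , γ) =
  inj₂ (contexts⇒xor (negate-context i neg (corner⇒context k γ)) (corner⇒context k γ))
... | inj₂ _ | inj₂ (j , inj₁ neg) | inj₂ (k , false , γ) =
  inj₂ (contexts⇒xor (corner⇒context k γ) (negate-context j neg (corner⇒context k γ)))
... | inj₂ _ | inj₂ (j , inj₁ neg) | inj₂ (k , true , γ) =
  inj₂ (contexts⇒xor (negate-context j neg (corner⇒context k γ)) (corner⇒context k γ))

-- Circuits and formulas

module _ {O : Basis} {n : ℕ} where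

  -- Sharing is lost, so the formulas may be exponentially large; they serve only as witnesses of
  -- membership in the clone.
  unfold : ∀ {m} → Nodes O n m → Vec (Formula O n) m
  unfold ∅                = []
  unfold (ns ▸ input x)   = var x ∷ unfold ns
  unfold (ns ▸ gate i js) = node i (map (lookup (unfold ns)) js) ∷ unfold ns

  values-unfold : ∀ {m} (ns : Nodes O n m) a → evalFormulas (unfold ns) a ≡ values ns a
  values-unfold ∅                a = refl
  values-unfold (ns ▸ input x)   a = cong (_ ∷_) (values-unfold ns a)
  values-unfold (ns ▸ gate i js) a = cong₂ _∷_
    (cong (Basis.op O i) (trans (evalFormulas-map-lookup (unfold ns) js a)
                                (cong (λ vs → map (lookup vs) js) (values-unfold ns a))))
    (values-unfold ns a)

  circuit∈ : (C : Circuit O n) → RepresentationClass.eval (CIR O) C ∈[ O ]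
  circuit∈ C = lookup (unfold nodes) output , λ a →
    trans (sym (lookup-evalFormulas (unfold nodes) output a))
          (cong (λ vs → lookup vs output) (values-unfold nodes a))
    where open Circuit C

  -- What compiling formulas on top of `ns` produces. The number of nodes is tied to k + m by an
  -- equation and not by an index, since the arguments of a gate, compiled in succession, add up in
  -- another order.
  record Extension {m} (ns : Nodes O n m) (k r : ℕ) (bs : Vec Bool n → Vec Bool r) : Set where
    field
      {total}  : ℕ
      total≡   : total ≡ k + m
      nodes    : Nodes O n total
      outputs  : Vec (Fin total) r
      correct  : ∀ a → map (lookup (values nodes a)) outputs ≡ bs a
      old      : Fin m → Fin total
      old-same : ∀ a x → lookup (values nodes a) (old x) ≡ lookup (values ns a) x

  open Extension

  map-lookup-old : ∀ {m k r bs} {ns : Nodes O n m} (e : Extension ns k r bs) {q} (js : Vec (Fin m) q) a →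
    map (lookup (values (nodes e) a)) (map (old e) js) ≡ map (lookup (values ns a)) js
  map-lookup-old e []       a = refl
  map-lookup-old e (j ∷ js) a = cong₂ _∷_ (old-same e a j) (map-lookup-old e js a)

  mutual
    extend : ∀ {m} (φ : Formula O n) (ns : Nodes O n m) →
      Extension ns (formulaSize φ) 1 (λ a → evalFormula φ a ∷ [])
    extend (var x) ns = record
      { total≡ = refl ; nodes = ns ▸ input x ; outputs = zero ∷ [] ; correct = λ a → refl
      ; old = suc ; old-same = λ a x → refl }
    extend (node i φs) ns = record
      { total≡ = cong suc (total≡ e) ; nodes = nodes e ▸ gate i (outputs e) ; outputs = zero ∷ []
      ; correct = λ a → cong (λ bs → Basis.op O i bs ∷ []) (correct e a)
      ; old = suc ∘ old e ; old-same = old-same e }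
      where
      e : Extension ns (formulaSizes φs) (Basis.arity O i) (evalFormulas φs)
      e = extends φs ns

    extends : ∀ {m r} (φs : Vec (Formula O n) r) (ns : Nodes O n m) →
      Extension ns (formulaSizes φs) r (evalFormulas φs)
    extends []       ns = record
      { total≡ = refl ; nodes = ns ; outputs = [] ; correct = λ a → refl
      ; old = λ x → x ; old-same = λ a x → refl }
    extends {m} (φ ∷ φs) ns = record
      { total≡ = begin
          total e₂                                   ≡⟨ total≡ e₂ ⟩
          formulaSizes φs + total e₁                 ≡⟨ cong (λ x → formulaSizes φs + x) (total≡ e₁) ⟩
          formulaSizes φs + (formulaSize φ + m)      ≡⟨ ℕₚ.+-assoc (formulaSizes φs) _ m ⟨
          formulaSizes φs + formulaSize φ + m        ≡⟨ cong (_+ m) (ℕₚ.+-comm (formulaSizes φs) _) ⟩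
          formulaSize φ + formulaSizes φs + m        ∎
      ; nodes = nodes e₂
      ; outputs = map (old e₂) (outputs e₁) Vec.++ outputs e₂
      ; correct = λ a → begin
          map (lookup (values (nodes e₂) a)) (map (old e₂) (outputs e₁) Vec.++ outputs e₂)
            ≡⟨ Vecₚ.map-++ _ (map (old e₂) (outputs e₁)) (outputs e₂) ⟩
          map (lookup (values (nodes e₂) a)) (map (old e₂) (outputs e₁))
            Vec.++ map (lookup (values (nodes e₂) a)) (outputs e₂)
            ≡⟨ cong₂ Vec._++_ (trans (map-lookup-old e₂ (outputs e₁) a) (correct e₁ a)) (correct e₂ a) ⟩
          evalFormula φ a ∷ evalFormulas φs a ∎
      ; old = old e₂ ∘ old e₁
      ; old-same = λ a x → trans (old-same e₂ a (old e₁ x)) (old-same e₁ a x) }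
      where
      open ≡-Reasoning
      e₁ : Extension ns (formulaSize φ) 1 (λ a → evalFormula φ a ∷ [])
      e₁ = extend φ ns
      e₂ : Extension (nodes e₁) (formulaSizes φs) _ (evalFormulas φs)
      e₂ = extends φs (nodes e₁)

Expresses : RepresentationClass → Basis → Set
Expresses 𝒞 O = ∀ {n} (φ : Formula O n) →
  Σ[ c ∈ Member n ] size c ≤ formulaSize φ × (∀ a → eval c a ≡ evalFormula φ a)
  where open RepresentationClass 𝒞

PL-expresses : ∀ O → Expresses (PL O) O
PL-expresses O φ = φ , ℕₚ.≤-refl , λ a → refl

CIR-expresses : ∀ O → Expresses (CIR O) O
CIR-expresses O φ =
  record { nodes = nodes e ; output = Vec.head (outputs e) } ,
  ℕₚ.≤-reflexive (trans (total≡ e) (ℕₚ.+-identityʳ _)) ,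
  λ a → trans (sym (head-map (lookup (values (nodes e) a)) (outputs e))) (cong Vec.head (correct e a))
  where
  open Extension
  e : Extension ∅ (formulaSize φ) 1 (λ a → evalFormula φ a ∷ [])
  e = extend φ ∅
  head-map : ∀ {A B : Set} {k} (f : A → B) (xs : Vec A (suc k)) → Vec.head (map f xs) ≡ f (Vec.head xs)
  head-map f (x ∷ xs) = refl

-- Parities

xorAll : ∀ {m} → (Fin m → Bool) → Bool
xorAll {zero}  f = false
xorAll {suc m} f = f zero xor xorAll (f ∘ suc)

xorAll-+ : ∀ m {k} (f : Fin (m + k) → Bool) → xorAll f ≡ xorAll (f ∘ (_↑ˡ k)) xor xorAll (f ∘ (m ↑ʳ_))
xorAll-+ zero    f = refl
xorAll-+ (suc m) f = trans (cong (f zero xor_) (xorAll-+ m (f ∘ suc))) (sym (xor-assoc (f zero) _ _))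

inner : ∀ {m} → Vec Bool m → Vec Bool m → Bool
inner S b = xorAll λ i → lookup S i ∧ lookup b i

-- The power 2^d, defined so that `Fin (double^ (suc d))` splits into two halves without transport.
double^ : ℕ → ℕ
double^ zero    = 1
double^ (suc d) = double^ d + double^ d

double^≡2^ : ∀ d → double^ d ≡ 2 ^ d
double^≡2^ zero    = refl
double^≡2^ (suc d) = cong₂ _+_ (double^≡2^ d) (trans (double^≡2^ d) (sym (ℕₚ.+-identityʳ _)))

formulaSize≥1 : ∀ {O n} (φ : Formula O n) → 1 ≤ formulaSize φ
formulaSize≥1 (var x)     = s≤s z≤n
formulaSize≥1 (node i φs) = s≤s z≤n

Computes : ∀ {O n} → Vec Bool n → Bool → Formula O n × Formula O n → Set
Computes a b (φ , φ̄) = evalFormula φ a ≡ b × evalFormula φ̄ a ≡ not b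

module _ {O : Basis} (X : XorContext O) {n : ℕ} (⊤ₓ ⊥ₓ : Fin n) where

  private
    c : ℕ
    c = formulaSize (proj₁ X)

  xor-gate : (φ φ̄ ψ ψ̄ : Formula O n) → Formula O n
  xor-gate φ φ̄ ψ ψ̄ = substitute (proj₁ X) (φ ∷ φ̄ ∷ ψ ∷ ψ̄ ∷ var ⊤ₓ ∷ var ⊥ₓ ∷ [])

  -- Each formula travels with its negation, because the context reads both rails; exchanging the
  -- rails of the left argument negates an exclusive or.
  parity : ∀ d → (Fin (double^ d) → Formula O n × Formula O n) → Formula O n × Formula O n
  parity zero    leaf = leaf zero
  parity (suc d) leaf =
    xor-gate (proj₁ φ) (proj₂ φ) (proj₁ ψ) (proj₂ ψ) , xor-gate (proj₂ φ) (proj₁ φ) (proj₁ ψ) (proj₂ ψ)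
    where
    φ ψ : Formula O n × Formula O n
    φ = parity d (leaf ∘ (_↑ˡ double^ d))
    ψ = parity d (leaf ∘ (double^ d ↑ʳ_))

  size-xor-gate : ∀ {M φ φ̄ ψ ψ̄} → 1 ≤ M → formulaSize φ ≤ M → formulaSize φ̄ ≤ M →
    formulaSize ψ ≤ M → formulaSize ψ̄ ≤ M → formulaSize (xor-gate φ φ̄ ψ ψ̄) ≤ c * M
  size-xor-gate 1≤M φ≤ φ̄≤ ψ≤ ψ̄≤ = size-substitute _ 1≤M
    (λ { 0F → φ≤ ; 1F → φ̄≤ ; 2F → ψ≤ ; 3F → ψ̄≤ ; 4F → 1≤M ; 5F → 1≤M }) (proj₁ X)

  -- Since the context may repeat its arguments, every level multiplies the size by c. Depth d for
  -- 2^d leaves keeps this polynomial, where a chain of gates could give an exponential size.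
  size-parity : ∀ d leaf → (∀ i → formulaSize (proj₁ (leaf i)) ≤ 1 × formulaSize (proj₂ (leaf i)) ≤ 1) →
    formulaSize (proj₁ (parity d leaf)) ≤ c ^ d × formulaSize (proj₂ (parity d leaf)) ≤ c ^ d
  size-parity zero    leaf small = small zero
  size-parity (suc d) leaf small
    with size-parity d (leaf ∘ (_↑ˡ double^ d)) (small ∘ (_↑ˡ double^ d))
       | size-parity d (leaf ∘ (double^ d ↑ʳ_)) (small ∘ (double^ d ↑ʳ_))
  ... | φ≤ , φ̄≤ | ψ≤ , ψ̄≤ = size-xor-gate 1≤M φ≤ φ̄≤ ψ≤ ψ̄≤ , size-xor-gate 1≤M φ̄≤ φ≤ ψ≤ ψ̄≤
    where
    1≤M : 1 ≤ c ^ d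
    1≤M = ℕₚ.≤-trans (ℕₚ.≤-reflexive (sym (ℕₚ.^-zeroˡ d))) (ℕₚ.^-monoˡ-≤ d (formulaSize≥1 (proj₁ X)))

  module _ {a : Vec Bool n} (⊤≡ : lookup a ⊤ₓ ≡ true) (⊥≡ : lookup a ⊥ₓ ≡ false) where

    eval-xor-gate : ∀ {φ φ̄ ψ ψ̄ p q} → Computes a p (φ , φ̄) → Computes a q (ψ , ψ̄) →
      evalFormula (xor-gate φ φ̄ ψ ψ̄) a ≡ p xor q
    eval-xor-gate {p = p} {q} (eφ , eφ̄) (eψ , eψ̄) = trans (eval-substitute (proj₁ X) _ a)
      (trans (cong (evalFormula (proj₁ X)) (cong₂ _∷_ eφ (cong₂ _∷_ eφ̄ (cong₂ _∷_ eψ (cong₂ _∷_ eψ̄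
               (cong₂ (λ x y → x ∷ y ∷ []) ⊤≡ ⊥≡))))))
             (proj₂ X p q))

    eval-parity : ∀ d leaf (b : Fin (double^ d) → Bool) → (∀ i → Computes a (b i) (leaf i)) →
      Computes a (xorAll b) (parity d leaf)
    eval-parity zero leaf b spec = subst (λ x → Computes a x (leaf zero)) (sym (xor-identityʳ (b zero))) (spec zero)
    eval-parity (suc d) leaf b spec =
      subst (λ x → Computes a x (parity (suc d) leaf)) (sym (xorAll-+ (double^ d) b))
        (eval-xor-gate eφ eψ ,
         trans (eval-xor-gate (proj₂ eφ , trans (proj₁ eφ) (sym (not-involutive _))) eψ) (sym (not-distribˡ-xor (xorAll (b ∘ (_↑ˡ double^ d))) _)))
      where
      eφ : Computes a (xorAll (b ∘ (_↑ˡ double^ d))) (parity d (leaf ∘ (_↑ˡ double^ d)))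
      eφ = eval-parity d _ _ (spec ∘ (_↑ˡ double^ d))
      eψ : Computes a (xorAll (b ∘ (double^ d ↑ʳ_))) (parity d (leaf ∘ (double^ d ↑ʳ_)))
      eψ = eval-parity d _ _ (spec ∘ (double^ d ↑ʳ_))

-- The distribution supplies constants and negated variables, so that the
-- basis need not.
encode : ∀ {m} → Vec Bool m → Vec Bool (2 + (m + m))
encode b = true ∷ false ∷ (b Vec.++ map not b)

parity-formula : ∀ {O} (X : XorContext O) d (S : Vec Bool (double^ d)) →
  Σ[ φ ∈ Formula O (2 + (double^ d + double^ d)) ]
    formulaSize φ ≤ formulaSize (proj₁ X) ^ d × (∀ b → evalFormula φ (encode b) ≡ inner S b)
parity-formula {O} X d S =
  proj₁ (parity X zero (suc zero) d leaf) ,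
  proj₁ (size-parity X zero (suc zero) d leaf small) ,
  λ b → proj₁ (eval-parity X zero (suc zero) refl refl d leaf _ (spec b))
  where
  m : ℕ
  m = double^ d

  rail : Bool → Fin m → Formula O (2 + (m + m)) × Formula O (2 + (m + m))
  rail true  i = var (2 ↑ʳ (i ↑ˡ m)) , var (2 ↑ʳ (m ↑ʳ i))
  -- A coordinate outside S contributes false, read off the second bit of the encoding.
  rail false i = var (suc zero) , var zero

  leaf : Fin m → Formula O (2 + (m + m)) × Formula O (2 + (m + m))
  leaf i = rail (lookup S i) i

  small : ∀ i → formulaSize (proj₁ (leaf i)) ≤ 1 × formulaSize (proj₂ (leaf i)) ≤ 1
  small i with lookup S i
  ... | true  = ℕₚ.≤-refl , ℕₚ.≤-refl
  ... | false = ℕₚ.≤-refl , ℕₚ.≤-refl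

  spec : ∀ b i → Computes (encode b) (lookup S i ∧ lookup b i) (leaf i)
  spec b i with lookup S i
  ... | true  = Vecₚ.lookup-++ˡ b (map not b) i ,
                trans (Vecₚ.lookup-++ʳ b (map not b) i) (Vecₚ.lookup-map i not b)
  ... | false = refl , refl

n<2^n : ∀ n → n < 2 ^ n
n<2^n zero    = s≤s z≤n
n<2^n (suc n) = begin-strict
  suc n              ≤⟨ n<2^n n ⟩
  2 ^ n              <⟨ ℕₚ.m<m+n (2 ^ n) (ℕₚ.≤-trans (ℕₚ.m^n>0 2 n) (ℕₚ.m≤m+n (2 ^ n) 0)) ⟩
  2 ^ suc n          ∎
  where open ℕₚ.≤-Reasoning

-- Rational numbers

fromℤ : ℤ → ℚ
fromℤ z = z ℚ./ 1

toℚᵘ-fromℤ : ∀ z → ℚ.toℚᵘ (fromℤ z) ℚᵘ.≃ ℚᵘ.mkℚᵘ z 0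
toℚᵘ-fromℤ z = ℚₚ.toℚᵘ-fromℚᵘ (ℚᵘ.mkℚᵘ z 0)

fromℤ-+ : ∀ i j → fromℤ (i ℤ.+ j) ≡ fromℤ i ℚ.+ fromℤ j
fromℤ-+ i j = ℚₚ.toℚᵘ-injective (begin
  ℚ.toℚᵘ (fromℤ (i ℤ.+ j))                   ≈⟨ toℚᵘ-fromℤ (i ℤ.+ j) ⟩
  ℚᵘ.mkℚᵘ (i ℤ.+ j) 0                        ≈⟨ ℚᵘ.*≡* (cong (ℤ._* + 1) (cong₂ ℤ._+_ (sym (ℤₚ.*-identityʳ i)) (sym (ℤₚ.*-identityʳ j)))) ⟩
  ℚᵘ.mkℚᵘ i 0 ℚᵘ.+ ℚᵘ.mkℚᵘ j 0               ≈⟨ ℚᵘₚ.+-cong (toℚᵘ-fromℤ i) (toℚᵘ-fromℤ j) ⟨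
  ℚ.toℚᵘ (fromℤ i) ℚᵘ.+ ℚ.toℚᵘ (fromℤ j)     ≈⟨ ℚₚ.toℚᵘ-homo-+ (fromℤ i) (fromℤ j) ⟨
  ℚ.toℚᵘ (fromℤ i ℚ.+ fromℤ j)               ∎)
  where open ℚᵘₚ.≃-Reasoning

ℕ→ℚ-+ : ∀ m n → ℕ→ℚ (m + n) ≡ ℕ→ℚ m ℚ.+ ℕ→ℚ n
ℕ→ℚ-+ m n = trans (cong fromℤ (ℤₚ.pos-+ m n)) (fromℤ-+ (+ m) (+ n))

ℕ→ℚ-suc : ∀ n → ℕ→ℚ (suc n) ≡ 1ℚ ℚ.+ ℕ→ℚ n
ℕ→ℚ-suc = ℕ→ℚ-+ 1

ℕ→ℚ-* : ∀ m n → ℕ→ℚ (m * n) ≡ ℕ→ℚ m ℚ.* ℕ→ℚ n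
ℕ→ℚ-* zero    n = sym (ℚₚ.*-zeroˡ (ℕ→ℚ n))
ℕ→ℚ-* (suc m) n = begin
  ℕ→ℚ (n + m * n)                     ≡⟨ ℕ→ℚ-+ n (m * n) ⟩
  ℕ→ℚ n ℚ.+ ℕ→ℚ (m * n)               ≡⟨ cong (ℕ→ℚ n ℚ.+_) (ℕ→ℚ-* m n) ⟩
  ℕ→ℚ n ℚ.+ ℕ→ℚ m ℚ.* ℕ→ℚ n           ≡⟨ solve 2 (λ m n → n ⊞ m ⊠ n := (κ 1ℚ ⊞ m) ⊠ n) refl (ℕ→ℚ m) (ℕ→ℚ n) ⟩
  (1ℚ ℚ.+ ℕ→ℚ m) ℚ.* ℕ→ℚ n            ≡⟨ cong (ℚ._* ℕ→ℚ n) (ℕ→ℚ-suc m) ⟨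
  ℕ→ℚ (suc m) ℚ.* ℕ→ℚ n               ∎
  where open ≡-Reasoning

0≤1 : 0ℚ ℚ.≤ 1ℚ
0≤1 = ℚₚ.≤ᵇ⇒≤ _

0≤½ : 0ℚ ℚ.≤ ½
0≤½ = ℚₚ.≤ᵇ⇒≤ _

+-nonneg : ∀ {p q} → 0ℚ ℚ.≤ p → 0ℚ ℚ.≤ q → 0ℚ ℚ.≤ p ℚ.+ q
+-nonneg = ℚₚ.+-mono-≤

*-nonneg : ∀ {p q} → 0ℚ ℚ.≤ p → 0ℚ ℚ.≤ q → 0ℚ ℚ.≤ p ℚ.* q
*-nonneg {p} {q} 0≤p 0≤q = subst (ℚ._≤ p ℚ.* q) (ℚₚ.*-zeroˡ q)
  (ℚₚ.*-monoʳ-≤-nonNeg q {{ℚ.nonNegative 0≤q}} 0≤p)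

*-monoˡ : ∀ {p q} r → 0ℚ ℚ.≤ r → p ℚ.≤ q → r ℚ.* p ℚ.≤ r ℚ.* q
*-monoˡ r 0≤r = ℚₚ.*-monoˡ-≤-nonNeg r {{ℚ.nonNegative 0≤r}}

*-monoʳ : ∀ {p q} r → 0ℚ ℚ.≤ r → p ℚ.≤ q → p ℚ.* r ℚ.≤ q ℚ.* r
*-monoʳ r 0≤r = ℚₚ.*-monoʳ-≤-nonNeg r {{ℚ.nonNegative 0≤r}}

*-mono : ∀ {p q r s} → 0ℚ ℚ.≤ p → 0ℚ ℚ.≤ s → p ℚ.≤ q → r ℚ.≤ s → p ℚ.* r ℚ.≤ q ℚ.* s
*-mono {p} {q} {r} {s} 0≤p 0≤s p≤q r≤s = ℚₚ.≤-trans (*-monoˡ p 0≤p r≤s) (*-monoʳ s 0≤s p≤q)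

0≤ℕ→ℚ : ∀ n → 0ℚ ℚ.≤ ℕ→ℚ n
0≤ℕ→ℚ zero    = ℚₚ.≤-refl
0≤ℕ→ℚ (suc n) = subst (0ℚ ℚ.≤_) (sym (ℕ→ℚ-suc n)) (+-nonneg 0≤1 (0≤ℕ→ℚ n))

ℕ→ℚ-mono : ∀ {m n} → m ≤ n → ℕ→ℚ m ℚ.≤ ℕ→ℚ n
ℕ→ℚ-mono {n = n} z≤n = 0≤ℕ→ℚ n
ℕ→ℚ-mono (s≤s {m} {n} m≤n) = subst₂ ℚ._≤_ (sym (ℕ→ℚ-suc m)) (sym (ℕ→ℚ-suc n))
  (ℚₚ.+-monoʳ-≤ 1ℚ (ℕ→ℚ-mono m≤n))

1≤ℕ→ℚ-suc : ∀ n → 1ℚ ℚ.≤ ℕ→ℚ (suc n)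
1≤ℕ→ℚ-suc n = ℕ→ℚ-mono {1} {suc n} (s≤s z≤n)

ℕ→ℚ-suc-positive : ∀ n → ℚ.Positive (ℕ→ℚ (suc n))
ℕ→ℚ-suc-positive n = ℚ.positive (ℚₚ.<-≤-trans (ℚₚ.positive⁻¹ 1ℚ) (1≤ℕ→ℚ-suc n))

ℕ→ℚ-cancel-≤ : ∀ m n → ℕ→ℚ m ℚ.≤ ℕ→ℚ n → m ≤ n
ℕ→ℚ-cancel-≤ m n le with m ℕₚ.≤? n
... | yes m≤n = m≤n
... | no  m≰n = contradiction (ℚₚ.<-≤-trans strict le) (ℚₚ.<-irrefl refl)
  where
  strict : ℕ→ℚ n ℚ.< ℕ→ℚ m
  strict = ℚₚ.<-≤-trans (subst₂ ℚ._<_ (ℚₚ.+-identityˡ _) (sym (ℕ→ℚ-suc n)) (ℚₚ.+-monoˡ-< (ℕ→ℚ n) (ℚₚ.positive⁻¹ 1ℚ)))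
                        (ℕ→ℚ-mono {suc n} {m} (ℕₚ.≰⇒> m≰n))

unit-fraction : ∀ n .{{_ : ℕ.NonZero n}} → (+ 1 ℚ./ n) ℚ.* ℕ→ℚ n ≡ 1ℚ
unit-fraction (suc n) = ℚₚ.toℚᵘ-injective (begin
  ℚ.toℚᵘ ((+ 1 ℚ./ suc n) ℚ.* ℕ→ℚ (suc n))           ≈⟨ ℚₚ.toℚᵘ-homo-* (+ 1 ℚ./ suc n) (ℕ→ℚ (suc n)) ⟩
  ℚ.toℚᵘ (+ 1 ℚ./ suc n) ℚᵘ.* ℚ.toℚᵘ (ℕ→ℚ (suc n))   ≈⟨ ℚᵘₚ.*-cong (ℚₚ.toℚᵘ-fromℚᵘ (ℚᵘ.mkℚᵘ (+ 1) n)) (toℚᵘ-fromℤ (+ suc n)) ⟩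
  ℚᵘ.mkℚᵘ (+ 1) n ℚᵘ.* ℚᵘ.mkℚᵘ (+ suc n) 0           ≈⟨ ℚᵘ.*≡* (cong +_ (trans (ℕₚ.*-identityʳ _) (cong suc (sym (eq n))))) ⟩
  ℚ.toℚᵘ 1ℚ                                          ∎)
  where
  open ℚᵘₚ.≃-Reasoning
  eq : ∀ n → n * 1 + 0 ≡ n + 0
  eq n = cong (_+ 0) (ℕₚ.*-identityʳ n)

-p≤∣p∣ : ∀ p → ℚ.- p ℚ.≤ ℚ.∣ p ∣
-p≤∣p∣ p with ℚₚ.∣p∣≡p∨∣p∣≡-p p
... | inj₁ eq = ℚₚ.≤-trans (ℚₚ.neg-antimono-≤ 0≤p) (ℚₚ.0≤∣p∣ p)
  where
  0≤p : 0ℚ ℚ.≤ p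
  0≤p = subst (0ℚ ℚ.≤_) eq (ℚₚ.0≤∣p∣ p)
... | inj₂ eq = ℚₚ.≤-reflexive (sym eq)

0≤1/1+ : ∀ k → 0ℚ ℚ.≤ 1/1+ k
0≤1/1+ k = ℚₚ.*-cancelʳ-≤-pos (ℕ→ℚ (suc k)) {{ℕ→ℚ-suc-positive k}}
  (subst₂ ℚ._≤_ (sym (ℚₚ.*-zeroˡ (ℕ→ℚ (suc k)))) (sym (unit-fraction (suc k))) 0≤1)

half^ : ℕ → ℚ
half^ zero    = 1ℚ
half^ (suc k) = ½ ℚ.* half^ k

0≤half^ : ∀ k → 0ℚ ℚ.≤ half^ k
0≤half^ zero    = 0≤1
0≤half^ (suc k) = *-nonneg 0≤½ (0≤half^ k)

half^-inverse : ∀ k → half^ k ℚ.* ℕ→ℚ (2 ^ k) ≡ 1ℚ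
half^-inverse zero    = refl
half^-inverse (suc k) = begin
  ½ ℚ.* half^ k ℚ.* ℕ→ℚ (2 * 2 ^ k)                 ≡⟨ cong (½ ℚ.* half^ k ℚ.*_) (ℕ→ℚ-* 2 (2 ^ k)) ⟩
  ½ ℚ.* half^ k ℚ.* (ℕ→ℚ 2 ℚ.* ℕ→ℚ (2 ^ k))         ≡⟨ solve 2 (λ h t → κ ½ ⊠ h ⊠ (κ (ℕ→ℚ 2) ⊠ t) := h ⊠ t) refl (half^ k) (ℕ→ℚ (2 ^ k)) ⟩
  half^ k ℚ.* ℕ→ℚ (2 ^ k)                           ≡⟨ half^-inverse k ⟩
  1ℚ                                                ∎
  where open ≡-Reasoning

half^-+ : ∀ j k → half^ (j + k) ≡ half^ j ℚ.* half^ k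
half^-+ zero    k = sym (ℚₚ.*-identityˡ (half^ k))
half^-+ (suc j) k = trans (cong (½ ℚ.*_) (half^-+ j k)) (sym (ℚₚ.*-assoc ½ (half^ j) (half^ k)))

uniform≡half^ : ∀ t a → uniform t a ≡ half^ t
uniform≡half^ t a = begin
  u                                             ≡⟨ ℚₚ.*-identityʳ u ⟨
  u ℚ.* 1ℚ                                      ≡⟨ cong (u ℚ.*_) (trans (ℚₚ.*-comm (ℕ→ℚ (2 ^ t)) (half^ t)) (half^-inverse t)) ⟨
  u ℚ.* (ℕ→ℚ (2 ^ t) ℚ.* half^ t)               ≡⟨ ℚₚ.*-assoc u _ _ ⟨
  u ℚ.* ℕ→ℚ (2 ^ t) ℚ.* half^ t                 ≡⟨ cong (ℚ._* half^ t) (unit-fraction (2 ^ t) {{ℕₚ.m^n≢0 2 t}}) ⟩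
  1ℚ ℚ.* half^ t                                ≡⟨ ℚₚ.*-identityˡ _ ⟩
  half^ t                                       ∎
  where
  open ≡-Reasoning
  u : ℚ
  u = uniform t a

-- Sums over the cube

sumCube-cong : ∀ n {f g : Vec Bool n → ℚ} → (∀ a → f a ≡ g a) → sumCube n f ≡ sumCube n g
sumCube-cong zero    eq = eq []
sumCube-cong (suc n) eq = cong₂ ℚ._+_ (sumCube-cong n (eq ∘ (false ∷_))) (sumCube-cong n (eq ∘ (true ∷_)))

sumCube-mono : ∀ n {f g : Vec Bool n → ℚ} → (∀ a → f a ℚ.≤ g a) → sumCube n f ℚ.≤ sumCube n g
sumCube-mono zero    le = le []
sumCube-mono (suc n) le = ℚₚ.+-mono-≤ (sumCube-mono n (le ∘ (false ∷_))) (sumCube-mono n (le ∘ (true ∷_)))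

+-interchange : ∀ p q r s → (p ℚ.+ q) ℚ.+ (r ℚ.+ s) ≡ (p ℚ.+ r) ℚ.+ (q ℚ.+ s)
+-interchange = solve 4 (λ p q r s → (p ⊞ q) ⊞ (r ⊞ s) := (p ⊞ r) ⊞ (q ⊞ s)) refl

sumCube-+ : ∀ n (f g : Vec Bool n → ℚ) → sumCube n (λ a → f a ℚ.+ g a) ≡ sumCube n f ℚ.+ sumCube n g
sumCube-+ zero    f g = refl
sumCube-+ (suc n) f g = trans
  (cong₂ ℚ._+_ (sumCube-+ n (f ∘ (false ∷_)) (g ∘ (false ∷_))) (sumCube-+ n (f ∘ (true ∷_)) (g ∘ (true ∷_))))
  (+-interchange (sumCube n (f ∘ (false ∷_))) _ _ _)

sumCube-*ˡ : ∀ n c (f : Vec Bool n → ℚ) → sumCube n (λ a → c ℚ.* f a) ≡ c ℚ.* sumCube n f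
sumCube-*ˡ zero    c f = refl
sumCube-*ˡ (suc n) c f = trans
  (cong₂ ℚ._+_ (sumCube-*ˡ n c (f ∘ (false ∷_))) (sumCube-*ˡ n c (f ∘ (true ∷_))))
  (sym (ℚₚ.*-distribˡ-+ c _ _))

sumCube-*ʳ : ∀ n c (f : Vec Bool n → ℚ) → sumCube n (λ a → f a ℚ.* c) ≡ sumCube n f ℚ.* c
sumCube-*ʳ n c f = trans (sumCube-cong n λ a → ℚₚ.*-comm (f a) c)
  (trans (sumCube-*ˡ n c f) (ℚₚ.*-comm c _))

sumCube-const : ∀ n c → sumCube n (λ _ → c) ≡ c ℚ.* ℕ→ℚ (2 ^ n)
sumCube-const zero    c = sym (ℚₚ.*-identityʳ c)
sumCube-const (suc n) c = begin
  sumCube n (λ _ → c) ℚ.+ sumCube n (λ _ → c)     ≡⟨ cong₂ ℚ._+_ (sumCube-const n c) (sumCube-const n c) ⟩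
  c ℚ.* ℕ→ℚ (2 ^ n) ℚ.+ c ℚ.* ℕ→ℚ (2 ^ n)         ≡⟨ solve 2 (λ c t → c ⊠ t ⊞ c ⊠ t := c ⊠ (κ (ℕ→ℚ 2) ⊠ t)) refl c (ℕ→ℚ (2 ^ n)) ⟩
  c ℚ.* (ℕ→ℚ 2 ℚ.* ℕ→ℚ (2 ^ n))                   ≡⟨ cong (c ℚ.*_) (ℕ→ℚ-* 2 (2 ^ n)) ⟨
  c ℚ.* ℕ→ℚ (2 ^ suc n)                           ∎
  where open ≡-Reasoning

sumCube-0 : ∀ n → sumCube n (λ _ → 0ℚ) ≡ 0ℚ
sumCube-0 n = trans (sumCube-const n 0ℚ) (ℚₚ.*-zeroˡ (ℕ→ℚ (2 ^ n)))

sumCube-swap : ∀ m n (F : Vec Bool m → Vec Bool n → ℚ) →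
  sumCube m (λ a → sumCube n (F a)) ≡ sumCube n (λ b → sumCube m (λ a → F a b))
sumCube-swap zero    n F = refl
sumCube-swap (suc m) n F = trans
  (cong₂ ℚ._+_ (sumCube-swap m n (F ∘ (false ∷_))) (sumCube-swap m n (F ∘ (true ∷_))))
  (sym (sumCube-+ n _ _))

sumCube-half^ : ∀ n → sumCube n (λ _ → half^ n) ≡ 1ℚ
sumCube-half^ n = trans (sumCube-const n (half^ n)) (half^-inverse n)

𝟙 : Bool → ℚ
𝟙 b = if b then 1ℚ else 0ℚ

if-weight : ∀ b w → (if b then w else 0ℚ) ≡ 𝟙 b ℚ.* w
if-weight true  w = sym (ℚₚ.*-identityˡ w)
if-weight false w = sym (ℚₚ.*-zeroˡ w)

0≤𝟙 : ∀ b → 0ℚ ℚ.≤ 𝟙 b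
0≤𝟙 true  = 0≤1
0≤𝟙 false = ℚₚ.≤-refl

-- Parseval's identity for the characters (-1)^⟨S,b⟩

sign : Bool → ℚ
sign false = 1ℚ
sign true  = ℚ.- 1ℚ


fourier : ∀ m → (Vec Bool m → ℚ) → Vec Bool m → ℚ
fourier m g S = sumCube m λ b → sign (inner S b) ℚ.* g b

-- Splitting off the first coordinate turns the coefficients at `false ∷ S` and `true ∷ S` into the
-- sum and the difference of those of the two halves of g; the parallelogram law gives the factor 2.
parseval : ∀ m (g : Vec Bool m → ℚ) →
  sumCube m (λ S → fourier m g S ℚ.* fourier m g S) ≡ ℕ→ℚ (2 ^ m) ℚ.* sumCube m (λ b → g b ℚ.* g b)
parseval zero g = solve 1 (λ x → (κ 1ℚ ⊠ x) ⊠ (κ 1ℚ ⊠ x) := κ 1ℚ ⊠ (x ⊠ x)) refl (g [])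
parseval (suc m) g = begin
  sumCube m (λ S → F (false ∷ S) ℚ.* F (false ∷ S)) ℚ.+ sumCube m (λ S → F (true ∷ S) ℚ.* F (true ∷ S))
    ≡⟨ sumCube-+ m _ _ ⟨
  sumCube m (λ S → F (false ∷ S) ℚ.* F (false ∷ S) ℚ.+ F (true ∷ S) ℚ.* F (true ∷ S))
    ≡⟨ sumCube-cong m (λ S → trans (cong (λ y → F (false ∷ S) ℚ.* F (false ∷ S) ℚ.+ y ℚ.* y) (F-true S))
                                   (square (F₀ S) (F₁ S))) ⟩
  sumCube m (λ S → ℕ→ℚ 2 ℚ.* (F₀ S ℚ.* F₀ S ℚ.+ F₁ S ℚ.* F₁ S))
    ≡⟨ sumCube-*ˡ m (ℕ→ℚ 2) _ ⟩
  ℕ→ℚ 2 ℚ.* sumCube m (λ S → F₀ S ℚ.* F₀ S ℚ.+ F₁ S ℚ.* F₁ S)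
    ≡⟨ cong (ℕ→ℚ 2 ℚ.*_) (trans (sumCube-+ m _ _) (cong₂ ℚ._+_ (parseval m (g ∘ (false ∷_))) (parseval m (g ∘ (true ∷_))))) ⟩
  ℕ→ℚ 2 ℚ.* (ℕ→ℚ (2 ^ m) ℚ.* G₀ ℚ.+ ℕ→ℚ (2 ^ m) ℚ.* G₁)
    ≡⟨ solve 4 (λ c t x y → c ⊠ (t ⊠ x ⊞ t ⊠ y) := c ⊠ t ⊠ (x ⊞ y)) refl (ℕ→ℚ 2) (ℕ→ℚ (2 ^ m)) G₀ G₁ ⟩
  ℕ→ℚ 2 ℚ.* ℕ→ℚ (2 ^ m) ℚ.* (G₀ ℚ.+ G₁)
    ≡⟨ cong (ℚ._* (G₀ ℚ.+ G₁)) (ℕ→ℚ-* 2 (2 ^ m)) ⟨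
  ℕ→ℚ (2 ^ suc m) ℚ.* (G₀ ℚ.+ G₁) ∎
  where
  open ≡-Reasoning
  F : Vec Bool (suc m) → ℚ
  F = fourier (suc m) g
  F₀ F₁ : Vec Bool m → ℚ
  F₀ = fourier m (g ∘ (false ∷_))
  F₁ = fourier m (g ∘ (true ∷_))
  G₀ G₁ : ℚ
  G₀ = sumCube m (λ b → g (false ∷ b) ℚ.* g (false ∷ b))
  G₁ = sumCube m (λ b → g (true ∷ b) ℚ.* g (true ∷ b))

  sign-not : ∀ x → sign (not x) ≡ ℚ.- 1ℚ ℚ.* sign x
  sign-not true  = refl
  sign-not false = refl

  F-true : ∀ S → F (true ∷ S) ≡ F₀ S ℚ.+ ℚ.- 1ℚ ℚ.* F₁ S
  F-true S = cong (F₀ S ℚ.+_) (trans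
    (sumCube-cong m λ b → trans (cong (ℚ._* g (true ∷ b)) (sign-not (inner S b))) (ℚₚ.*-assoc (ℚ.- 1ℚ) (sign (inner S b)) (g (true ∷ b))))
    (sumCube-*ˡ m (ℚ.- 1ℚ) _))

  square : ∀ x y → (x ℚ.+ y) ℚ.* (x ℚ.+ y) ℚ.+ (x ℚ.+ ℚ.- 1ℚ ℚ.* y) ℚ.* (x ℚ.+ ℚ.- 1ℚ ℚ.* y)
                   ≡ ℕ→ℚ 2 ℚ.* (x ℚ.* x ℚ.+ y ℚ.* y)
  square = solve 2 (λ x y → (x ⊞ y) ⊠ (x ⊞ y) ⊞ (x ⊞ κ (ℚ.- 1ℚ) ⊠ y) ⊠ (x ⊞ κ (ℚ.- 1ℚ) ⊠ y)
                            := κ (ℕ→ℚ 2) ⊠ (x ⊠ x ⊞ y ⊠ y)) refl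

average : ∀ m → (Vec Bool m → ℚ) → ℚ
average m g = half^ m ℚ.* sumCube m g

∣p∣²≡p² : ∀ p → ℚ.∣ p ∣ ℚ.* ℚ.∣ p ∣ ≡ p ℚ.* p
∣p∣²≡p² p with ℚₚ.∣p∣≡p∨∣p∣≡-p p
... | inj₁ eq = cong₂ ℚ._*_ eq eq
... | inj₂ eq = trans (cong₂ ℚ._*_ eq eq) (solve 1 (λ p → (⊟ p) ⊠ (⊟ p) := p ⊠ p) refl p)

𝟙-not-does : ∀ {P : Set} (P? : Dec P) {q} → 0ℚ ℚ.≤ q → (¬ P → 1ℚ ℚ.≤ q) → 𝟙 (not (does P?)) ℚ.≤ q
𝟙-not-does (yes _) 0≤q _   = 0≤q
𝟙-not-does (no ¬p) _   1≤q = 1≤q ¬p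

-- Correlation of tests with parities

Test : ℕ → Set
Test m = Vec Bool m → Bool → Bool

module _ {m : ℕ} (χ : Test m) where

  truth : Vec Bool m → ℚ
  truth S = average m λ b → 𝟙 (χ b (inner S b))

  neutral : ℚ
  neutral = average m λ b → ½ ℚ.* (𝟙 (χ b false) ℚ.+ 𝟙 (χ b true))

  contrast : Vec Bool m → ℚ
  contrast b = ½ ℚ.* (𝟙 (χ b false) ℚ.+ ℚ.- 𝟙 (χ b true))

  deviation : Vec Bool m → ℚ
  deviation S = half^ m ℚ.* fourier m contrast S

  -- Pointwise, the value of a test at label y is its mean over both labels plus (-1)^y times half
  -- their difference. The second term, averaged, is a Fourier coefficient of `contrast`.
  truth≡ : ∀ S → truth S ≡ neutral ℚ.+ deviation S
  truth≡ S = begin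
    average m (λ b → 𝟙 (χ b (inner S b)))
      ≡⟨ cong (half^ m ℚ.*_) (trans (sumCube-cong m λ b → pointwise (χ b) (inner S b)) (sumCube-+ m _ _)) ⟩
    half^ m ℚ.* (sumCube m (λ b → ½ ℚ.* (𝟙 (χ b false) ℚ.+ 𝟙 (χ b true))) ℚ.+ fourier m contrast S)
      ≡⟨ ℚₚ.*-distribˡ-+ (half^ m) _ _ ⟩
    neutral ℚ.+ deviation S ∎
    where
    open ≡-Reasoning
    pointwise : ∀ (f : Bool → Bool) y →
      𝟙 (f y) ≡ ½ ℚ.* (𝟙 (f false) ℚ.+ 𝟙 (f true)) ℚ.+ sign y ℚ.* (½ ℚ.* (𝟙 (f false) ℚ.+ ℚ.- 𝟙 (f true)))
    pointwise f y with f false | f true | f y | cases y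
      where
      cases : ∀ y → (f y ≡ f false × y ≡ false) ⊎ (f y ≡ f true × y ≡ true)
      cases false = inj₁ (refl , refl)
      cases true  = inj₂ (refl , refl)
    ... | u     | true  | .true  | inj₂ (refl , refl) = solve 1 (λ u → κ 1ℚ := κ ½ ⊠ (u ⊞ κ 1ℚ) ⊞ κ (ℚ.- 1ℚ) ⊠ (κ ½ ⊠ (u ⊞ κ (ℚ.- 1ℚ)))) refl (𝟙 u)
    ... | u     | false | .false | inj₂ (refl , refl) = solve 1 (λ u → κ 0ℚ := κ ½ ⊠ (u ⊞ κ 0ℚ) ⊞ κ (ℚ.- 1ℚ) ⊠ (κ ½ ⊠ (u ⊞ κ (ℚ.- 0ℚ)))) refl (𝟙 u)
    ... | true  | v     | .true  | inj₁ (refl , refl) = solve 1 (λ v → κ 1ℚ := κ ½ ⊠ (κ 1ℚ ⊞ v) ⊞ κ 1ℚ ⊠ (κ ½ ⊠ (κ 1ℚ ⊞ ⊟ v))) refl (𝟙 v)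
    ... | false | v     | .false | inj₁ (refl , refl) = solve 1 (λ v → κ 0ℚ := κ ½ ⊠ (κ 0ℚ ⊞ v) ⊞ κ 1ℚ ⊠ (κ ½ ⊠ (κ 0ℚ ⊞ ⊟ v))) refl (𝟙 v)

  contrast²≤1 : ∀ b → contrast b ℚ.* contrast b ℚ.≤ 1ℚ
  contrast²≤1 b with χ b false | χ b true
  ... | true  | true  = ℚₚ.≤ᵇ⇒≤ _
  ... | true  | false = ℚₚ.≤ᵇ⇒≤ _
  ... | false | true  = ℚₚ.≤ᵇ⇒≤ _
  ... | false | false = ℚₚ.≤ᵇ⇒≤ _

  -- With the normalisation by 2^-m, Parseval equates the sum to the average of the squared
  -- contrast.
  deviation²-sum : sumCube m (λ S → deviation S ℚ.* deviation S) ℚ.≤ 1ℚ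
  deviation²-sum = begin
    sumCube m (λ S → h ℚ.* F S ℚ.* (h ℚ.* F S))
      ≡⟨ sumCube-cong m (λ S → solve 2 (λ h f → h ⊠ f ⊠ (h ⊠ f) := h ⊠ h ⊠ (f ⊠ f)) refl h (F S)) ⟩
    sumCube m (λ S → h ℚ.* h ℚ.* (F S ℚ.* F S))
      ≡⟨ trans (sumCube-*ˡ m (h ℚ.* h) _) (cong (h ℚ.* h ℚ.*_) (parseval m contrast)) ⟩
    h ℚ.* h ℚ.* (ℕ→ℚ (2 ^ m) ℚ.* G)
      ≡⟨ solve 3 (λ h t g → h ⊠ h ⊠ (t ⊠ g) := (h ⊠ t) ⊠ (h ⊠ g)) refl h (ℕ→ℚ (2 ^ m)) G ⟩
    h ℚ.* ℕ→ℚ (2 ^ m) ℚ.* (h ℚ.* G)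
      ≡⟨ trans (cong (ℚ._* (h ℚ.* G)) (half^-inverse m)) (ℚₚ.*-identityˡ (h ℚ.* G)) ⟩
    h ℚ.* G
      ≤⟨ *-monoˡ h (0≤half^ m) (sumCube-mono m contrast²≤1) ⟩
    h ℚ.* sumCube m (λ _ → 1ℚ)
      ≡⟨ cong (h ℚ.*_) (trans (sumCube-const m 1ℚ) (ℚₚ.*-identityˡ _)) ⟩
    h ℚ.* ℕ→ℚ (2 ^ m)
      ≡⟨ half^-inverse m ⟩
    1ℚ ∎
    where
    open ℚₚ.≤-Reasoning
    h G : ℚ
    h = half^ m
    G = sumCube m (λ b → contrast b ℚ.* contrast b)
    F : Vec Bool m → ℚ
    F = fourier m contrast

  -- The answer `yes` stands for a deviation of at most 1/t and is negated in `detects`; multiplying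
  -- by t avoids a division.
  large? : ∀ t S → Dec (ℚ.∣ deviation S ∣ ℚ.* ℕ→ℚ t ℚ.≤ 1ℚ)
  large? t S = ℚ.∣ deviation S ∣ ℚ.* ℕ→ℚ t ℚₚ.≤? 1ℚ

  detects : ℕ → Vec Bool m → Bool
  detects t S = not (does (large? t S))

  detects-square : ∀ t S → 𝟙 (detects t S) ℚ.≤ ℕ→ℚ (t * t) ℚ.* (deviation S ℚ.* deviation S)
  detects-square t S = 𝟙-not-does (large? t S)
    (*-nonneg (0≤ℕ→ℚ (t * t)) (subst (0ℚ ℚ.≤_) (∣p∣²≡p² (deviation S)) (*-nonneg (ℚₚ.0≤∣p∣ (deviation S)) (ℚₚ.0≤∣p∣ (deviation S)))))
    λ big → one≤ (ℚₚ.<⇒≤ (ℚₚ.≰⇒> big))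
    where
    open ℚₚ.≤-Reasoning
    x : ℚ
    x = ℚ.∣ deviation S ∣ ℚ.* ℕ→ℚ t
    one≤ : 1ℚ ℚ.≤ x → 1ℚ ℚ.≤ ℕ→ℚ (t * t) ℚ.* (deviation S ℚ.* deviation S)
    one≤ 1≤x = begin
      1ℚ                                          ≡⟨⟩
      1ℚ ℚ.* 1ℚ                                   ≤⟨ *-mono 0≤1 (ℚₚ.≤-trans 0≤1 1≤x) 1≤x 1≤x ⟩
      x ℚ.* x                                     ≡⟨ solve 2 (λ a t → (a ⊠ t) ⊠ (a ⊠ t) := (t ⊠ t) ⊠ (a ⊠ a)) refl ℚ.∣ deviation S ∣ (ℕ→ℚ t) ⟩
      ℕ→ℚ t ℚ.* ℕ→ℚ t ℚ.* (ℚ.∣ deviation S ∣ ℚ.* ℚ.∣ deviation S ∣)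
                                                  ≡⟨ cong₂ ℚ._*_ (sym (ℕ→ℚ-* t t)) (∣p∣²≡p² (deviation S)) ⟩
      ℕ→ℚ (t * t) ℚ.* (deviation S ℚ.* deviation S) ∎

  -- Chebyshev's inequality: a detected parity contributes at least 1/t² to a sum of squares that is
  -- at most 1.
  detects-count : ∀ t → sumCube m (λ S → 𝟙 (detects t S)) ℚ.≤ ℕ→ℚ (t * t)
  detects-count t = begin
    sumCube m (λ S → 𝟙 (detects t S))                                    ≤⟨ sumCube-mono m (detects-square t) ⟩
    sumCube m (λ S → ℕ→ℚ (t * t) ℚ.* (deviation S ℚ.* deviation S))      ≡⟨ sumCube-*ˡ m (ℕ→ℚ (t * t)) _ ⟩
    ℕ→ℚ (t * t) ℚ.* sumCube m (λ S → deviation S ℚ.* deviation S)        ≤⟨ *-monoˡ (ℕ→ℚ (t * t)) (0≤ℕ→ℚ (t * t)) deviation²-sum ⟩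
    ℕ→ℚ (t * t) ℚ.* 1ℚ                                                   ≡⟨ ℚₚ.*-identityʳ _ ⟩
    ℕ→ℚ (t * t)                                                          ∎
    where open ℚₚ.≤-Reasoning

𝟙-∨ : ∀ x y → 𝟙 (x ∨ y) ℚ.≤ 𝟙 x ℚ.+ 𝟙 y
𝟙-∨ true  true  = ℚₚ.≤ᵇ⇒≤ _
𝟙-∨ true  false = ℚₚ.≤ᵇ⇒≤ _
𝟙-∨ false true  = ℚₚ.≤ᵇ⇒≤ _
𝟙-∨ false false = ℚₚ.≤ᵇ⇒≤ _

detected : ∀ {m} → ℕ → List (Test m) → Vec Bool m → Bool
detected t []       S = false
detected t (χ ∷ χs) S = detects χ t S ∨ detected t χs S

detected-count : ∀ {m} t (χs : List (Test m)) →
  sumCube m (λ S → 𝟙 (detected t χs S)) ℚ.≤ ℕ→ℚ (length χs * (t * t))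
detected-count {m} t []       = ℚₚ.≤-reflexive (sumCube-0 m)
detected-count {m} t (χ ∷ χs) = begin
  sumCube m (λ S → 𝟙 (detects χ t S ∨ detected t χs S))              ≤⟨ sumCube-mono m (λ S → 𝟙-∨ (detects χ t S) _) ⟩
  sumCube m (λ S → 𝟙 (detects χ t S) ℚ.+ 𝟙 (detected t χs S))        ≡⟨ sumCube-+ m _ _ ⟩
  sumCube m (λ S → 𝟙 (detects χ t S)) ℚ.+ sumCube m (λ S → 𝟙 (detected t χs S))
                                                                     ≤⟨ ℚₚ.+-mono-≤ (detects-count χ t) (detected-count t χs) ⟩
  ℕ→ℚ (t * t) ℚ.+ ℕ→ℚ (length χs * (t * t))                          ≡⟨ ℕ→ℚ-+ (t * t) _ ⟨
  ℕ→ℚ (length (χ ∷ χs) * (t * t))                                    ∎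
  where open ℚₚ.≤-Reasoning

-- Dyadic numbers are the values of answers

Dyadic : ℚ → Set
Dyadic q = Σ[ c ∈ ℕ ] Σ[ k ∈ ℕ ] q ≡ ℕ→ℚ c ℚ.* half^ k

dyadic-+ : ∀ {p q} → Dyadic p → Dyadic q → Dyadic (p ℚ.+ q)
dyadic-+ {p} {q} (c , j , p≡) (d , k , q≡) = c * 2 ^ k + d * 2 ^ j , j + k , (begin
  p ℚ.+ q                                           ≡⟨ cong₂ ℚ._+_ p≡ q≡ ⟩
  C ℚ.* hj ℚ.+ D ℚ.* hk                             ≡⟨ cong₂ ℚ._+_ (sym (ℚₚ.*-identityʳ (C ℚ.* hj))) (sym (ℚₚ.*-identityʳ (D ℚ.* hk))) ⟩
  C ℚ.* hj ℚ.* 1ℚ ℚ.+ D ℚ.* hk ℚ.* 1ℚ               ≡⟨ cong₂ (λ x y → C ℚ.* hj ℚ.* x ℚ.+ D ℚ.* hk ℚ.* y) (half^-inverse k) (half^-inverse j) ⟨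
  C ℚ.* hj ℚ.* (hk ℚ.* tk) ℚ.+ D ℚ.* hk ℚ.* (hj ℚ.* tj)
    ≡⟨ solve 6 (λ C D hj hk tj tk → C ⊠ hj ⊠ (hk ⊠ tk) ⊞ D ⊠ hk ⊠ (hj ⊠ tj) := (C ⊠ tk ⊞ D ⊠ tj) ⊠ (hj ⊠ hk)) refl C D hj hk tj tk ⟩
  (C ℚ.* tk ℚ.+ D ℚ.* tj) ℚ.* (hj ℚ.* hk)
    ≡⟨ cong₂ ℚ._*_ (trans (ℕ→ℚ-+ (c * 2 ^ k) (d * 2 ^ j)) (cong₂ ℚ._+_ (ℕ→ℚ-* c (2 ^ k)) (ℕ→ℚ-* d (2 ^ j)))) (half^-+ j k) ⟨
  ℕ→ℚ (c * 2 ^ k + d * 2 ^ j) ℚ.* half^ (j + k)     ∎)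
  where
  open ≡-Reasoning
  C D hj hk tj tk : ℚ
  C = ℕ→ℚ c
  D = ℕ→ℚ d
  hj = half^ j
  hk = half^ k
  tj = ℕ→ℚ (2 ^ j)
  tk = ℕ→ℚ (2 ^ k)

dyadic-half^ : ∀ {q} j → Dyadic q → Dyadic (half^ j ℚ.* q)
dyadic-half^ {q} j (c , k , q≡) = c , j + k ,
  trans (cong (half^ j ℚ.*_) q≡) (trans (solve 3 (λ h c k → h ⊠ (c ⊠ k) := c ⊠ (h ⊠ k)) refl (half^ j) (ℕ→ℚ c) (half^ k))
    (cong (ℕ→ℚ c ℚ.*_) (sym (half^-+ j k))))

dyadic-𝟙 : ∀ b → Dyadic (𝟙 b)
dyadic-𝟙 true  = 1 , 0 , refl
dyadic-𝟙 false = 0 , 0 , refl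

dyadic-sumCube : ∀ m {g : Vec Bool m → ℚ} → (∀ b → Dyadic (g b)) → Dyadic (sumCube m g)
dyadic-sumCube zero    dy = dy []
dyadic-sumCube (suc m) dy = dyadic-+ (dyadic-sumCube m (dy ∘ (false ∷_))) (dyadic-sumCube m (dy ∘ (true ∷_)))

digits : ∀ k c → c < 2 ^ k → Σ[ bs ∈ List Bool ] fraction bs ≡ ℕ→ℚ c ℚ.* half^ k
digits zero    zero    _        = [] , refl
digits zero    (suc c) (s≤s ())
digits (suc k) c       c<       with c ℕₚ.<? 2 ^ k
... | yes c<2^k = let bs , eq = digits k c c<2^k in false ∷ bs , (begin
  ½ ℚ.* (0ℚ ℚ.+ fraction bs)             ≡⟨ cong (λ x → ½ ℚ.* (0ℚ ℚ.+ x)) eq ⟩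
  ½ ℚ.* (0ℚ ℚ.+ ℕ→ℚ c ℚ.* half^ k)       ≡⟨ solve 2 (λ c h → κ ½ ⊠ (κ 0ℚ ⊞ c ⊠ h) := c ⊠ (κ ½ ⊠ h)) refl (ℕ→ℚ c) (half^ k) ⟩
  ℕ→ℚ c ℚ.* half^ (suc k)                ∎)
  where open ≡-Reasoning
... | no  c≮2^k = let bs , eq = digits k (c ∸ 2 ^ k) below in true ∷ bs , (begin
  ½ ℚ.* (1ℚ ℚ.+ fraction bs)                                           ≡⟨ cong (λ x → ½ ℚ.* (1ℚ ℚ.+ x)) eq ⟩
  ½ ℚ.* (1ℚ ℚ.+ ℕ→ℚ c′ ℚ.* half^ k)                                    ≡⟨ cong (λ x → ½ ℚ.* (x ℚ.+ ℕ→ℚ c′ ℚ.* half^ k)) (half^-inverse k) ⟨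
  ½ ℚ.* (half^ k ℚ.* ℕ→ℚ (2 ^ k) ℚ.+ ℕ→ℚ c′ ℚ.* half^ k)
    ≡⟨ solve 3 (λ c h t → κ ½ ⊠ (h ⊠ t ⊞ c ⊠ h) := (c ⊞ t) ⊠ (κ ½ ⊠ h)) refl (ℕ→ℚ c′) (half^ k) (ℕ→ℚ (2 ^ k)) ⟩
  (ℕ→ℚ c′ ℚ.+ ℕ→ℚ (2 ^ k)) ℚ.* half^ (suc k)
    ≡⟨ cong (ℚ._* half^ (suc k)) (trans (sym (ℕ→ℚ-+ c′ (2 ^ k))) (cong ℕ→ℚ (ℕₚ.m∸n+n≡m 2^k≤c))) ⟩
  ℕ→ℚ c ℚ.* half^ (suc k)                                              ∎)
  where
  open ≡-Reasoning
  c′ : ℕ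
  c′ = c ∸ 2 ^ k
  2^k≤c : 2 ^ k ≤ c
  2^k≤c = ℕₚ.≮⇒≥ c≮2^k
  below : c′ < 2 ^ k
  below = ℕₚ.+-cancelʳ-< (2 ^ k) c′ (2 ^ k) (subst₂ _<_ (sym (ℕₚ.m∸n+n≡m 2^k≤c)) (cong (λ x → 2 ^ k + x) (ℕₚ.+-identityʳ (2 ^ k))) c<)

-- Lets the oracles of the lower bound answer exactly: probabilities over m fair bits, and their
-- averages over both labels, have denominators that are powers of two.
dyadic-answer : ∀ {q} → Dyadic q → Σ[ v ∈ Answer ] answer-value v ≡ q
dyadic-answer {q} (c , k , q≡) = answer (+ w) bs , (begin
  ℕ→ℚ w ℚ.+ fraction bs                                      ≡⟨ cong (ℕ→ℚ w ℚ.+_) (proj₂ ds) ⟩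
  ℕ→ℚ w ℚ.+ ℕ→ℚ r ℚ.* half^ k                                ≡⟨ cong (ℚ._+ ℕ→ℚ r ℚ.* half^ k) (trans (cong (ℕ→ℚ w ℚ.*_) (half^-inverse k)) (ℚₚ.*-identityʳ (ℕ→ℚ w))) ⟨
  ℕ→ℚ w ℚ.* (half^ k ℚ.* ℕ→ℚ (2 ^ k)) ℚ.+ ℕ→ℚ r ℚ.* half^ k  ≡⟨ solve 4 (λ w h t r → w ⊠ (h ⊠ t) ⊞ r ⊠ h := (r ⊞ w ⊠ t) ⊠ h) refl (ℕ→ℚ w) (half^ k) (ℕ→ℚ (2 ^ k)) (ℕ→ℚ r) ⟩
  (ℕ→ℚ r ℚ.+ ℕ→ℚ w ℚ.* ℕ→ℚ (2 ^ k)) ℚ.* half^ k              ≡⟨ cong (ℚ._* half^ k) (trans (ℕ→ℚ-+ r (w * 2 ^ k)) (cong (ℕ→ℚ r ℚ.+_) (ℕ→ℚ-* w (2 ^ k)))) ⟨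
  ℕ→ℚ (r + w * 2 ^ k) ℚ.* half^ k                            ≡⟨ cong (λ x → ℕ→ℚ x ℚ.* half^ k) (ℕ.m≡m%n+[m/n]*n c (2 ^ k)) ⟨
  ℕ→ℚ c ℚ.* half^ k                                          ≡⟨ q≡ ⟨
  q                                                          ∎)
  where
  open ≡-Reasoning
  instance
    nz : ℕ.NonZero (2 ^ k)
    nz = ℕₚ.m^n≢0 2 k
  w r : ℕ
  w = c ℕ./ 2 ^ k
  r = c ℕ.% 2 ^ k
  ds : Σ[ bs ∈ List Bool ] fraction bs ≡ ℕ→ℚ r ℚ.* half^ k
  ds = digits k r (ℕ.m%n<n c (2 ^ k))
  bs : List Bool
  bs = proj₁ ds

-- The image of the uniform distribution

equal : ∀ {n} → Vec Bool n → Vec Bool n → Bool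
equal []       []       = true
equal (x ∷ xs) (y ∷ ys) = not (x xor y) ∧ equal xs ys

sumCube-equal : ∀ n c (G : Vec Bool n → ℚ) → sumCube n (λ a → 𝟙 (equal c a) ℚ.* G a) ≡ G c
sumCube-equal zero    []          G = ℚₚ.*-identityˡ (G [])
sumCube-equal (suc n) (true ∷ c)  G = trans (cong₂ ℚ._+_
  (trans (sumCube-cong n λ a → ℚₚ.*-zeroˡ (G (false ∷ a))) (sumCube-0 n))
  (sumCube-equal n c (G ∘ (true ∷_)))) (ℚₚ.+-identityˡ _)
sumCube-equal (suc n) (false ∷ c) G = trans (cong₂ ℚ._+_
  (sumCube-equal n c (G ∘ (false ∷_)))
  (trans (sumCube-cong n λ a → ℚₚ.*-zeroˡ (G (true ∷ a))) (sumCube-0 n))) (ℚₚ.+-identityʳ _)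

module _ {m n : ℕ} (enc : Vec Bool m → Vec Bool n) where

  image-weight : Vec Bool n → ℚ
  image-weight a = sumCube m λ b → 𝟙 (equal (enc b) a) ℚ.* half^ m

  image-sum : ∀ (G : Vec Bool n → ℚ) →
    sumCube n (λ a → G a ℚ.* image-weight a) ≡ sumCube m (λ b → G (enc b) ℚ.* half^ m)
  image-sum G = begin
    sumCube n (λ a → G a ℚ.* image-weight a)
      ≡⟨ sumCube-cong n (λ a → trans (sym (sumCube-*ˡ m (G a) _)) (sumCube-cong m λ b →
           solve 3 (λ g e h → g ⊠ (e ⊠ h) := e ⊠ (g ⊠ h)) refl (G a) (𝟙 (equal (enc b) a)) (half^ m))) ⟩
    sumCube n (λ a → sumCube m (λ b → 𝟙 (equal (enc b) a) ℚ.* (G a ℚ.* half^ m)))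
      ≡⟨ sumCube-swap n m _ ⟩
    sumCube m (λ b → sumCube n (λ a → 𝟙 (equal (enc b) a) ℚ.* (G a ℚ.* half^ m)))
      ≡⟨ sumCube-cong m (λ b → sumCube-equal n (enc b) (λ a → G a ℚ.* half^ m)) ⟩
    sumCube m (λ b → G (enc b) ℚ.* half^ m) ∎
    where open ≡-Reasoning

  image : Distribution n
  image = record
    { approx = λ _ → image-weight
    ; nonneg = λ _ a → subst (ℚ._≤ image-weight a) (sumCube-0 m)
        (sumCube-mono m λ b → *-nonneg (0≤𝟙 (equal (enc b) a)) (0≤half^ m))
    ; total  = λ _ → trans (sumCube-cong n λ a → sym (ℚₚ.*-identityˡ (image-weight a)))
        (trans (image-sum (λ _ → 1ℚ)) (trans (sumCube-cong m λ _ → ℚₚ.*-identityˡ (half^ m)) (sumCube-half^ m)))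
    ; cauchy = λ j k → ℚₚ.≤-trans
        (ℚₚ.≤-reflexive (trans (sumCube-cong n λ a → cong ℚ.∣_∣ (ℚₚ.+-inverseʳ (image-weight a))) (sumCube-0 n)))
        (+-nonneg (0≤1/1+ j) (0≤1/1+ k))
    }

  Pr-image : ∀ k A → Pr (Distribution.approx image k) A ≡ average m (λ b → 𝟙 (A (enc b)))
  Pr-image k A = begin
    sumCube n (λ a → if A a then image-weight a else 0ℚ)  ≡⟨ sumCube-cong n (λ a → if-weight (A a) (image-weight a)) ⟩
    sumCube n (λ a → 𝟙 (A a) ℚ.* image-weight a)          ≡⟨ image-sum (𝟙 ∘ A) ⟩
    sumCube m (λ b → 𝟙 (A (enc b)) ℚ.* half^ m)           ≡⟨ sumCube-*ʳ m (half^ m) _ ⟩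
    sumCube m (λ b → 𝟙 (A (enc b))) ℚ.* half^ m           ≡⟨ ℚₚ.*-comm _ (half^ m) ⟩
    average m (λ b → 𝟙 (A (enc b)))                       ∎
    where open ≡-Reasoning

-- Runs with different oracles

module _ {coins queries inputs} (M : Machine coins queries inputs) where
  open Machine M
  open Execution M

  current-query : Configuration → Query
  current-query c with tapes c
  ... | w ∷ τᵢ ∷ τᶠ ∷ _ = query (contents w) (ℕ→ℚ (fromBits (contents τᵢ)) ℚ.+ fraction (contents τᶠ))

  asked-submit : ∀ 𝒪 s c → asked (submit 𝒪 s c) ≡ current-query c ∷ asked c
  asked-submit 𝒪 s c with tapes c
  ... | w ∷ τᵢ ∷ τᶠ ∷ _ ∷ _ ∷ _ = refl

  submit-agree : ∀ 𝒪 𝒪′ s c → 𝒪 (current-query c) (asked c) ≡ 𝒪′ (current-query c) (asked c) →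
    submit 𝒪 s c ≡ submit 𝒪′ s c
  submit-agree 𝒪 𝒪′ s c eq with tapes c
  ... | w ∷ τᵢ ∷ τᶠ ∷ _ ∷ _ ∷ rest = cong (λ v → record
    { state = s
    ; tapes = w ∷ τᵢ ∷ τᶠ ∷ load (signedBits (Answer.whole v)) ∷ load (Answer.fractional v) ∷ rest
    ; asked = _ ∷ asked c
    }) eq

  asked-step : ∀ 𝒪 b c {q} → q ∈ asked c → q ∈ asked (step 𝒪 b c)
  asked-step 𝒪 b c q∈ with instruction c
  ... | halt     = q∈
  ... | move _ _ = q∈
  ... | toss _ _ = q∈
  ... | ask _ s  = subst (_ ∈_) (sym (asked-submit 𝒪 s c)) (there q∈)

  asked-run : ∀ 𝒪 {t} (cs : Vec Bool t) c {q} → q ∈ asked c → q ∈ asked (run 𝒪 cs c)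
  asked-run 𝒪 []       c q∈ = q∈
  asked-run 𝒪 (b ∷ cs) c q∈ = asked-run 𝒪 cs (step 𝒪 b c) (asked-step 𝒪 b c q∈)

  length-asked-step : ∀ 𝒪 b c → length (asked (step 𝒪 b c)) ≤ suc (length (asked c))
  length-asked-step 𝒪 b c with instruction c
  ... | halt     = ℕₚ.n≤1+n _
  ... | move _ _ = ℕₚ.n≤1+n _
  ... | toss _ _ = ℕₚ.n≤1+n _
  ... | ask _ s  = ℕₚ.≤-reflexive (cong length (asked-submit 𝒪 s c))

  length-asked-run : ∀ 𝒪 {t} (cs : Vec Bool t) c → length (asked (run 𝒪 cs c)) ≤ t + length (asked c)
  length-asked-run 𝒪 []               c = ℕₚ.≤-refl
  length-asked-run 𝒪 {suc t} (b ∷ cs) c = ℕₚ.≤-trans (length-asked-run 𝒪 cs (step 𝒪 b c))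
    (ℕₚ.≤-trans (ℕₚ.+-monoʳ-≤ t (length-asked-step 𝒪 b c)) (ℕₚ.≤-reflexive (ℕₚ.+-suc t _)))

  step-agree : ∀ 𝒪 𝒪′ b c →
    (∀ q → q ∈ asked (step 𝒪 b c) → q ∈ asked (step 𝒪′ b c) → ∀ e → 𝒪 q e ≡ 𝒪′ q e) →
    step 𝒪 b c ≡ step 𝒪′ b c
  step-agree 𝒪 𝒪′ b c agree with instruction c
  ... | halt     = refl
  ... | move _ _ = refl
  ... | toss _ _ = refl
  ... | ask _ s  = submit-agree 𝒪 𝒪′ s c (agree (current-query c)
    (subst (_ ∈_) (sym (asked-submit 𝒪 s c)) (here refl))
    (subst (_ ∈_) (sym (asked-submit 𝒪′ s c)) (here refl)) (asked c))

  -- Agreement is demanded only on queries that occur in both runs. In the application, one run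
  -- supplies the lower bound on the tolerance of such a query, the other its place in the fixed
  -- list of tests.
  run-agree : ∀ 𝒪 𝒪′ {t} (cs : Vec Bool t) c →
    (∀ q → q ∈ asked (run 𝒪 cs c) → q ∈ asked (run 𝒪′ cs c) → ∀ e → 𝒪 q e ≡ 𝒪′ q e) →
    run 𝒪 cs c ≡ run 𝒪′ cs c
  run-agree 𝒪 𝒪′ []       c agree = refl
  run-agree 𝒪 𝒪′ (b ∷ cs) c agree = trans
    (run-agree 𝒪 𝒪′ cs (step 𝒪 b c) λ q q∈ q∈′ →
      agree q q∈ (subst (λ d → q ∈ asked (run 𝒪′ cs d)) same q∈′))
    (cong (run 𝒪′ cs) same)
    where
    same : step 𝒪 b c ≡ step 𝒪′ b c
    same = step-agree 𝒪 𝒪′ b c λ q q∈ q∈′ →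
      agree q (asked-run 𝒪 cs (step 𝒪 b c) q∈) (asked-run 𝒪′ cs (step 𝒪′ b c) q∈′)

-- Growth

-- One power of a common bound B on the arguments suffices: a constant c is below 2^c, and an
-- addition costs one extra factor because `2 ≤ B`.
polynomial-bound : ∀ {k} (p : Polynomial k) →
  Σ[ e ∈ ℕ ] (∀ B xs → 2 ≤ B → (∀ i → lookup xs i ≤ B) → ⟦ p ⟧ xs ≤ B ^ e)
polynomial-bound (con c) = c , λ B xs 2≤B _ → ℕₚ.≤-trans (ℕₚ.<⇒≤ (n<2^n c)) (ℕₚ.^-monoˡ-≤ c 2≤B)
polynomial-bound (var i) = 1 , λ B xs 2≤B xs≤B → ℕₚ.≤-trans (xs≤B i) (ℕₚ.≤-reflexive (sym (ℕₚ.*-identityʳ B)))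
polynomial-bound (p :+ q) with polynomial-bound p | polynomial-bound q
... | d , p≤ | e , q≤ = suc (d + e) , λ B xs 2≤B xs≤B → let
    open ℕₚ.≤-Reasoning
    1≤B = ℕₚ.≤-trans (s≤s z≤n) 2≤B
  in begin
    ⟦ p ⟧ xs + ⟦ q ⟧ xs        ≤⟨ ℕₚ.+-mono-≤ (p≤ B xs 2≤B xs≤B) (q≤ B xs 2≤B xs≤B) ⟩
    B ^ d + B ^ e              ≤⟨ ℕₚ.+-mono-≤ (ℕₚ.^-monoʳ-≤ B {{ℕ.>-nonZero 1≤B}} (ℕₚ.m≤m+n d e))
                                             (ℕₚ.^-monoʳ-≤ B {{ℕ.>-nonZero 1≤B}} (ℕₚ.m≤n+m e d)) ⟩
    B ^ (d + e) + B ^ (d + e)  ≡⟨ cong (λ x → B ^ (d + e) + x) (ℕₚ.+-identityʳ _) ⟨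
    2 * B ^ (d + e)            ≤⟨ ℕₚ.*-monoˡ-≤ (B ^ (d + e)) 2≤B ⟩
    B ^ suc (d + e)            ∎
polynomial-bound (p :* q) with polynomial-bound p | polynomial-bound q
... | d , p≤ | e , q≤ = d + e , λ B xs 2≤B xs≤B → ℕₚ.≤-trans
  (ℕₚ.*-mono-≤ (p≤ B xs 2≤B xs≤B) (q≤ B xs 2≤B xs≤B)) (ℕₚ.≤-reflexive (sym (ℕₚ.^-distribˡ-+-* B d e)))

-- For even d = 2x the right side is the square of 2^x and thus at least (x + 1)²; x = 2k + 1 makes
-- this quadratic exceed k(2x + 1).
exponential-wins : ∀ k → Σ[ d ∈ ℕ ] k * suc d < 2 ^ d
exponential-wins k = x + x , (begin-strict
  k * suc (x + x)                     <⟨ ℕₚ.m<m+n (k * suc (x + x)) (s≤s z≤n) ⟩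
  k * suc (x + x) + suc (3 + 5 * k)   ≡⟨ eq k ⟩
  suc x * suc x                       ≤⟨ ℕₚ.*-mono-≤ (n<2^n x) (n<2^n x) ⟩
  2 ^ x * 2 ^ x                       ≡⟨ ℕₚ.^-distribˡ-+-* 2 x x ⟨
  2 ^ (x + x)                         ∎)
  where
  open ℕₚ.≤-Reasoning
  x : ℕ
  x = suc (k + k)
  eq : ∀ k → k * suc (suc (k + k) + suc (k + k)) + suc (3 + 5 * k) ≡ suc (suc (k + k)) * suc (suc (k + k))
  eq = solve-∀

bounds-power : ∀ b e K → let d = proj₁ (exponential-wins (b * e * K)) in ((2 ^ (b * suc d)) ^ e) ^ K < 2 ^ double^ d
bounds-power b e K = begin-strict
  ((2 ^ (b * suc d)) ^ e) ^ K        ≡⟨ trans (cong (_^ K) (ℕₚ.^-*-assoc 2 (b * suc d) e)) (ℕₚ.^-*-assoc 2 (b * suc d * e) K) ⟩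
  2 ^ (b * suc d * e * K)            ≡⟨ cong (2 ^_) (rearrange b (suc d) e K) ⟩
  2 ^ (b * e * K * suc d)            <⟨ ℕₚ.^-monoʳ-< 2 (s≤s (s≤s z≤n)) (proj₂ (exponential-wins (b * e * K))) ⟩
  2 ^ (2 ^ d)                        ≡⟨ cong (2 ^_) (double^≡2^ d) ⟨
  2 ^ double^ d                      ∎
  where
  open ℕₚ.≤-Reasoning
  d : ℕ
  d = proj₁ (exponential-wins (b * e * K))
  rearrange : ∀ b d e K → b * d * e * K ≡ b * e * K * d
  rearrange = solve-∀

-- The inequality that learning all parities of 2^d bits would force: at most p queries and the test
-- of the hypothesis detect at most (9 + q)² parities each, and half of all parities must be
-- detected on average. The 9 is explained at `close-detects`.
Bounded : Polynomial 4 → Polynomial 3 → (c e₁ e₂ d : ℕ) → Set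
Bounded p q c e₁ e₂ d =
  2 ^ double^ d ≤ 2 * (suc (⟦ p ⟧ (n ∷ c ^ d ∷ e₁ ∷ e₂ ∷ [])) * ((9 + ⟦ q ⟧ (n ∷ c ^ d ∷ e₁ ∷ [])) * (9 + ⟦ q ⟧ (n ∷ c ^ d ∷ e₁ ∷ []))))
  where
  n : ℕ
  n = 2 + (double^ d + double^ d)

counting : Polynomial 2
counting = con 2 :* ((con 1 :+ var 0F) :* ((con 9 :+ var 1F) :* (con 9 :+ var 1F)))

module _ (c e₁ e₂ d : ℕ) where

  private
    -- A single power of two, with exponent linear in d, dominates the number of variables 2 + 2 ·
    -- 2^d, the size c^d and the constants, whereas the number of parities is doubly exponential in
    -- d.
    b B : ℕ
    b = 2 + (c + (e₁ + e₂))
    B = 2 ^ (b * suc d)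

    ≤B : ∀ k → k ≤ b * suc d → 2 ^ k ≤ B
    ≤B k = ℕₚ.^-monoʳ-≤ 2

    constant≤B : ∀ k → k ≤ b → k ≤ B
    constant≤B k k≤b = ℕₚ.≤-trans (ℕₚ.<⇒≤ (n<2^n k)) (≤B k (ℕₚ.≤-trans k≤b (ℕₚ.m≤m*n b (suc d))))

  2≤B : 2 ≤ B
  2≤B = constant≤B 2 (ℕₚ.m≤m+n 2 _)

  variables≤B : 2 + (double^ d + double^ d) ≤ B
  variables≤B = begin
    2 + (double^ d + double^ d)      ≡⟨ cong (λ x → 2 + (x + x)) (double^≡2^ d) ⟩
    2 + (2 ^ d + 2 ^ d)              ≤⟨ ℕₚ.+-monoˡ-≤ (2 ^ d + 2 ^ d) (ℕₚ.+-mono-≤ (ℕₚ.m^n>0 2 d) (ℕₚ.m^n>0 2 d)) ⟩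
    2 ^ d + 2 ^ d + (2 ^ d + 2 ^ d)  ≡⟨ four (2 ^ d) ⟩
    2 ^ (2 + d)                      ≤⟨ ≤B (2 + d) (ℕₚ.≤-trans (ℕₚ.+-monoʳ-≤ 2 (ℕₚ.m≤n*m d 2))
                                          (ℕₚ.≤-trans (ℕₚ.≤-reflexive (sym (ℕₚ.*-suc 2 d))) (ℕₚ.*-monoˡ-≤ (suc d) (ℕₚ.m≤m+n 2 (c + (e₁ + e₂)))))) ⟩
    B                                ∎
    where
    open ℕₚ.≤-Reasoning
    four : ∀ x → x + x + (x + x) ≡ 2 * (2 * x)
    four = solve-∀

  size≤B : c ^ d ≤ B
  size≤B = begin
    c ^ d          ≤⟨ ℕₚ.^-monoˡ-≤ d (ℕₚ.<⇒≤ (n<2^n c)) ⟩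
    (2 ^ c) ^ d    ≡⟨ ℕₚ.^-*-assoc 2 c d ⟩
    2 ^ (c * d)    ≤⟨ ≤B (c * d) (ℕₚ.*-mono-≤ (ℕₚ.≤-trans (ℕₚ.m≤m+n c _) (ℕₚ.m≤n+m _ 2)) (ℕₚ.n≤1+n d)) ⟩
    B              ∎
    where open ℕₚ.≤-Reasoning

  e₁≤B : e₁ ≤ B
  e₁≤B = constant≤B e₁ (ℕₚ.≤-trans (ℕₚ.m≤m+n e₁ e₂) (ℕₚ.≤-trans (ℕₚ.m≤n+m _ c) (ℕₚ.m≤n+m _ 2)))

  e₂≤B : e₂ ≤ B
  e₂≤B = constant≤B e₂ (ℕₚ.≤-trans (ℕₚ.m≤n+m e₂ e₁) (ℕₚ.≤-trans (ℕₚ.m≤n+m _ c) (ℕₚ.m≤n+m _ 2)))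

count-bound : ∀ B e K (counting≤ : ∀ C xs → 2 ≤ C → (∀ i → lookup xs i ≤ C) → ⟦ counting ⟧ xs ≤ C ^ K)
  {T t i j} → 2 ≤ B → T ≤ B ^ i → t ≤ B ^ j → e ≡ suc (i + j) → 2 * (suc T * ((9 + t) * (9 + t))) ≤ (B ^ e) ^ K
count-bound B e K counting≤ {T} {t} {i} {j} 2≤B T≤ t≤ refl =
  counting≤ (B ^ e) (T ∷ t ∷ []) 2≤B^e λ { 0F → T≤B^e ; 1F → t≤B^e }
  where
  power≤ : ∀ k → k ≤ e → B ^ k ≤ B ^ e
  power≤ k = ℕₚ.^-monoʳ-≤ B {{ℕ.>-nonZero (ℕₚ.≤-trans (s≤s z≤n) 2≤B)}}

  2≤B^e : 2 ≤ B ^ e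
  2≤B^e = ℕₚ.≤-trans 2≤B (ℕₚ.≤-trans (ℕₚ.≤-reflexive (sym (ℕₚ.*-identityʳ B))) (power≤ 1 (s≤s z≤n)))

  T≤B^e : T ≤ B ^ e
  T≤B^e = ℕₚ.≤-trans T≤ (power≤ i (ℕₚ.≤-trans (ℕₚ.m≤m+n i j) (ℕₚ.n≤1+n _)))

  t≤B^e : t ≤ B ^ e
  t≤B^e = ℕₚ.≤-trans t≤ (power≤ j (ℕₚ.≤-trans (ℕₚ.m≤n+m j i) (ℕₚ.n≤1+n _)))

few-parities-bound : ∀ p q c e₁ e₂ → ¬ (∀ d → Bounded p q c e₁ e₂ d)
few-parities-bound p q c e₁ e₂ bounded = beaten (polynomial-bound p) (polynomial-bound q) (polynomial-bound counting)
  where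
  beaten : (Σ[ i ∈ ℕ ] (∀ B xs → 2 ≤ B → (∀ v → lookup xs v ≤ B) → ⟦ p ⟧ xs ≤ B ^ i)) →
    (Σ[ j ∈ ℕ ] (∀ B xs → 2 ≤ B → (∀ v → lookup xs v ≤ B) → ⟦ q ⟧ xs ≤ B ^ j)) →
    (Σ[ K ∈ ℕ ] (∀ B xs → 2 ≤ B → (∀ v → lookup xs v ≤ B) → ⟦ counting ⟧ xs ≤ B ^ K)) → ⊥
  beaten (i , p≤) (j , q≤) (K , counting≤) = ℕₚ.<⇒≱ (bounds-power b e K)
    (ℕₚ.≤-trans (bounded d) (count-bound B e K counting≤ {i = i} {j} (2≤B c e₁ e₂ d)
      (p≤ B _ (2≤B c e₁ e₂ d) λ { 0F → variables≤B c e₁ e₂ d ; 1F → size≤B c e₁ e₂ d ; 2F → e₁≤B c e₁ e₂ d ; 3F → e₂≤B c e₁ e₂ d })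
      (q≤ B _ (2≤B c e₁ e₂ d) λ { 0F → variables≤B c e₁ e₂ d ; 1F → size≤B c e₁ e₂ d ; 2F → e₁≤B c e₁ e₂ d })
      refl))
    where
    b e d B : ℕ
    b = 2 + (c + (e₁ + e₂))
    e = suc (i + j)
    d = proj₁ (exponential-wins (b * e * K))
    B = 2 ^ (b * suc d)

-- Parities are not learnable

choose : ∀ {P A : Set} → Dec P → A → A → A
choose (yes _) x y = x
choose (no  _) x y = y

choose-yes : ∀ {P A : Set} (P? : Dec P) {x y : A} → P → choose P? x y ≡ x
choose-yes (yes _) p = refl
choose-yes (no ¬p) p = contradiction p ¬p

choose-elim : ∀ {P A : Set} (C : A → Set) (P? : Dec P) {x y : A} → (P → C x) → C y → C (choose P? x y)
choose-elim C (yes p) cx cy = cx p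
choose-elim C (no _)  cx cy = cy

not-does-false : ∀ {P : Set} (P? : Dec P) → not (does P?) ≡ false → P
not-does-false (yes p) _ = p

not-does-true : ∀ {P : Set} (P? : Dec P) → ¬ P → not (does P?) ≡ true
not-does-true (yes p) ¬p = contradiction p ¬p
not-does-true (no  _) _  = refl

detected-∈ : ∀ {m} t (χs : List (Test m)) S {χ} → χ ∈ χs → detects χ t S ≡ true → detected t χs S ≡ true
detected-∈ t (χ ∷ χs) S (here refl) hit = cong (_∨ detected t χs S) hit
detected-∈ t (χ ∷ χs) S (there χ∈)  hit = trans (cong (detects χ t S ∨_) (detected-∈ t χs S χ∈ hit)) (∨-zeroʳ (detects χ t S))

not-true : ∀ b → ¬ (b ≡ true) → b ≡ false
not-true true  ≢true = contradiction refl ≢true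
not-true false _     = refl

unless-false : ∀ b → (b ≡ false → b ≡ true) → b ≡ true
unless-false true  _   = refl
unless-false false f⇒t = f⇒t refl

𝟙-mono : ∀ b c → (b ≡ true → c ≡ true) → 𝟙 b ℚ.≤ 𝟙 c
𝟙-mono false c _   = 0≤𝟙 c
𝟙-mono true  c b⇒c = ℚₚ.≤-reflexive (cong 𝟙 (sym (b⇒c refl)))

average-cong : ∀ m {f g : Vec Bool m → ℚ} → (∀ b → f b ≡ g b) → average m f ≡ average m g
average-cong m eq = cong (half^ m ℚ.*_) (sumCube-cong m eq)

average-const : ∀ m c → average m (λ _ → c) ≡ c
average-const m c = begin
  half^ m ℚ.* sumCube m (λ _ → c)      ≡⟨ cong (half^ m ℚ.*_) (sumCube-const m c) ⟩
  half^ m ℚ.* (c ℚ.* ℕ→ℚ (2 ^ m))      ≡⟨ solve 3 (λ h c t → h ⊠ (c ⊠ t) := c ⊠ (h ⊠ t)) refl (half^ m) c (ℕ→ℚ (2 ^ m)) ⟩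
  c ℚ.* (half^ m ℚ.* ℕ→ℚ (2 ^ m))      ≡⟨ cong (c ℚ.*_) (half^-inverse m) ⟩
  c ℚ.* 1ℚ                             ≡⟨ ℚₚ.*-identityʳ c ⟩
  c                                    ∎
  where open ≡-Reasoning

¼ ⅛ : ℚ
¼ = ½ ℚ.* ½
⅛ = ½ ℚ.* ¼

εs₀ δs₀ : List Bool
εs₀ = false ∷ true ∷ []
δs₀ = true ∷ []

ε₀>0 : 0ℚ ℚ.< fraction εs₀
ε₀>0 = toWitness {a? = 0ℚ ℚₚ.<? fraction εs₀} _

δ₀>0 : 0ℚ ℚ.< fraction δs₀
δ₀>0 = toWitness {a? = 0ℚ ℚₚ.<? fraction δs₀} _

-- The event of an error has neutral value ½ for every hypothesis, so an error of at most ⅜ means a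
-- deviation of at most -⅛; since 9 · ⅛ exceeds 1, the threshold 1/(9 + t) is passed.
close-detects : ∀ {m} t (h : Vec Bool m → Bool) S →
  truth (λ b y → h b xor y) S ℚ.≤ ¼ ℚ.+ ⅛ → detects (λ b y → h b xor y) (9 + t) S ≡ true
close-detects {m} t h S close = not-does-true (large? χ (9 + t) S) λ small →
  ℚₚ.<-irrefl refl (ℚₚ.<-≤-trans (toWitness {a? = 1ℚ ℚₚ.<? ⅛ ℚ.* ℕ→ℚ 9} _) (ℚₚ.≤-trans ⅛t≤ small))
  where
  χ : Test m
  χ b y = h b xor y

  half : ∀ x → ½ ℚ.* (𝟙 (x xor false) ℚ.+ 𝟙 (x xor true)) ≡ ½
  half true  = refl
  half false = refl

  ⅛≤∣dev∣ : ⅛ ℚ.≤ ℚ.∣ deviation χ S ∣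
  ⅛≤∣dev∣ = ℚₚ.≤-trans step (-p≤∣p∣ (deviation χ S))
    where
    dev : ℚ
    dev = deviation χ S
    le : ½ ℚ.+ dev ℚ.≤ ¼ ℚ.+ ⅛
    le = subst (ℚ._≤ ¼ ℚ.+ ⅛) (trans (truth≡ χ S) (cong (ℚ._+ dev)
           (trans (average-cong m (half ∘ h)) (average-const m ½)))) close
    step : ⅛ ℚ.≤ ℚ.- dev
    step = subst₂ ℚ._≤_
      (solve 1 (λ d → κ ½ ⊞ d ⊞ (κ (ℚ.- (¼ ℚ.+ ⅛)) ⊞ ⊟ d) := κ ⅛) refl dev)
      (solve 1 (λ d → κ (¼ ℚ.+ ⅛) ⊞ (κ (ℚ.- (¼ ℚ.+ ⅛)) ⊞ ⊟ d) := ⊟ d) refl dev)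
      (ℚₚ.+-monoˡ-≤ (ℚ.- (¼ ℚ.+ ⅛) ℚ.+ ℚ.- dev) le)

  ⅛t≤ : ⅛ ℚ.* ℕ→ℚ 9 ℚ.≤ ℚ.∣ deviation χ S ∣ ℚ.* ℕ→ℚ (9 + t)
  ⅛t≤ = *-mono {⅛} {ℚ.∣ deviation χ S ∣} {ℕ→ℚ 9} {ℕ→ℚ (9 + t)}
    (ℚₚ.≤ᵇ⇒≤ _) (0≤ℕ→ℚ (9 + t)) ⅛≤∣dev∣ (ℕ→ℚ-mono {9} {9 + t} (ℕₚ.m≤m+n 9 t))

Succeeds : SQLearner → ∀ {n} → ℕ → (Vec Bool n → Bool) → Distribution n → ∀ εs δs →
  0ℚ ℚ.< fraction εs → 0ℚ ℚ.< fraction δs → Oracle → Set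
Succeeds L s f D εs δs ε>0 δ>0 𝒪 = Admissible → (∀ cs → Efficient cs) × AccurateWithConfidence
  where open Run L s f D εs δs ε>0 δ>0 𝒪

module _ (L : SQLearner) {m n : ℕ} (s : ℕ) (enc : Vec Bool m → Vec Bool n) (f : Vec Bool m → Vec Bool n → Bool)
         (f-enc : ∀ S b → f S (enc b) ≡ inner S b) (εs δs : List Bool)
         (ε>0 : 0ℚ ℚ.< fraction εs) (δ>0 : 0ℚ ℚ.< fraction δs) (ε≡¼ : fraction εs ≡ ¼) (δ≡½ : fraction δs ≡ ½)
         (succeeds : ∀ S 𝒪 → Succeeds L s (f S) (image enc) εs δs ε>0 δ>0 𝒪) where
  open SQLearner L

  private
    D : Distribution n
    D = image enc

  test : List Bool → Test m
  test w b y = χ w (enc b) y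

  hypothesis-test : List Bool → Test m
  hypothesis-test h b y = hypothesis h (enc b) xor y

  Pr-target : ∀ k (A : Vec Bool n → Bool → Bool) S →
    Pr (Distribution.approx D k) (λ a → A a (f S a)) ≡ truth (λ b → A (enc b)) S
  Pr-target k A S = trans (Pr-image enc k (λ a → A a (f S a)))
    (average-cong m λ b → cong (λ y → 𝟙 (A (enc b) y)) (f-enc S b))

  neutral-answer : ∀ w → Σ[ v ∈ Answer ] answer-value v ≡ neutral (test w)
  neutral-answer w = dyadic-answer (dyadic-half^ m (dyadic-sumCube m λ b →
    dyadic-half^ 1 (dyadic-+ (dyadic-𝟙 (test w b false)) (dyadic-𝟙 (test w b true)))))

  truth-answer : ∀ S w → Σ[ v ∈ Answer ] answer-value v ≡ truth (test w) S
  truth-answer S w = dyadic-answer (dyadic-half^ m (dyadic-sumCube m λ b → dyadic-𝟙 (test w b (inner S b))))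

  neutral-oracle : Oracle
  neutral-oracle (query w τ) _ = proj₁ (neutral-answer w)

  -- Reveals something about S only when the tolerance leaves no choice.
  reluctant-oracle : Vec Bool m → Oracle
  reluctant-oracle S (query w τ) _ =
    choose (ℚ.∣ deviation (test w) S ∣ ℚₚ.≤? τ) (proj₁ (neutral-answer w)) (proj₁ (truth-answer S w))

  module Target (S : Vec Bool m) = Run L s (f S) D εs δs ε>0 δ>0 (reluctant-oracle S)

  -- The neutral answer misses the truth by the absolute deviation, and it is given only when this
  -- is within the tolerance; otherwise the answer is exact.
  reluctant-admissible : ∀ S → Target.Admissible S
  reluctant-admissible S w τ _ 0<τ = choose-elim
    (λ v → PrWithin D (λ a → χ w a (f S a)) τ (answer-value v))
    (ℚ.∣ deviation (test w) S ∣ ℚₚ.≤? τ)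
    (λ dev≤τ k → within k (proj₂ (neutral-answer w)) (subst (ℚ._≤ τ) (sym (neutral-error)) dev≤τ))
    (λ k → within k (proj₂ (truth-answer S w)) (ℚₚ.≤-trans (ℚₚ.≤-reflexive (cong ℚ.∣_∣ (ℚₚ.+-inverseʳ (truth (test w) S)))) (ℚₚ.<⇒≤ 0<τ)))
    where
    neutral-error : ℚ.∣ neutral (test w) ℚ.- truth (test w) S ∣ ≡ ℚ.∣ deviation (test w) S ∣
    neutral-error = trans (cong ℚ.∣_∣ (trans (cong (λ x → neutral (test w) ℚ.- x) (truth≡ (test w) S))
      (solve 2 (λ a b → a ⊞ ⊟ (a ⊞ b) := ⊟ b) refl (neutral (test w)) (deviation (test w) S))))
      (ℚₚ.∣-p∣≡∣p∣ (deviation (test w) S))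

    within : ∀ k {v q} → v ≡ q → ℚ.∣ q ℚ.- truth (test w) S ∣ ℚ.≤ τ →
      ℚ.∣ v ℚ.- Pr (Distribution.approx D k) (λ a → χ w a (f S a)) ∣ ℚ.≤ τ ℚ.+ 1/1+ k
    within k {v} {q} refl le = ℚₚ.≤-trans
      (subst (λ x → ℚ.∣ q ℚ.- x ∣ ℚ.≤ τ) (sym (Pr-target k (χ w) S)) le)
      (subst (ℚ._≤ τ ℚ.+ 1/1+ k) (ℚₚ.+-identityʳ τ) (ℚₚ.+-monoʳ-≤ τ (0≤1/1+ k)))

  private
    1/ε 1/δ : ℕ
    1/ε = ⌈1/ fraction εs ⌉ {ε>0}
    1/δ = ⌈1/ fraction δs ⌉ {δ>0}

  time allowance : ℕ
  time      = ⟦ timeBound ⟧ (n ∷ s ∷ 1/ε ∷ 1/δ ∷ [])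
  allowance = ⟦ toleranceBound ⟧ (n ∷ s ∷ 1/ε ∷ [])

  open Execution learner using (Configuration; asked; run; initial; output)

  neutral-start : Configuration
  neutral-start = initial (unary n ∷ unary s ∷ εs ∷ δs ∷ [])

  neutral-run : Vec Bool time → Configuration
  neutral-run cs = run neutral-oracle cs neutral-start

  -- Determined by the coins alone, not by S. The error event of the final hypothesis is treated as
  -- one more query.
  tests : Vec Bool time → List (Test m)
  tests cs = hypothesis-test (output (neutral-run cs)) ∷ List.map (test ∘ Query.word) (asked (neutral-run cs))

  guarantee : ∀ S → (∀ cs → Target.Efficient S cs) × Target.AccurateWithConfidence S
  guarantee S = succeeds S (reluctant-oracle S) (reluctant-admissible S)

  -- Efficiency of the actual run makes the tolerance at least 1/allowance, and being undetected
  -- makes the deviation at most 1/(9 + allowance). The reluctant oracle therefore answers neutrally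
  -- on every common query.
  undetected-agree : ∀ S cs → detected (9 + allowance) (tests cs) S ≡ false →
    Target.final S cs ≡ neutral-run cs
  undetected-agree S cs undetected = run-agree learner (reluctant-oracle S) neutral-oracle cs neutral-start agree
    where
    agree : ∀ q → q ∈ asked (Target.final S cs) → q ∈ asked (neutral-run cs) →
      ∀ e → reluctant-oracle S q e ≡ neutral-oracle q e
    agree q@(query w τ) q∈ q∈′ e = choose-yes (ℚ.∣ deviation (test w) S ∣ ℚₚ.≤? τ)
      (below allowance (All.lookup (proj₂ (proj₂ (proj₁ (guarantee S) cs))) q∈) small)
      where
      dev : ℚ
      dev = deviation (test w) S

      undetected-w : detects (test w) (9 + allowance) S ≡ false
      undetected-w = not-true (detects (test w) (9 + allowance) S) λ hit → contradiction (trans (sym undetected)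
        (detected-∈ (9 + allowance) (tests cs) S (there (∈-map⁺ (test ∘ Query.word) q∈′)) hit)) λ ()

      small : ℚ.∣ dev ∣ ℚ.* ℕ→ℚ (9 + allowance) ℚ.≤ 1ℚ
      small = not-does-false (large? (test w) (9 + allowance) S) undetected-w

      below : ∀ t → 1ℚ ℚ.≤ τ ℚ.* ℕ→ℚ t → ℚ.∣ dev ∣ ℚ.* ℕ→ℚ (9 + t) ℚ.≤ 1ℚ → ℚ.∣ dev ∣ ℚ.≤ τ
      below zero    1≤ _  = ⊥-elim (ℚₚ.<-irrefl refl
        (ℚₚ.<-≤-trans (ℚₚ.positive⁻¹ 1ℚ) (ℚₚ.≤-trans 1≤ (ℚₚ.≤-reflexive (ℚₚ.*-zeroʳ τ)))))
      below (suc t) 1≤ ≤1 = ℚₚ.*-cancelʳ-≤-pos (ℕ→ℚ (suc t)) {{ℕ→ℚ-suc-positive t}}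
        (ℚₚ.≤-trans (*-monoˡ ℚ.∣ dev ∣ (ℚₚ.0≤∣p∣ dev) (ℕ→ℚ-mono {suc t} {9 + suc t} (ℕₚ.m≤n+m (suc t) 9)))
                    (ℚₚ.≤-trans ≤1 1≤))

  -- For an undetected target the actual hypothesis is the neutral one; being accurate, its own
  -- error test at the head of `tests` detects the target after all.
  accurate⇒detected : ∀ S cs → Target.Accurate S cs → detected (9 + allowance) (tests cs) S ≡ true
  accurate⇒detected S cs accurate = unless-false (detected (9 + allowance) (tests cs) S) λ undetected →
    detected-∈ (9 + allowance) (tests cs) S (here refl)
      (close-detects allowance (λ b → hypothesis (output (neutral-run cs)) (enc b)) S
        (subst (λ c → truth (hypothesis-test (output c)) S ℚ.≤ ¼ ℚ.+ ⅛) (undetected-agree S cs undetected)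
          (subst (ℚ._≤ ¼ ℚ.+ ⅛) (Pr-target 7 (λ a y → hypothesis (output (Target.final S cs)) a xor y) S)
            (subst (λ ε → Pr (Distribution.approx D 7) (λ a → hypothesis (output (Target.final S cs)) a xor f S a) ℚ.≤ ε ℚ.+ ⅛)
              -- At index 7 the allowance `1/1+ 7` for the approximation is the ⅛ granted in
              -- `close-detects`.
              ε≡¼ (accurate 7)))))

  success : Vec Bool m → Vec Bool time → Bool
  success S = proj₁ (proj₂ (guarantee S))

  counted : ℕ
  counted = suc time * ((9 + allowance) * (9 + allowance))

  count : ∀ cs → sumCube m (λ S → 𝟙 (success S cs)) ℚ.≤ ℕ→ℚ counted
  count cs = begin
    sumCube m (λ S → 𝟙 (success S cs))                                ≤⟨ sumCube-mono m (λ S → 𝟙-mono (success S cs) (detected (9 + allowance) (tests cs) S)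
                                                                         (accurate⇒detected S cs ∘ proj₁ (proj₂ (proj₂ (guarantee S))) cs)) ⟩
    sumCube m (λ S → 𝟙 (detected (9 + allowance) (tests cs) S))     ≤⟨ detected-count (9 + allowance) (tests cs) ⟩
    ℕ→ℚ (length (tests cs) * t²)                                    ≤⟨ ℕ→ℚ-mono {length (tests cs) * t²} {counted} (ℕₚ.*-monoˡ-≤ t² (s≤s few)) ⟩
    ℕ→ℚ counted                                                     ∎
    where
    open ℚₚ.≤-Reasoning
    t² : ℕ
    t² = (9 + allowance) * (9 + allowance)

    few : length (List.map (test ∘ Query.word) (asked (neutral-run cs))) ≤ time
    few = ℕₚ.≤-trans (ℕₚ.≤-reflexive (Listₚ.length-map (test ∘ Query.word) (asked (neutral-run cs))))
      (ℕₚ.≤-trans (length-asked-run learner neutral-oracle cs neutral-start) (ℕₚ.≤-reflexive (ℕₚ.+-identityʳ time)))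

  -- Double counting of pairs of a target and coins: each target succeeds on at least half of the
  -- coins, each coin sequence on at most `counted` targets.
  few-parities : 2 ^ m ≤ 2 * counted
  few-parities = ℕ→ℚ-cancel-≤ (2 ^ m) (2 * counted) (begin
    ℕ→ℚ (2 ^ m)
      ≡⟨ solve 1 (λ t → t := κ (ℕ→ℚ 2) ⊠ (κ ½ ⊠ t)) refl (ℕ→ℚ (2 ^ m)) ⟩
    ℕ→ℚ 2 ℚ.* (½ ℚ.* ℕ→ℚ (2 ^ m))
      ≤⟨ *-monoˡ (ℕ→ℚ 2) (0≤ℕ→ℚ 2) average-count ⟩
    ℕ→ℚ 2 ℚ.* ℕ→ℚ counted
      ≡⟨ ℕ→ℚ-* 2 counted ⟨
    ℕ→ℚ (2 * counted) ∎)
    where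
    open ℚₚ.≤-Reasoning
    h : ℚ
    h = half^ time

    average-count : ½ ℚ.* ℕ→ℚ (2 ^ m) ℚ.≤ ℕ→ℚ counted
    average-count = begin
      ½ ℚ.* ℕ→ℚ (2 ^ m)
        ≡⟨ sumCube-const m ½ ⟨
      sumCube m (λ _ → ½)
        ≤⟨ sumCube-mono m (λ S → subst (λ δ → 1ℚ ℚ.- δ ℚ.≤ Pr (uniform time) (success S)) δ≡½ (proj₂ (proj₂ (proj₂ (guarantee S))))) ⟩
      sumCube m (λ S → sumCube time (λ cs → if success S cs then uniform time cs else 0ℚ))
        ≡⟨ sumCube-cong m (λ S → sumCube-cong time λ cs →
             trans (if-weight (success S cs) (uniform time cs)) (cong (𝟙 (success S cs) ℚ.*_) (uniform≡half^ time cs))) ⟩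
      sumCube m (λ S → sumCube time (λ cs → 𝟙 (success S cs) ℚ.* h))
        ≡⟨ sumCube-swap m time _ ⟩
      sumCube time (λ cs → sumCube m (λ S → 𝟙 (success S cs) ℚ.* h))
        ≡⟨ sumCube-cong time (λ cs → sumCube-*ʳ m h _) ⟩
      sumCube time (λ cs → sumCube m (λ S → 𝟙 (success S cs)) ℚ.* h)
        ≤⟨ sumCube-mono time (λ cs → *-monoʳ h (0≤half^ time) (count cs)) ⟩
      sumCube time (λ _ → ℕ→ℚ counted ℚ.* h)
        ≡⟨ sumCube-*ˡ time (ℕ→ℚ counted) _ ⟩
      ℕ→ℚ counted ℚ.* sumCube time (λ _ → h)
        ≡⟨ trans (cong (ℕ→ℚ counted ℚ.*_) (sumCube-half^ time)) (ℚₚ.*-identityʳ (ℕ→ℚ counted)) ⟩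
      ℕ→ℚ counted ∎

not-learnable : ∀ {𝒞 O} → Expresses 𝒞 O → XorContext O → ¬ EfficientlySQLearnable 𝒞
not-learnable {𝒞} expresses X (L , learns) = few-parities-bound timeBound toleranceBound (formulaSize (proj₁ X)) 1/ε 1/δ parities
  where
  open SQLearner L

  1/ε 1/δ : ℕ
  1/ε = ⌈1/ fraction εs₀ ⌉ {ε₀>0}
  1/δ = ⌈1/ fraction δs₀ ⌉ {δ₀>0}

  module _ (d : ℕ) where
    target : Vec Bool (double^ d) → RepresentationClass.Member 𝒞 (2 + (double^ d + double^ d))
    target S = proj₁ (expresses (proj₁ (parity-formula X d S)))

    parities : Bounded timeBound toleranceBound (formulaSize (proj₁ X)) 1/ε 1/δ d
    parities = few-parities L {double^ d} (formulaSize (proj₁ X) ^ d) encode (λ S → RepresentationClass.eval 𝒞 (target S))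
      (λ S b → trans (proj₂ (proj₂ (expresses (proj₁ (parity-formula X d S)))) (encode b)) (proj₂ (proj₂ (parity-formula X d S)) b))
      εs₀ δs₀ ε₀>0 δ₀>0 refl refl
      λ S → learns (formulaSize (proj₁ X) ^ d) (target S)
        (ℕₚ.≤-trans (proj₁ (proj₂ (expresses (proj₁ (parity-formula X d S))))) (proj₁ (proj₂ (parity-formula X d S))))
        (image {double^ d} encode) εs₀ δs₀ ε₀>0 δ₀>0

learnable⇒tractable : ∀ {𝒞 O} → Expresses 𝒞 O → EfficientlySQLearnable 𝒞 → Tractable O
learnable⇒tractable {O = O} expresses learnable =
  Sum.[ id , (λ X → ⊥-elim (not-learnable expresses X learnable)) ]′ (tractable-or-xor O)

-- Machines that toss no coins

module _ {coins queries inputs} {M : Machine coins queries inputs} (𝒪 : Oracle) where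
  open Execution M

  -- A derivation covers all coin sequences at once, because `next` asks for a step that ignores the
  -- coin. The lemmas on phases of a machine are in continuation form: from a derivation for the end
  -- of a phase they build one for its beginning, adding the cost.
  data Finishes (P : Configuration → Set) : ℕ → Configuration → Set where
    stop : ∀ {k c} → Halted c → P c → Finishes P k c
    next : ∀ {k c} → (∀ coin → step 𝒪 coin c ≡ step 𝒪 false c) →
      Finishes P k (step 𝒪 false c) → Finishes P (suc k) c

  finishes-weaken : ∀ {P j k c} → j ≤ k → Finishes P j c → Finishes P k c
  finishes-weaken j≤k       (stop h p)     = stop h p
  finishes-weaken (s≤s j≤k) (next eq fin)  = next eq (finishes-weaken j≤k fin)

  run-halted : ∀ {t} (cs : Vec Bool t) c → Halted c → run 𝒪 cs c ≡ c
  run-halted []       c h = refl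
  run-halted (b ∷ cs) c h = trans (cong (run 𝒪 cs) stays) (run-halted cs c h)
    where
    stays : step 𝒪 b c ≡ c
    stays with instruction c
    stays | halt = refl

  finishes-run : ∀ {P k t c} → Finishes P k c → k ≤ t → (cs : Vec Bool t) →
    Halted (run 𝒪 cs c) × P (run 𝒪 cs c)
  finishes-run {P} {c = c} (stop h p) _ cs =
    subst (λ c → Halted c × P c) (sym (run-halted cs c h)) (h , p)
  finishes-run {P} (next eq fin) (s≤s k≤t) (b ∷ cs) =
    subst (λ c → Halted (run 𝒪 cs c) × P (run 𝒪 cs c)) (sym (eq b)) (finishes-run fin k≤t cs)

keep : Symbol → Symbol × Direction
keep x = x , stay

write : Bool → Symbol × Direction
write b = just b , stay

back : List Symbol → List Symbol → Tape
back ls rs = proj₂ (uncons ls) ◂ (proj₁ (uncons ls) ∷ rs)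

-- Literals

-- Candidate 2j is the literal aⱼ and candidate 2j+1 the literal ¬aⱼ;
-- beyond the end of a both are violated, hence constantly false.
opposes : Bool → Symbol → Bool
opposes v (just b) = b xor v
opposes v nothing  = true

violated : Bool → ℕ → List Symbol → Bool
violated v     zero    rs = opposes v (proj₁ (uncons rs))
violated true  (suc k) rs = violated false k rs
violated false (suc k) rs = violated true k (proj₂ (uncons rs))

consistent : Bool → List Bool → List Symbol → Bool
consistent v     []       rs = true
consistent true  (m ∷ ms) rs = not (m ∧ opposes true (proj₁ (uncons rs))) ∧ consistent false ms rs
consistent false (m ∷ ms) rs = not (m ∧ opposes false (proj₁ (uncons rs))) ∧ consistent true ms (proj₂ (uncons rs))

-- Rewriting the scanned symbol extends an empty tape by a blank.
settled : List Symbol → List Symbol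
settled rs = proj₁ (uncons rs) ∷ proj₂ (uncons rs)

violated-settled : ∀ v k rs → violated v k (settled rs) ≡ violated v k rs
violated-settled true  zero    rs = refl
violated-settled false zero    rs = refl
violated-settled true  (suc k) rs = violated-settled false k rs
violated-settled false (suc k) rs = refl

consistent-settled : ∀ v ms rs → consistent v ms (settled rs) ≡ consistent v ms rs
consistent-settled v     []       rs = refl
consistent-settled true  (m ∷ ms) rs = cong (_ ∧_) (consistent-settled false ms rs)
consistent-settled false (m ∷ ms) rs = refl

agrees : Bool → Symbol → Bool
agrees d (just b) = not (b xor d)
agrees d nothing  = false

-- The predicates queried

module _ (d : Bool) where

  -- Only the length of the query word matters: it is the number of a candidate. States 0 and 1 hold
  -- its parity, and the head on a advances at every second letter.
  δᴱ : Fin 3 → Vec Symbol 8 → Instruction false false 8 3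
  δᴱ 0F (o ∷ t ∷ f ∷ i ∷ g ∷ nothing ∷ a ∷ b ∷ []) =
    move (write (opposes true a ∧ agrees d b) ∷ keep t ∷ keep f ∷ keep i ∷ keep g ∷ keep nothing ∷ keep a ∷ keep b ∷ []) 2F
  δᴱ 0F (o ∷ t ∷ f ∷ i ∷ g ∷ just w ∷ a ∷ b ∷ []) =
    move (keep o ∷ keep t ∷ keep f ∷ keep i ∷ keep g ∷ (just w , right) ∷ keep a ∷ keep b ∷ []) 1F
  δᴱ 1F (o ∷ t ∷ f ∷ i ∷ g ∷ nothing ∷ a ∷ b ∷ []) =
    move (write (opposes false a ∧ agrees d b) ∷ keep t ∷ keep f ∷ keep i ∷ keep g ∷ keep nothing ∷ keep a ∷ keep b ∷ []) 2F
  δᴱ 1F (o ∷ t ∷ f ∷ i ∷ g ∷ just w ∷ a ∷ b ∷ []) =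
    move (keep o ∷ keep t ∷ keep f ∷ keep i ∷ keep g ∷ (just w , right) ∷ (a , right) ∷ keep b ∷ []) 0F
  δᴱ 2F _ = halt

  machineᴱ : Machine false false 3
  machineᴱ = record { work = 0 ; states = 3 ; start = 0F ; δ = δᴱ }

  private
    module E = Execution machineᴱ

  phaseᴱ : Bool → Fin 3
  phaseᴱ true  = 0F
  phaseᴱ false = 1F

  finishesᴱ : ∀ v w {o t f i g lw la ra lb rb qs r} → violated v (length w) ra ∧ agrees d (proj₁ (uncons rb)) ≡ r →
    Finishes {M = machineᴱ} no-oracle (λ c → accepting (E.output c) ≡ r)
      (suc (length w))
      (record { state = phaseᴱ v ; tapes = o ∷ t ∷ f ∷ i ∷ g ∷ (lw ◂ List.map just w) ∷ (la ◂ ra) ∷ (lb ◂ rb) ∷ [] ; asked = qs })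
  finishesᴱ true  []      eq = next (λ _ → refl) (stop refl eq)
  finishesᴱ false []      eq = next (λ _ → refl) (stop refl eq)
  finishesᴱ true  (x ∷ w) {ra = ra} eq = next (λ _ → refl)
    (finishesᴱ false w (trans (cong (_∧ _) (violated-settled false (length w) ra)) eq))
  finishesᴱ false (x ∷ w) eq = next (λ _ → refl) (finishesᴱ true w eq)

  queried : PolyTime false 3
  queried = record
    { machine = machineᴱ
    ; bound   = con 1 :+ var 0F
    ; halts   = λ { (w ∷ a ∷ b ∷ []) cs → proj₁ (finishes-run no-oracle (finishesᴱ true w refl) (s≤s (ℕₚ.m≤m+n (length w) _)) cs) }
    }

  decide-queried : ∀ w a b → decide queried (w ∷ a ∷ (b ∷ []) ∷ []) ≡
    violated true (length w) (List.map just a) ∧ not (b xor d)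
  decide-queried w a b = proj₂ (finishes-run no-oracle (finishesᴱ true w refl) (s≤s (ℕₚ.m≤m+n (length w) _)) (replicate _ false))

-- The hypotheses

  -- The marks are stored with the newest candidate first, so the head runs to their end and reads
  -- them on the way back while the head on a moves right at every second mark.
  δᴴ : Fin 4 → Vec Symbol 7 → Instruction false false 7 4
  δᴴ 0F (o ∷ t ∷ f ∷ i ∷ g ∷ nothing ∷ a ∷ []) =
    move (keep o ∷ keep t ∷ keep f ∷ keep i ∷ keep g ∷ (nothing , left) ∷ keep a ∷ []) 1F
  δᴴ 0F (o ∷ t ∷ f ∷ i ∷ g ∷ just m ∷ a ∷ []) =
    move (keep o ∷ keep t ∷ keep f ∷ keep i ∷ keep g ∷ (just m , right) ∷ keep a ∷ []) 0F
  δᴴ 1F (o ∷ t ∷ f ∷ i ∷ g ∷ nothing ∷ a ∷ []) =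
    move (write d ∷ keep t ∷ keep f ∷ keep i ∷ keep g ∷ keep nothing ∷ keep a ∷ []) 3F
  δᴴ 1F (o ∷ t ∷ f ∷ i ∷ g ∷ just m ∷ a ∷ []) =
    if m ∧ opposes true a
    then move (write (not d) ∷ keep t ∷ keep f ∷ keep i ∷ keep g ∷ keep (just m) ∷ keep a ∷ []) 3F
    else move (keep o ∷ keep t ∷ keep f ∷ keep i ∷ keep g ∷ (just m , left) ∷ keep a ∷ []) 2F
  δᴴ 2F (o ∷ t ∷ f ∷ i ∷ g ∷ nothing ∷ a ∷ []) =
    move (write d ∷ keep t ∷ keep f ∷ keep i ∷ keep g ∷ keep nothing ∷ keep a ∷ []) 3F
  δᴴ 2F (o ∷ t ∷ f ∷ i ∷ g ∷ just m ∷ a ∷ []) =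
    if m ∧ opposes false a
    then move (write (not d) ∷ keep t ∷ keep f ∷ keep i ∷ keep g ∷ keep (just m) ∷ keep a ∷ []) 3F
    else move (keep o ∷ keep t ∷ keep f ∷ keep i ∷ keep g ∷ (just m , left) ∷ (a , right) ∷ []) 1F
  δᴴ 3F _ = halt

  machineᴴ : Machine false false 2
  machineᴴ = record { work = 0 ; states = 4 ; start = 0F ; δ = δᴴ }

  private
    module H = Execution machineᴴ

  phaseᴴ : Bool → Fin 4
  phaseᴴ true  = 1F
  phaseᴴ false = 2F

  verdict : Bool → Bool
  verdict b = if b then d else not d

  sweep : ∀ v ms {o t f i g rs la ra qs r} → verdict (consistent v ms ra) ≡ r →
    Finishes {M = machineᴴ} no-oracle (λ c → accepting (H.output c) ≡ r) (suc (length ms))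
      (record { state = phaseᴴ v ; tapes = o ∷ t ∷ f ∷ i ∷ g ∷ back (List.map just ms) rs ∷ (la ◂ ra) ∷ [] ; asked = qs })
  sweep true  []           eq = next (λ _ → refl) (stop refl eq)
  sweep false []           eq = next (λ _ → refl) (stop refl eq)
  sweep true  (false ∷ ms) {ra = ra} eq = next (λ _ → refl)
    (sweep false ms (trans (cong verdict (consistent-settled false ms ra)) eq))
  sweep false (false ∷ ms) eq = next (λ _ → refl) (sweep true ms eq)
  sweep true  (true ∷ ms) {ra = []}              eq = next (λ _ → refl) (stop refl eq)
  sweep true  (true ∷ ms) {ra = nothing ∷ ra}    eq = next (λ _ → refl) (stop refl eq)
  sweep true  (true ∷ ms) {ra = just true ∷ ra}  eq = next (λ _ → refl) (sweep false ms eq)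
  sweep true  (true ∷ ms) {ra = just false ∷ ra} eq = next (λ _ → refl) (stop refl eq)
  sweep false (true ∷ ms) {ra = []}              eq = next (λ _ → refl) (stop refl eq)
  sweep false (true ∷ ms) {ra = nothing ∷ ra}    eq = next (λ _ → refl) (stop refl eq)
  sweep false (true ∷ ms) {ra = just true ∷ ra}  eq = next (λ _ → refl) (stop refl eq)
  sweep false (true ∷ ms) {ra = just false ∷ ra} eq = next (λ _ → refl) (sweep true ms eq)

  finishesᴴ : ∀ h ms {o t f i g la ra qs r} → verdict (consistent true (h ʳ++ ms) ra) ≡ r →
    Finishes {M = machineᴴ} no-oracle (λ c → accepting (H.output c) ≡ r)
      (suc (length h + suc (length (h ʳ++ ms))))
      (record { state = 0F ; tapes = o ∷ t ∷ f ∷ i ∷ g ∷ (List.map just ms ◂ List.map just h) ∷ (la ◂ ra) ∷ [] ; asked = qs })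
  finishesᴴ []      ms {ra = ra} eq = next (λ _ → refl) (sweep true ms (trans (cong verdict (consistent-settled true ms ra)) eq))
  finishesᴴ (x ∷ h) ms {ra = ra} eq = next (λ _ → refl)
    (finishesᴴ h (x ∷ ms) (trans (cong verdict (consistent-settled true (h ʳ++ (x ∷ ms)) ra)) eq))

  enoughᴴ : ∀ (h : List Bool) k → suc (length h + suc (length (h ʳ++ []))) ≤ 2 + 2 * (length h + k)
  enoughᴴ h k = begin
    suc (length h + suc (length (h ʳ++ [])))  ≡⟨ cong (λ n → suc (length h + suc n)) (Listₚ.length-reverse h) ⟩
    suc (length h + suc (length h))           ≡⟨ double (length h) ⟩
    2 + 2 * length h                          ≤⟨ ℕₚ.+-monoʳ-≤ 2 (ℕₚ.*-monoʳ-≤ 2 (ℕₚ.m≤m+n (length h) k)) ⟩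
    2 + 2 * (length h + k)                    ∎
    where
    open ℕₚ.≤-Reasoning
    double : ∀ n → suc (n + suc n) ≡ 2 + 2 * n
    double = solve-∀

  runsᴴ : ∀ (h a : List Bool) → Finishes {M = machineᴴ} no-oracle
    (λ c → accepting (H.output c) ≡ verdict (consistent true (reverse h) (List.map just a)))
    (suc (length h + suc (length (h ʳ++ [])))) (H.initial (h ∷ a ∷ []))
  runsᴴ h a = finishesᴴ h [] refl

  hypotheses : PolyTime false 2
  hypotheses = record
    { machine = machineᴴ
    ; bound   = con 2 :+ (con 2 :* var 0F)
    ; halts   = λ { (h ∷ a ∷ []) cs → proj₁ (finishes-run no-oracle (runsᴴ h a) (enoughᴴ h (length a + 0)) cs) }
    }

  decide-hypotheses : ∀ h a → decide hypotheses (h ∷ a ∷ []) ≡ verdict (consistent true (reverse h) (List.map just a))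
  decide-hypotheses h a = proj₂ (finishes-run no-oracle (runsᴴ h a) (enoughᴴ h (length a + 0))
    (replicate (PolyTime.time hypotheses (h ∷ a ∷ [])) false))

-- The machine of the learner

pattern 10F = suc 9F
pattern 11F = suc 10F
pattern 12F = suc 11F
pattern 13F = suc 12F
pattern 14F = suc 13F
pattern 15F = suc 14F
pattern 16F = suc 15F
pattern 17F = suc 16F
pattern 18F = suc 17F
pattern 19F = suc 18F
pattern 20F = suc 19F
pattern 21F = suc 20F
pattern 22F = suc 21F
pattern 23F = suc 22F

asking : Bool → Fin 24
asking true  = 10F
asking false = 11F

integral : Bool → Fin 24
integral true  = 12F
integral false = 13F

magnitude : Bool → Fin 24
magnitude true  = 14F
magnitude false = 15F

comparing : Bool → Fin 24
comparing true  = 16F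
comparing false = 17F

-- The first argument is the bit to be recorded once the numeral 0^k 1 is rewound, the second
-- whether the candidate is the first of its pair.
rewinding : Bool → Bool → Fin 24
rewinding true  true  = 18F
rewinding true  false = 19F
rewinding false true  = 20F
rewinding false false = 21F

-- The scanned symbols are o, t, f, i and g on the tapes of output, tolerance
-- and answer, in this order, and n, s, e and d on those of n, s, ε and δ.
module _ (t s d : Symbol) where

  private
    moves : (o f i g n e : Symbol × Direction) → Fin 24 → Instruction true true 9 24
    moves o f i g n e q = move (o ∷ keep t ∷ f ∷ i ∷ g ∷ n ∷ keep s ∷ e ∷ keep d ∷ []) q

    integral-rule magnitude-rule compare-rule : Bool → (o f i g n e : Symbol) → Instruction true true 9 24
    integral-rule v o f (just true) g n e =
      moves (o , left) (keep f) (keep (just true)) (keep g) (keep n) (keep e) (rewinding true v)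
    integral-rule v o f i g n e =
      moves (keep o) (keep f) (i , right) (keep g) (keep n) (keep e) (magnitude v)

    magnitude-rule v o f (just true) g n e =
      moves (o , left) (keep f) (keep (just true)) (keep g) (keep n) (keep e) (rewinding false v)
    magnitude-rule v o f i g n e =
      moves (keep o) (keep f) (keep i) (keep g) (keep n) (keep e) (comparing v)

    -- A digit 1 of the answer against a 0 of the numeral 0^k 1 means a value of at least 2^-k;
    -- reaching the final 1 means that the first k digits vanish.
    compare-rule v o (just false) i (just true) n e =
      moves (o , left) (keep (just false)) (keep i) (keep (just true)) (keep n) (keep e) (rewinding false v)
    compare-rule v o (just false) i g n e =
      moves (keep o) (just false , right) (keep i) (g , right) (keep n) (keep e) (comparing v)
    compare-rule v o f i g n e =
      moves (o , left) (keep f) (keep i) (keep g) (keep n) (keep e) (rewinding true v)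

    rewind-rule : Bool → Bool → (o f i g n e : Symbol) → Instruction true true 9 24
    rewind-rule b v     o (just x) i g n e = moves (keep o) (just x , left) (keep i) (keep g) (keep n) (keep e) (rewinding b v)
    rewind-rule b true  o nothing  i g n e = moves (write b) (nothing , right) (keep i) (keep g) (keep n) (keep e) (asking false)
    rewind-rule b false o nothing  i g n e = moves (write b) (nothing , right) (keep i) (keep g) (n , left) (keep e) 22F

    push : (o i g e : Symbol) → Symbol × Direction → Fin 24 → Instruction true true 9 24
    push o i g e n q = moves (keep o) (just false , left) (keep i) (keep g) n (keep e) q

    pass : (o f i g e : Symbol) → Symbol × Direction → Fin 24 → Instruction true true 9 24
    pass o f i g e n q = moves (keep o) (keep f) (keep i) (keep g) n (keep e) q

  rules : Fin 24 → (o f i g n e : Symbol) → Instruction true true 9 24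
  rules 0F o f i g n e = moves (keep o) (just true , left) (keep i) (keep g) (keep n) (keep e) 1F
  -- States 1 to 4 write the four zeros that form the summand 4 of k.
  rules 1F o f i g n e = push o i g e (keep n) 2F
  rules 2F o f i g n e = push o i g e (keep n) 3F
  rules 3F o f i g n e = push o i g e (keep n) 4F
  rules 4F o f i g n e = push o i g e (keep n) 5F
  -- a zero for each leading zero of ε
  rules 5F o f i g n (just false) = moves (keep o) (just false , left) (keep i) (keep g) (keep n) (just false , right) 5F
  rules 5F o f i g n e            = pass o f i g e (keep n) 6F
  -- a zero for each halving of n, erasing every other digit of its unary
  -- numeral in a pass to the right
  rules 6F o f i g (just true)  e = pass o f i g e (just false , right) 7F
  rules 6F o f i g (just false) e = pass o f i g e (just false , right) 6F
  rules 6F o f i g nothing      e = moves (keep o) (f , right) (keep i) (keep g) (keep nothing) (keep e) (asking true)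
  rules 7F o f i g (just true)  e = pass o f i g e (just true , right) 8F
  rules 7F o f i g (just false) e = pass o f i g e (just false , right) 7F
  rules 7F o f i g nothing      e = push o i g e (nothing , left) 9F
  rules 8F o f i g (just true)  e = pass o f i g e (just false , right) 7F
  rules 8F o f i g (just false) e = pass o f i g e (just false , right) 8F
  rules 8F o f i g nothing      e = push o i g e (nothing , left) 9F
  rules 9F o f i g (just x)     e = pass o f i g e (just x , left) 9F
  rules 9F o f i g nothing      e = pass o f i g e (nothing , right) 6F
  -- two queries for each digit of n and for the blank to its right
  rules 10F o f i g n e = ask tt (integral true)
  rules 11F o f i g n e = ask tt (integral false)
  rules 12F = integral-rule true
  rules 13F = integral-rule false
  rules 14F = magnitude-rule true
  rules 15F = magnitude-rule false
  rules 16F = compare-rule true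
  rules 17F = compare-rule false
  rules 18F = rewind-rule true true
  rules 19F = rewind-rule true false
  rules 20F = rewind-rule false true
  rules 21F = rewind-rule false false
  rules 22F o f i g (just x) e = pass o f i g e (keep (just x)) (asking true)
  rules 22F o f i g nothing  e = pass o f i g e (keep nothing) 23F
  rules 23F o f i g n e = halt

machineᴸ : Machine true true 4
machineᴸ = record { work = 0 ; states = 24 ; start = 0F ; δ = δᴸ }
  where
  δᴸ : Fin 24 → Vec Symbol 9 → Instruction true true 9 24
  δᴸ q (o ∷ t ∷ f ∷ i ∷ g ∷ n ∷ s ∷ e ∷ d ∷ []) = rules t s d q o f i g n e

-- i + j, in the form in which i cells are passed one by one
_⊕_ : ℕ → ℕ → ℕ
zero  ⊕ j = j
suc i ⊕ j = i ⊕ suc j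

⊕≡+ : ∀ i j → i ⊕ j ≡ i + j
⊕≡+ zero    j = refl
⊕≡+ (suc i) j = trans (⊕≡+ i (suc j)) (ℕₚ.+-suc i j)

zeros : ℕ → List Symbol
zeros zero    = just true ∷ []
zeros (suc k) = just false ∷ zeros k

margin : ℕ → List Symbol
margin zero    = nothing ∷ []
margin (suc i) = just false ∷ margin i

shift : ℕ → List Symbol → List Symbol
shift zero    rs = rs
shift (suc i) rs = shift i (just false ∷ rs)

shift-zeros : ∀ i j → shift i (zeros j) ≡ zeros (i ⊕ j)
shift-zeros zero    j = refl
shift-zeros (suc i) j = shift-zeros i (suc j)

data Blank : List Symbol → Set where
  none : Blank []
  some : ∀ {ls} → Blank (nothing ∷ ls)

clear : ℕ → List Symbol → Bool
clear zero    rs              = true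
clear (suc k) (just true ∷ _) = false
clear (suc k) rs              = clear k (proj₂ (uncons rs))

small : ℕ → List Bool → List Bool → Bool
small k (false ∷ true ∷ _) bs = false
small k (false ∷ _)        bs = clear k (List.map just bs)
small k _                  bs = true

accepts : ℕ → Answer → Bool
accepts k (answer z bs) = small k (signedBits z) bs

lead : List Symbol → ℕ
lead (just false ∷ rs) = suc (lead rs)
lead _                 = 0

thin : Bool → List Bool → List Bool
thin p     []           = []
thin true  (true ∷ bs)  = true ∷ thin false bs
thin false (true ∷ bs)  = false ∷ thin true bs
thin p     (false ∷ bs) = false ∷ thin p bs

ones : List Bool → ℕ
ones []           = 0
ones (true ∷ bs)  = suc (ones bs)
ones (false ∷ bs) = ones bs

-- `thin false` keeps half of the ones rounded down and `thin true` half rounded up; the two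
-- alternate at every one, whence the mutual induction for this bound and the three that follow.
thin-even-low  : ∀ bs → 2 * ones (thin false bs) ≤ ones bs
thin-odd-low   : ∀ bs → 2 * ones (thin true bs) ≤ suc (ones bs)
thin-even-low []           = z≤n
thin-even-low (true ∷ bs)  = thin-odd-low bs
thin-even-low (false ∷ bs) = thin-even-low bs
thin-odd-low []           = z≤n
thin-odd-low (true ∷ bs)  = ℕₚ.≤-trans (ℕₚ.≤-reflexive (ℕₚ.*-suc 2 (ones (thin false bs)))) (s≤s (s≤s (thin-even-low bs)))
thin-odd-low (false ∷ bs) = thin-odd-low bs

thin-even-high : ∀ bs → ones bs ≤ suc (2 * ones (thin false bs))
thin-odd-high  : ∀ bs → ones bs ≤ 2 * ones (thin true bs)
thin-even-high []           = z≤n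
thin-even-high (true ∷ bs)  = s≤s (thin-odd-high bs)
thin-even-high (false ∷ bs) = thin-even-high bs
thin-odd-high []           = z≤n
thin-odd-high (true ∷ bs)  = ℕₚ.≤-trans (s≤s (thin-even-high bs)) (ℕₚ.≤-reflexive (sym (ℕₚ.*-suc 2 (ones (thin false bs)))))
thin-odd-high (false ∷ bs) = thin-odd-high bs

length-thin : ∀ p bs → length (thin p bs) ≡ length bs
length-thin p     []           = refl
length-thin true  (true ∷ bs)  = cong suc (length-thin false bs)
length-thin false (true ∷ bs)  = cong suc (length-thin true bs)
length-thin true  (false ∷ bs) = cong suc (length-thin true bs)
length-thin false (false ∷ bs) = cong suc (length-thin false bs)

map-ʳ++ : ∀ (bs : List Bool) ls → List.map just bs ʳ++ ls ≡ List.map just (reverse bs) ++ ls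
map-ʳ++ bs ls = trans (Listₚ.ʳ++-defn (List.map just bs)) (cong (_++ ls) (sym (Listₚ.reverse-map just bs)))

map-reverse-ʳ++ : ∀ (bs : List Bool) ls → List.map just (reverse bs) ʳ++ ls ≡ List.map just bs ++ ls
map-reverse-ʳ++ bs ls = trans (map-ʳ++ (reverse bs) ls) (cong (λ cs → List.map just cs ++ ls) (Listₚ.reverse-involutive bs))

halving-cost : ℕ → ℕ → ℕ
halving-cost zero    N = suc N
halving-cost (suc f) N = suc N + (suc N + halving-cost f N)

-- The run of the learner, phase by phase

module _ (𝒪 : Oracle) where

  open Execution machineᴸ

  tolerance : ℕ → ℚ
  tolerance k = ℕ→ℚ 0 ℚ.+ fraction (contents ((nothing ∷ []) ◂ zeros k))

  -- The answers recorded and the queries asked, most recent first.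
  data Trace (k : ℕ) : List Bool → List Query → Set where
    []   : Trace k [] []
    more : ∀ {ms qs} → Trace k ms qs →
      Trace k (accepts k (𝒪 (query ms (tolerance k)) qs) ∷ ms) (query ms (tolerance k) ∷ qs)

  -- The tapes of s and δ are never used.
  module Phases (P : Configuration → Set) (ls rs ld rd : List Symbol) (s d : Symbol) where

    blank : Tape
    blank = [] ◂ (nothing ∷ [])

    at : Fin 24 → (o f i g n e : Tape) → List Query → Configuration
    at q o f i g n e qs = record
      { state = q
      ; tapes = o ∷ blank ∷ f ∷ i ∷ g ∷ n ∷ (ls ◂ (s ∷ rs)) ∷ e ∷ (ld ◂ (d ∷ rd)) ∷ []
      ; asked = qs
      }

    F : ℕ → Configuration → Set
    F = Finishes {M = machineᴸ} 𝒪 P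

    prepare : ∀ {k ln x rn le y re} →
      F k (at 5F blank ([] ◂ (nothing ∷ zeros 4)) blank blank (ln ◂ (x ∷ rn)) (le ◂ (y ∷ re)) []) →
      F (4 + k) (at 1F blank ([] ◂ (nothing ∷ zeros 0)) blank blank (ln ◂ (x ∷ rn)) (le ◂ (y ∷ re)) [])
    prepare cont = next (λ _ → refl) (next (λ _ → refl) (next (λ _ → refl) (next (λ _ → refl) cont)))

    scan-ε : ∀ re {le k j ln x rn} →
      (∀ {le y re′} → F k (at 6F blank ([] ◂ (nothing ∷ zeros (lead re ⊕ j))) blank blank (ln ◂ (x ∷ rn)) (le ◂ (y ∷ re′)) [])) →
      F (suc (lead re) + k) (at 5F blank ([] ◂ (nothing ∷ zeros j)) blank blank (ln ◂ (x ∷ rn)) (le ◂ re) [])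
    scan-ε []                cont = next (λ _ → refl) cont
    scan-ε (nothing ∷ re)    cont = next (λ _ → refl) cont
    scan-ε (just true ∷ re)  cont = next (λ _ → refl) cont
    scan-ε (just false ∷ re) cont = next (λ _ → refl) (scan-ε re cont)

    module _ {le re : List Symbol} {y : Symbol} where

      thinning : Fin 24 → ℕ → Tape → Configuration
      thinning q j n = at q blank ([] ◂ (nothing ∷ zeros j)) blank blank n (le ◂ (y ∷ re)) []

      sweep-odd : ∀ bs {k j ln e} → Blank e →
        (∀ {e′} → F k (thinning 9F (suc j) (back (List.map just (thin true bs) ʳ++ ln) (nothing ∷ e′)))) →
        F (suc (length bs) + k) (thinning 7F j (ln ◂ (List.map just bs ++ e)))
      sweep-even : ∀ bs {k j ln e} → Blank e →
        (∀ {e′} → F k (thinning 9F (suc j) (back (List.map just (thin false bs) ʳ++ ln) (nothing ∷ e′)))) →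
        F (suc (length bs) + k) (thinning 8F j (ln ◂ (List.map just bs ++ e)))
      sweep-odd []           none cont = next (λ _ → refl) cont
      sweep-odd []           some cont = next (λ _ → refl) cont
      sweep-odd (true ∷ bs)  e    cont = next (λ _ → refl) (sweep-even bs e cont)
      sweep-odd (false ∷ bs) e    cont = next (λ _ → refl) (sweep-odd bs e cont)
      sweep-even []           none cont = next (λ _ → refl) cont
      sweep-even []           some cont = next (λ _ → refl) cont
      sweep-even (true ∷ bs)  e    cont = next (λ _ → refl) (sweep-odd bs e cont)
      sweep-even (false ∷ bs) e    cont = next (λ _ → refl) (sweep-even bs e cont)

      rewind-n : ∀ cs {k j L rn} → Blank L →
        (∀ {L′} → Blank L′ → F k (thinning 6F j (L′ ◂ (List.map just cs ʳ++ rn)))) →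
        F (suc (length cs) + k) (thinning 9F j (back (List.map just cs ++ L) rn))
      rewind-n []       none cont = next (λ _ → refl) (cont some)
      rewind-n []       some cont = next (λ _ → refl) (cont some)
      rewind-n (c ∷ cs) L    cont = next (λ _ → refl) (rewind-n cs L cont)

      scan-n : ∀ bs {k j ln e} → Blank e →
        (ones bs ≡ 0 → ∀ {e′} → F k (at 10F blank ((nothing ∷ []) ◂ zeros j) blank blank
          ((List.map just bs ʳ++ ln) ◂ (nothing ∷ e′)) (le ◂ (y ∷ re)) [])) →
        (1 ≤ ones bs → ∀ {e′} → F k (thinning 9F (suc j) (back (List.map just (thin false bs) ʳ++ ln) (nothing ∷ e′)))) →
        F (suc (length bs) + k) (thinning 6F j (ln ◂ (List.map just bs ++ e)))
      scan-n []           none done round = next (λ _ → refl) (done refl)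
      scan-n []           some done round = next (λ _ → refl) (done refl)
      scan-n (true ∷ bs)  e    done round = next (λ _ → refl) (sweep-odd bs e (round (s≤s z≤n)))
      scan-n (false ∷ bs) e    done round = next (λ _ → refl) (scan-n bs e done round)

      -- The number r of rounds is the binary length of the number of ones. The continuation is told
      -- 2^r from above and below: one bound serves accuracy, the other tolerance and time. The
      -- cells of the numeral survive the thinning, as they later count the rounds of queries.
      halve-n : ∀ fuel bs {j k L e} → ones bs ≤ fuel → Blank L → Blank e →
        (∀ r bs′ {L′ e′} → length bs′ ≡ length bs → Blank L′ → ones bs < 2 ^ r → r ≡ 0 ⊎ 2 ^ r ≤ 2 * ones bs →
          F k (at 10F blank ((nothing ∷ []) ◂ zeros (r ⊕ j)) blank blank
            ((List.map just bs′ ++ L′) ◂ (nothing ∷ e′)) (le ◂ (y ∷ re)) [])) →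
        F (halving-cost fuel (length bs) + k) (thinning 6F j (L ◂ (List.map just bs ++ e)))
      halve-n fuel bs {j} {k} {L} ones≤ blankL blanke cont = go fuel ones≤
        where
        done : ones bs ≡ 0 → ∀ {e′} → F k (at 10F blank ((nothing ∷ []) ◂ zeros j) blank blank
          ((List.map just bs ʳ++ L) ◂ (nothing ∷ e′)) (le ◂ (y ∷ re)) [])
        done none-left {e′} = subst (λ l → F k (at 10F blank ((nothing ∷ []) ◂ zeros j) blank blank
          (l ◂ (nothing ∷ e′)) (le ◂ (y ∷ re)) [])) (sym (map-ʳ++ bs L))
          (cont 0 (reverse bs) (Listₚ.length-reverse bs) blankL (subst (_< 1) (sym none-left) (s≤s z≤n)) (inj₁ refl))

        o : ℕ
        o = ones (thin false bs)

        next-bounds : ∀ r → 1 ≤ ones bs → o < 2 ^ r → r ≡ 0 ⊎ 2 ^ r ≤ 2 * o → ones bs < 2 ^ suc r × 2 ^ suc r ≤ 2 * ones bs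
        next-bounds r 1≤ o< low = (begin-strict
          ones bs        ≤⟨ thin-even-high bs ⟩
          suc (2 * o)    <⟨ ℕₚ.≤-reflexive (sym (ℕₚ.*-suc 2 o)) ⟩
          2 * suc o      ≤⟨ ℕₚ.*-monoʳ-≤ 2 o< ⟩
          2 ^ suc r      ∎) , ℕₚ.*-monoʳ-≤ 2 (lower low)
          where
          open ℕₚ.≤-Reasoning
          lower : r ≡ 0 ⊎ 2 ^ r ≤ 2 * o → 2 ^ r ≤ ones bs
          lower (inj₁ refl) = 1≤
          lower (inj₂ le)   = ℕₚ.≤-trans le (thin-even-low bs)

        go : ∀ fuel → ones bs ≤ fuel → F (halving-cost fuel (length bs) + k) (thinning 6F j (L ◂ (List.map just bs ++ _)))
        go zero       ones≤ = scan-n bs blanke done λ 1≤ → contradiction (ℕₚ.≤-trans 1≤ ones≤) λ ()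
        go (suc fuel) ones≤ = finishes-weaken 𝒪 (ℕₚ.≤-reflexive (sym (ℕₚ.+-assoc (suc (length bs)) _ k)))
          (scan-n bs blanke (λ none-left → finishes-weaken 𝒪 (ℕₚ.m≤n+m k _) (done none-left)) round)
          where
          round : 1 ≤ ones bs → ∀ {e′} → F (suc (length bs) + halving-cost fuel (length bs) + k)
            (thinning 9F (suc j) (back (List.map just (thin false bs) ʳ++ L) (nothing ∷ e′)))
          round 1≤ {e′} = subst (λ l → F _ (thinning 9F (suc j) (back l (nothing ∷ e′)))) (sym (map-ʳ++ (thin false bs) L))
            (finishes-weaken 𝒪 (ℕₚ.≤-reflexive length-eq) (rewind-n (reverse (thin false bs)) {j = suc j} blankL λ {L′} blankL′ →
              subst (λ l → F (halving-cost fuel (length (thin false bs)) + k) (thinning 6F (suc j) (L′ ◂ l)))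
                (sym (map-reverse-ʳ++ (thin false bs) (nothing ∷ e′)))
                (halve-n fuel (thin false bs) smaller blankL′ some λ r bs′ len bl o< low →
                  cont (suc r) bs′ (trans len (length-thin false bs)) bl
                    (proj₁ (next-bounds r 1≤ o< low)) (inj₂ (proj₂ (next-bounds r 1≤ o< low))))))
            where
            smaller : o ≤ fuel
            smaller = ℕₚ.≤-pred (begin
              suc o        ≤⟨ suc≤ o (ones bs) (thin-even-low bs) 1≤ ⟩
              ones bs      ≤⟨ ones≤ ⟩
              suc fuel     ∎)
              where
              open ℕₚ.≤-Reasoning
              suc≤ : ∀ o n → 2 * o ≤ n → 1 ≤ n → suc o ≤ n
              suc≤ zero    n _   1≤n = 1≤n
              suc≤ (suc o) n 2*o≤n _ = ℕₚ.≤-trans (s≤s (ℕₚ.≤-trans (ℕₚ.m≤n+m (suc o) o) (ℕₚ.+-monoʳ-≤ o (ℕₚ.≤-reflexive (sym (ℕₚ.+-identityʳ (suc o))))))) 2*o≤n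

            length-eq : suc (length (reverse (thin false bs))) + (halving-cost fuel (length (thin false bs)) + k)
              ≡ suc (length bs) + halving-cost fuel (length bs) + k
            length-eq = trans
              (cong₂ (λ l m → suc l + (halving-cost fuel m + k))
                (trans (Listₚ.length-reverse (thin false bs)) (length-thin false bs)) (length-thin false bs))
              (sym (ℕₚ.+-assoc (suc (length bs)) (halving-cost fuel (length bs)) k))

    -- Comparing the answer with the threshold

    judging-cost : ℕ → ℕ
    judging-cost j = 2 + (suc j + (2 + j))

    after-rewinding : Bool → Tape → (o f i g : Tape) → Tape → List Query → Configuration
    after-rewinding true  n o f i g e qs = at 11F o f i g n e qs
    after-rewinding false (ln ◂ rn) o f i g e qs = at 22F o f i g (back ln rn) e qs

    module _ {lo ro ln rn le re : List Symbol} {x y z : Symbol} {qs : List Query} where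

      rewound : Bool → Bool → Tape → (i g : Tape) → Configuration
      rewound b v f i g = after-rewinding v (ln ◂ (x ∷ rn)) (lo ◂ (just b ∷ ro)) f i g (le ◂ (y ∷ re)) qs

      rewind-f : ∀ i b v {k c rf i′ g} →
        (∀ {i′ g} → F k (rewound b v ((nothing ∷ []) ◂ shift i (just c ∷ rf)) i′ g)) →
        F (2 + i + k) (at (rewinding b v) (lo ◂ (z ∷ ro)) (margin i ◂ (just c ∷ rf)) i′ g (ln ◂ (x ∷ rn)) (le ◂ (y ∷ re)) qs)
      rewind-f zero    true  true  cont = next (λ _ → refl) (next (λ _ → refl) cont)
      rewind-f zero    true  false cont = next (λ _ → refl) (next (λ _ → refl) cont)
      rewind-f zero    false true  cont = next (λ _ → refl) (next (λ _ → refl) cont)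
      rewind-f zero    false false cont = next (λ _ → refl) (next (λ _ → refl) cont)
      rewind-f (suc i) true  true  cont = next (λ _ → refl) (rewind-f i true true cont)
      rewind-f (suc i) true  false cont = next (λ _ → refl) (rewind-f i true false cont)
      rewind-f (suc i) false true  cont = next (λ _ → refl) (rewind-f i false true cont)
      rewind-f (suc i) false false cont = next (λ _ → refl) (rewind-f i false false cont)

      -- Charges more than the i cells to be crossed, so that the cost of a comparison does not
      -- depend on where it stops.
      rewind-f′ : ∀ i j b v {k c rf i′ g} → just c ∷ rf ≡ zeros j →
        (∀ {i′ g} → F k (rewound b v ((nothing ∷ []) ◂ zeros (i ⊕ j)) i′ g)) →
        F (j + (2 + (i ⊕ j)) + k) (at (rewinding b v) (lo ◂ (z ∷ ro)) (margin i ◂ (just c ∷ rf)) i′ g (ln ◂ (x ∷ rn)) (le ◂ (y ∷ re)) qs)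
      rewind-f′ i j b v {k} eq cont = finishes-weaken 𝒪
        (ℕₚ.+-monoˡ-≤ k (ℕₚ.≤-trans (ℕₚ.+-monoʳ-≤ 2 (ℕₚ.≤-trans (ℕₚ.m≤m+n i j) (ℕₚ.≤-reflexive (sym (⊕≡+ i j))))) (ℕₚ.m≤n+m _ j)))
        (rewind-f i b v λ {i′} {g} →
          subst (λ rs → F k (rewound b v ((nothing ∷ []) ◂ rs) i′ g)) (sym (trans (cong (shift i) eq) (shift-zeros i j))) cont)

    module _ {ro ln rn le re : List Symbol} {w x y : Symbol} {qs : List Query} where

      judged : Bool → Bool → ℕ → (i g : Tape) → Configuration
      judged b v k i g = after-rewinding v (ln ◂ (x ∷ rn)) ([] ◂ (just b ∷ w ∷ ro))
        ((nothing ∷ []) ◂ zeros k) i g (le ◂ (y ∷ re)) qs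

      judging : Fin 24 → Tape → (i g : Tape) → Configuration
      judging q f i g = at q ([] ◂ (w ∷ ro)) f i g (ln ◂ (x ∷ rn)) (le ◂ (y ∷ re)) qs

      compare : ∀ i j v rg {b k lg i′} → clear j rg ≡ b →
        (∀ {i′ g} → F k (judged b v (i ⊕ j) i′ g)) →
        F (suc j + (2 + (i ⊕ j)) + k) (judging (comparing v) (margin i ◂ zeros j) i′ (lg ◂ rg))
      compare i zero    true  rg                refl cont = next (λ _ → refl) (rewind-f′ i 0 true true refl cont)
      compare i zero    false rg                refl cont = next (λ _ → refl) (rewind-f′ i 0 true false refl cont)
      compare i (suc j) true  []                eq   cont = next (λ _ → refl) (compare (suc i) j true [] eq cont)
      compare i (suc j) true  (nothing ∷ rg)    eq   cont = next (λ _ → refl) (compare (suc i) j true rg eq cont)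
      compare i (suc j) true  (just false ∷ rg) eq   cont = next (λ _ → refl) (compare (suc i) j true rg eq cont)
      compare i (suc j) true  (just true ∷ rg)  refl cont = next (λ _ → refl) (rewind-f′ i (suc j) false true refl cont)
      compare i (suc j) false []                eq   cont = next (λ _ → refl) (compare (suc i) j false [] eq cont)
      compare i (suc j) false (nothing ∷ rg)    eq   cont = next (λ _ → refl) (compare (suc i) j false rg eq cont)
      compare i (suc j) false (just false ∷ rg) eq   cont = next (λ _ → refl) (compare (suc i) j false rg eq cont)
      compare i (suc j) false (just true ∷ rg)  refl cont = next (λ _ → refl) (rewind-f′ i (suc j) false false refl cont)


      clear-settled : ∀ j rg → clear j (settled rg) ≡ clear j rg
      clear-settled zero    rg       = refl
      clear-settled (suc j) []       = refl
      clear-settled (suc j) (g ∷ rg) = refl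

      compare-all : ∀ v bs {j c₀ rf k i′} → just c₀ ∷ rf ≡ zeros j →
        (∀ {i g} → F k (judged (clear j (List.map just bs)) v j i g)) →
        F (suc j + (2 + j) + k)
          (judging (comparing v) ((nothing ∷ []) ◂ (just c₀ ∷ rf)) i′ ([] ◂ settled (List.map just bs)))
      compare-all v bs {j} {k = k} {i′} eq cont = subst
        (λ rf → F (suc j + (2 + j) + k) (judging (comparing v) ((nothing ∷ []) ◂ rf) i′ ([] ◂ settled (List.map just bs)))) (sym eq)
        (compare 0 j v (settled (List.map just bs)) (clear-settled j (List.map just bs)) cont)

      private
        early : ∀ j {k} → 1 + (j + (2 + j) + k) ≤ 2 + (suc j + (2 + j)) + k
        early j {k} = s≤s (ℕₚ.+-monoˡ-≤ k {j + (2 + j)} (ℕₚ.≤-trans (ℕₚ.n≤1+n (j + (2 + j))) (ℕₚ.n≤1+n _)))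

        earlier : ∀ j {k} → 2 + (j + (2 + j) + k) ≤ 2 + (suc j + (2 + j)) + k
        earlier j {k} = s≤s (s≤s (ℕₚ.+-monoˡ-≤ k {j + (2 + j)} (ℕₚ.n≤1+n (j + (2 + j)))))

      judge : ∀ v c sb bs {j c₀ rf k} → just c₀ ∷ rf ≡ zeros j →
        (∀ {i g} → F k (judged (small j (c ∷ sb) bs) v j i g)) →
        F (judging-cost j + k)
          (judging (integral v) ((nothing ∷ []) ◂ (just c₀ ∷ rf)) ([] ◂ List.map just (c ∷ sb)) ([] ◂ List.map just bs))
      judge true  true  sb           bs {j} eq cont = finishes-weaken 𝒪 (early j) (next (λ _ → refl) (rewind-f′ 0 j true true eq cont))
      judge false true  sb           bs {j} eq cont = finishes-weaken 𝒪 (early j) (next (λ _ → refl) (rewind-f′ 0 j true false eq cont))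
      judge true  false (true ∷ sb)  bs {j} eq cont = finishes-weaken 𝒪 (earlier j) (next (λ _ → refl) (next (λ _ → refl) (rewind-f′ 0 j false true eq cont)))
      judge false false (true ∷ sb)  bs {j} eq cont = finishes-weaken 𝒪 (earlier j) (next (λ _ → refl) (next (λ _ → refl) (rewind-f′ 0 j false false eq cont)))
      judge true  false []           bs {j} eq cont = next (λ _ → refl) (next (λ _ → refl) (compare-all true bs eq cont))
      judge false false []           bs {j} eq cont = next (λ _ → refl) (next (λ _ → refl) (compare-all false bs eq cont))
      judge true  false (false ∷ sb) bs {j} eq cont = next (λ _ → refl) (next (λ _ → refl) (compare-all true bs eq cont))
      judge false false (false ∷ sb) bs {j} eq cont = next (λ _ → refl) (next (λ _ → refl) (compare-all false bs eq cont))

      judge-answer : ∀ v j ans {k} → (∀ {i g} → F k (judged (accepts j ans) v j i g)) →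
        F (judging-cost j + k) (judging (integral v) ((nothing ∷ []) ◂ zeros j)
          (load (signedBits (Answer.whole ans))) (load (Answer.fractional ans)))
      -- The split on j exposes the scanned cell of `zeros j`, and the one on the integer part its
      -- sign.
      judge-answer v zero    (answer (+ n) bs)    cont = judge v false (toBits n) bs {j = 0} refl cont
      judge-answer v zero    (answer -[1+ n ] bs) cont = judge v true (toBits (suc n)) bs {j = 0} refl cont
      judge-answer v (suc j) (answer (+ n) bs)    cont = judge v false (toBits n) bs {j = suc j} refl cont
      judge-answer v (suc j) (answer -[1+ n ] bs) cont = judge v true (toBits (suc n)) bs {j = suc j} refl cont

    iteration-cost : ℕ → ℕ
    iteration-cost j = 1 + (judging-cost j + (1 + (judging-cost j + 1)))

    module _ {j N : ℕ} (final : ∀ {w ro f i g n e qs} → Trace j (contents ([] ◂ (w ∷ ro))) qs →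
                length (contents ([] ◂ (w ∷ ro))) ≡ N → P (at 23F ([] ◂ (w ∷ ro)) f i g n e qs)) where

      -- A round decides both candidates of a pair. The first bit is recorded before the second
      -- query, whose word is thereby longer by one and names the next candidate.
      iterate : ∀ {w ro i g ln x rn le y re qs k} → Trace j (contents ([] ◂ (w ∷ ro))) qs →
        (∀ {b c i g qs} → Trace j (b ∷ c ∷ contents ([] ◂ (w ∷ ro))) qs →
           F (suc k) (at 22F ([] ◂ (just b ∷ just c ∷ w ∷ ro)) ((nothing ∷ []) ◂ zeros j) i g (back ln (x ∷ rn)) (le ◂ (y ∷ re)) qs)) →
        F (iteration-cost j + k) (at 10F ([] ◂ (w ∷ ro)) ((nothing ∷ []) ◂ zeros j) i g (ln ◂ (x ∷ rn)) (le ◂ (y ∷ re)) qs)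
      iterate {w} {ro} {qs = qs} {k} trace cont = finishes-weaken 𝒪 (ℕₚ.≤-reflexive (arrange (judging-cost j) k))
        (next (λ _ → refl) (judge-answer true j (𝒪 q₁ qs)
          (next (λ _ → refl) (judge-answer false j (𝒪 q₂ (q₁ ∷ qs)) (cont (more (more trace)))))))
        where
        q₁ q₂ : Query
        q₁ = query (contents ([] ◂ (w ∷ ro))) (tolerance j)
        q₂ = query (accepts j (𝒪 q₁ qs) ∷ contents ([] ◂ (w ∷ ro))) (tolerance j)
        arrange : ∀ c k → 1 + (c + (1 + (c + suc k))) ≡ 1 + (c + (1 + (c + 1))) + k
        arrange = solve-∀

      resume : ∀ j {w ro i g ln c rn le y re qs k} →
        (∀ {i g} → F k (at 10F ([] ◂ (w ∷ ro)) ((nothing ∷ []) ◂ zeros j) i g (ln ◂ (just c ∷ rn)) (le ◂ (y ∷ re)) qs)) →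
        F (suc k) (at 22F ([] ◂ (w ∷ ro)) ((nothing ∷ []) ◂ zeros j) i g (ln ◂ (just c ∷ rn)) (le ◂ (y ∷ re)) qs)
      resume zero    cont = next (λ _ → refl) cont
      resume (suc j) cont = next (λ _ → refl) cont

      -- The head on the tape of n starts at the blank behind the numeral and moves left over its n
      -- cells, cs being those still ahead; this gives n + 1 rounds.
      loop : ∀ cs {L w ro i g x rn le y re qs} → Blank L → Trace j (contents ([] ◂ (w ∷ ro))) qs →
        length (contents ([] ◂ (w ∷ ro))) + 2 * suc (length cs) ≡ N →
        F (suc (length cs) * iteration-cost j)
          (at 10F ([] ◂ (w ∷ ro)) ((nothing ∷ []) ◂ zeros j) i g ((List.map just cs ++ L) ◂ (x ∷ rn)) (le ◂ (y ∷ re)) qs)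
      loop []       none trace eq = iterate trace λ tr → next (λ _ → refl) (stop refl (final tr (trans (ℕₚ.+-comm 2 _) eq)))
      loop []       some trace eq = iterate trace λ tr → next (λ _ → refl) (stop refl (final tr (trans (ℕₚ.+-comm 2 _) eq)))
      loop (c ∷ cs) {w = w} {ro} L trace eq = iterate trace λ tr → resume j
        (loop cs L tr (trans (arrange (length (contents ([] ◂ (w ∷ ro)))) (length cs)) eq))
        where
        arrange : ∀ m c → suc (suc m) + 2 * suc c ≡ m + 2 * suc (suc c)
        arrange = solve-∀

leading-zeros : List Bool → ℕ
leading-zeros εs = lead (List.map just εs)

-- With k = r + p + 4, the threshold half^ k for 2n + 2 ≤ 2^(r+1) candidates
-- bounds the total error by half^ (p + 2).
record Outcome (𝒪 : Oracle) (n : ℕ) (εs : List Bool) (c : Execution.Configuration machineᴸ) : Set where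
  open Execution machineᴸ
  field
    {r k}  : ℕ
    k≡     : k ≡ r + (leading-zeros εs + 4)
    n<2^r  : n < 2 ^ r
    2^r≤   : 2 ^ r ≤ suc (2 * n)
    trace  : Trace 𝒪 k (output c) (asked c)
    length≡ : length (output c) ≡ 2 * suc n

-- The summands are the initial writing, the leading zeros of ε, the halving of n, and n + 1 rounds
-- of cost 4k + 13, where k is estimated through r < 2^r ≤ 2n + 1.
learning-cost : ℕ → ℕ → ℕ
learning-cost n p = 5 + (suc p + (suc (2 * n) * suc n + suc n * (4 * (suc (2 * n) + (p + 4)) + 13)))

learning-cost-mono : ∀ n {p q} → p ≤ q → learning-cost n p ≤ learning-cost n q
learning-cost-mono n p≤q = ℕₚ.+-monoʳ-≤ 5 (ℕₚ.+-mono-≤ (s≤s p≤q) (ℕₚ.+-monoʳ-≤ (suc (2 * n) * suc n)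
  (ℕₚ.*-monoʳ-≤ (suc n) (ℕₚ.+-monoˡ-≤ 13 (ℕₚ.*-monoʳ-≤ 4 (ℕₚ.+-monoʳ-≤ (suc (2 * n)) (ℕₚ.+-monoˡ-≤ 4 p≤q)))))))

halving-cost≡ : ∀ f N → halving-cost f N ≡ suc (2 * f) * suc N
halving-cost≡ zero    N = sym (ℕₚ.+-identityʳ (suc N))
halving-cost≡ (suc f) N = trans (cong (λ x → suc N + (suc N + x)) (halving-cost≡ f N)) (arrange f (suc N))
  where
  arrange : ∀ f m → m + (m + suc (2 * f) * m) ≡ suc (2 * suc f) * m
  arrange = solve-∀

lead-settled : ∀ rs → lead (settled rs) ≡ lead rs
lead-settled []                = refl
lead-settled (nothing ∷ rs)    = refl
lead-settled (just true ∷ rs)  = refl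
lead-settled (just false ∷ rs) = refl

ones-unary : ∀ n → ones (unary n) ≡ n
ones-unary zero    = refl
ones-unary (suc n) = cong suc (ones-unary n)

unary-settled : ∀ n → Σ[ e ∈ List Symbol ] Blank e × settled (List.map just (unary n)) ≡ List.map just (unary n) ++ e
unary-settled zero    = nothing ∷ [] , some , refl
unary-settled (suc n) = [] , none , sym (Listₚ.++-identityʳ _)

module _ (𝒪 : Oracle) (n s : ℕ) (εs δs : List Bool) where
  open Execution machineᴸ

  private
    p : ℕ
    p = leading-zeros εs

    S D : List Symbol
    S = List.map just (unary s)
    D = List.map just δs

    open Phases 𝒪 (Outcome 𝒪 n εs) [] (proj₂ (uncons S)) [] (proj₂ (uncons D)) (proj₁ (uncons S)) (proj₁ (uncons D))

    loop-cost : ℕ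
    loop-cost = suc n * (4 * (suc (2 * n) + (p + 4)) + 13)

    upper : ∀ r → r ≡ 0 ⊎ 2 ^ r ≤ 2 * n → 2 ^ r ≤ suc (2 * n)
    upper r (inj₁ refl) = s≤s z≤n
    upper r (inj₂ le)   = ℕₚ.≤-trans le (ℕₚ.n≤1+n _)

    main-loop : ∀ r bs {j L e le y re i g} → j ≡ p + 4 → length bs ≡ n → Blank L → n < 2 ^ r → 2 ^ r ≤ suc (2 * n) →
      F loop-cost (at 10F blank ((nothing ∷ []) ◂ zeros (r ⊕ j)) i g
        ((List.map just bs ++ L) ◂ (nothing ∷ e)) (le ◂ (y ∷ re)) [])
    main-loop r bs {j} refl refl blankL n< ≤n = finishes-weaken 𝒪 enough
      (loop (λ tr len → record { r = r ; k≡ = ⊕≡+ r j ; n<2^r = n< ; 2^r≤ = ≤n ; trace = tr ; length≡ = len })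
        bs blankL Trace.[] refl)
      where
      iteration-cost≡ : ∀ k → iteration-cost k ≡ 4 * k + 13
      iteration-cost≡ = arrange
        where
        arrange : ∀ k → 1 + (2 + (suc k + (2 + k)) + (1 + (2 + (suc k + (2 + k)) + 1))) ≡ 4 * k + 13
        arrange = solve-∀

      open ℕₚ.≤-Reasoning
      enough : suc n * iteration-cost (r ⊕ j) ≤ loop-cost
      enough = ℕₚ.*-monoʳ-≤ (suc n) (begin
        iteration-cost (r ⊕ j)                    ≡⟨ trans (iteration-cost≡ (r ⊕ j)) (cong (λ x → 4 * x + 13) (⊕≡+ r j)) ⟩
        4 * (r + j) + 13                          ≤⟨ ℕₚ.+-monoˡ-≤ 13 (ℕₚ.*-monoʳ-≤ 4 (ℕₚ.+-monoˡ-≤ j (ℕₚ.≤-trans (ℕₚ.<⇒≤ (n<2^n r)) ≤n))) ⟩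
        4 * (suc (2 * n) + (p + 4)) + 13          ∎)

  learner-finishes : Finishes 𝒪 (Outcome 𝒪 n εs) (learning-cost n p) (initial (unary n ∷ unary s ∷ εs ∷ δs ∷ []))
  learner-finishes = next (λ _ → refl) (prepare scanning)
    where
    N E : List Symbol
    N = List.map just (unary n)
    E = List.map just εs

    cost : ℕ
    cost = suc (2 * n) * suc n + loop-cost

    halving : ∀ {le y re} → F cost
      (at 6F blank ([] ◂ (nothing ∷ zeros (lead (settled E) ⊕ 4))) blank blank ([] ◂ settled N) (le ◂ (y ∷ re)) [])
    halving {le} {y} {re} = subst
      (λ l → F cost (at 6F blank ([] ◂ (nothing ∷ zeros (lead (settled E) ⊕ 4))) blank blank ([] ◂ l) (le ◂ (y ∷ re)) []))
      (sym (proj₂ (proj₂ (unary-settled n))))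
      (finishes-weaken 𝒪 (ℕₚ.≤-reflexive (cong (_+ loop-cost) (trans (cong (halving-cost n) (Listₚ.length-replicate n)) (halving-cost≡ n n))))
        (halve-n n (unary n) {j = lead (settled E) ⊕ 4} (ℕₚ.≤-reflexive (ones-unary n)) none (proj₁ (proj₂ (unary-settled n)))
          λ r bs len bl n< low → main-loop r bs
            (trans (⊕≡+ (lead (settled E)) 4) (cong (_+ 4) (lead-settled E)))
            (trans len (Listₚ.length-replicate n)) bl
            (subst (_< 2 ^ r) (ones-unary n) n<)
            (upper r (subst (λ m → r ≡ 0 ⊎ 2 ^ r ≤ 2 * m) (ones-unary n) low))))

    scanning : F (suc p + cost) (at 5F blank ([] ◂ (nothing ∷ zeros 4)) blank blank ([] ◂ settled N) ([] ◂ settled E) [])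
    scanning = finishes-weaken 𝒪 (ℕₚ.≤-reflexive (cong (λ x → suc x + cost) (lead-settled E)))
      (scan-ε (settled E) {j = 4} halving)

-- Rounding

floor≤ : ∀ p → fromℤ (ℚ.floor p) ℚ.≤ p
floor≤ p@(ℚ.mkℚ i d _) = ℚₚ.toℚᵘ-cancel-≤ (ℚᵘₚ.≤-respˡ-≃ (ℚᵘₚ.≃-sym (toℚᵘ-fromℤ (ℚ.floor p)))
  (ℚᵘ.*≤* (ℤₚ.≤-trans (ℤ.[n/d]*d≤n i (+ suc d)) (ℤₚ.≤-reflexive (sym (ℤₚ.*-identityʳ i))))))

fromℤ-neg : ∀ i → fromℤ (ℤ.- i) ≡ ℚ.- fromℤ i
fromℤ-neg i = begin
  fromℤ (ℤ.- i)                                        ≡⟨ solve 2 (λ x y → x := (y ⊞ x) ⊞ ⊟ y) refl (fromℤ (ℤ.- i)) (fromℤ i) ⟩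
  (fromℤ i ℚ.+ fromℤ (ℤ.- i)) ℚ.+ ℚ.- fromℤ i          ≡⟨ cong (ℚ._+ ℚ.- fromℤ i) (trans (sym (fromℤ-+ i (ℤ.- i))) (cong fromℤ (ℤₚ.+-inverseʳ i))) ⟩
  0ℚ ℚ.+ ℚ.- fromℤ i                                   ≡⟨ ℚₚ.+-identityˡ (ℚ.- fromℤ i) ⟩
  ℚ.- fromℤ i                                          ∎
  where open ≡-Reasoning

≤ceiling : ∀ p → p ℚ.≤ fromℤ (ℚ.ceiling p)
≤ceiling p@(ℚ.mkℚ _ _ _) = subst₂ ℚ._≤_ (solve 1 (λ p → ⊟ (⊟ p) := p) refl p) (sym (fromℤ-neg (ℚ.floor (ℚ.- p))))
  (ℚₚ.neg-antimono-≤ (floor≤ (ℚ.- p)))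

fromℤ≤∣∣ : ∀ i → fromℤ i ℚ.≤ ℕ→ℚ ℤ.∣ i ∣
fromℤ≤∣∣ (+ n)    = ℚₚ.≤-refl
fromℤ≤∣∣ -[1+ n ] = ℚₚ.≤-trans (ℚₚ.neg-antimono-≤ (0≤ℕ→ℚ (suc n))) (0≤ℕ→ℚ (suc n))

-- Converts the number of leading zeros of ε, which governs time and tolerance, into the parameter
-- 1/ε of the bounding polynomials.
reciprocal-bound : ∀ q (q>0 : 0ℚ ℚ.< q) t → q ℚ.≤ half^ t → 2 ^ t ≤ ⌈1/ q ⌉ {q>0}
reciprocal-bound q q>0 t q≤ = ℕ→ℚ-cancel-≤ (2 ^ t) (⌈1/ q ⌉ {q>0}) (begin
  T                                ≡⟨ trans (cong (T ℚ.*_) (ℚₚ.*-inverseʳ q)) (ℚₚ.*-identityʳ T) ⟨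
  T ℚ.* (q ℚ.* r)                  ≤⟨ *-monoˡ T (0≤ℕ→ℚ (2 ^ t)) (*-monoʳ r 0≤r q≤) ⟩
  T ℚ.* (half^ t ℚ.* r)            ≡⟨ solve 3 (λ T h r → T ⊠ (h ⊠ r) := (h ⊠ T) ⊠ r) refl T (half^ t) r ⟩
  half^ t ℚ.* T ℚ.* r              ≡⟨ trans (cong (ℚ._* r) (half^-inverse t)) (ℚₚ.*-identityˡ r) ⟩
  r                                ≤⟨ ≤ceiling r ⟩
  fromℤ (ℚ.ceiling r)              ≤⟨ fromℤ≤∣∣ (ℚ.ceiling r) ⟩
  ℕ→ℚ (⌈1/ q ⌉ {q>0})              ∎)
  where
  open ℚₚ.≤-Reasoning
  instance
    q≢0 : ℚ.NonZero q
    q≢0 = ℚ.>-nonZero q>0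
  T r : ℚ
  T = ℕ→ℚ (2 ^ t)
  r = ℚ.1/ q
  0≤r : 0ℚ ℚ.≤ r
  0≤r = ℚₚ.<⇒≤ (ℚₚ.positive⁻¹ r {{ℚₚ.1/pos⇒pos q {{ℚ.positive q>0}}}})

-- Binary fractions

0≤fraction : ∀ bs → 0ℚ ℚ.≤ fraction bs
0≤fraction []       = ℚₚ.≤-refl
0≤fraction (b ∷ bs) = *-nonneg 0≤½ (+-nonneg (0≤ℕ→ℚ (bit b)) (0≤fraction bs))

fraction≤1 : ∀ bs → fraction bs ℚ.≤ 1ℚ
fraction≤1 []       = 0≤1
fraction≤1 (b ∷ bs) = *-monoˡ {ℕ→ℚ (bit b) ℚ.+ fraction bs} {1ℚ ℚ.+ 1ℚ} ½ 0≤½ (ℚₚ.+-mono-≤ (bit≤1 b) (fraction≤1 bs))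
  where
  bit≤1 : ∀ b → ℕ→ℚ (bit b) ℚ.≤ 1ℚ
  bit≤1 true  = ℚₚ.≤-refl
  bit≤1 false = 0≤1

half^≤1 : ∀ k → half^ k ℚ.≤ 1ℚ
half^≤1 zero    = ℚₚ.≤-refl
half^≤1 (suc k) = ℚₚ.≤-trans (*-monoˡ ½ 0≤½ (half^≤1 k)) (ℚₚ.≤ᵇ⇒≤ _)

half^>0 : ∀ k → 0ℚ ℚ.< half^ k
half^>0 zero    = ℚₚ.positive⁻¹ 1ℚ
half^>0 (suc k) = subst (ℚ._< ½ ℚ.* half^ k) (ℚₚ.*-zeroʳ ½) (ℚₚ.*-monoʳ-<-pos ½ (half^>0 k))

half^-antimono : ∀ j k → half^ (j + k) ℚ.≤ half^ k
half^-antimono j k = subst₂ ℚ._≤_ (sym (half^-+ j k)) (ℚₚ.*-identityˡ (half^ k)) (*-monoʳ (half^ k) (0≤half^ k) (half^≤1 j))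

halve-≤ : ∀ {p q} → p ℚ.≤ q → ½ ℚ.* (0ℚ ℚ.+ p) ℚ.≤ ½ ℚ.* q
halve-≤ {p} {q} p≤q = *-monoˡ ½ 0≤½ (subst (ℚ._≤ q) (sym (ℚₚ.+-identityˡ p)) p≤q)

halve-≥ : ∀ {p q} → q ℚ.≤ p → ½ ℚ.* q ℚ.≤ ½ ℚ.* (0ℚ ℚ.+ p)
halve-≥ {p} {q} q≤p = *-monoˡ ½ 0≤½ (subst (q ℚ.≤_) (sym (ℚₚ.+-identityˡ p)) q≤p)

½≤true : ∀ bs k → half^ (suc k) ℚ.≤ fraction (true ∷ bs)
½≤true bs k = *-monoˡ {half^ k} {1ℚ ℚ.+ fraction bs} ½ 0≤½ (ℚₚ.≤-trans (half^≤1 k)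
  (subst (ℚ._≤ 1ℚ ℚ.+ fraction bs) (ℚₚ.+-identityʳ 1ℚ) (ℚₚ.+-monoʳ-≤ 1ℚ (0≤fraction bs))))

fraction-leading-upper : ∀ bs → fraction bs ℚ.≤ half^ (leading-zeros bs)
fraction-leading-upper []           = 0≤1
fraction-leading-upper (true ∷ bs)  = fraction≤1 (true ∷ bs)
fraction-leading-upper (false ∷ bs) = halve-≤ (fraction-leading-upper bs)

fraction-leading-lower : ∀ bs → 0ℚ ℚ.< fraction bs → half^ (suc (leading-zeros bs)) ℚ.≤ fraction bs
fraction-leading-lower []           0<0 = ⊥-elim (ℚₚ.<-irrefl refl 0<0)
fraction-leading-lower (true ∷ bs)  _   = ½≤true bs 0
fraction-leading-lower (false ∷ bs) 0<f = halve-≥ (fraction-leading-lower bs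
  (ℚₚ.*-cancelˡ-<-nonNeg ½ (subst₂ ℚ._<_ (sym (ℚₚ.*-zeroʳ ½)) (cong (½ ℚ.*_) (ℚₚ.+-identityˡ (fraction bs))) 0<f)))

clear-true : ∀ k bs → clear k (List.map just bs) ≡ true → fraction bs ℚ.≤ half^ k
clear-true zero    bs           _  = fraction≤1 bs
clear-true (suc k) []           _  = 0≤half^ (suc k)
clear-true (suc k) (false ∷ bs) eq = halve-≤ (clear-true k bs eq)

clear-false : ∀ k bs → clear k (List.map just bs) ≡ false → half^ k ℚ.≤ fraction bs
clear-false (suc k) []           eq = contradiction (trans (sym eq) (clear-[] k)) λ ()
  where
  clear-[] : ∀ k → clear k [] ≡ true
  clear-[] zero    = refl
  clear-[] (suc k) = clear-[] k
clear-false (suc k) (true ∷ bs)  eq = ½≤true bs k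
clear-false (suc k) (false ∷ bs) eq = halve-≥ (clear-false k bs eq)

tolerance≡ : ∀ 𝒪 k → tolerance 𝒪 k ≡ half^ (suc k)
tolerance≡ 𝒪 k = trans (ℚₚ.+-identityˡ _) (lemma k)
  where
  lemma : ∀ k → fraction (contents ((nothing ∷ []) ◂ zeros k)) ≡ half^ (suc k)
  lemma zero    = refl
  lemma (suc k) = cong (½ ℚ.*_) (trans (ℚₚ.+-identityˡ _) (lemma k))

-- An admissible answer is below 2, so that the digits of its integer part
-- matter only when this is 0 or 1.

accepts-sound : ∀ k v → answer-value v ℚ.< ℕ→ℚ 2 → accepts k v ≡ true → answer-value v ℚ.≤ half^ k
accepts-sound k (answer (+ 0) bs) <2 eq = subst (ℚ._≤ half^ k) (sym (ℚₚ.+-identityˡ (fraction bs))) (clear-true k bs eq)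
accepts-sound k (answer (+ 1) bs) <2 ()
accepts-sound k (answer (+ suc (suc n)) bs) <2 eq = ⊥-elim (ℚₚ.<-irrefl refl (ℚₚ.<-≤-trans <2
  (subst (ℚ._≤ ℕ→ℚ (2 + n) ℚ.+ fraction bs) (ℚₚ.+-identityʳ (ℕ→ℚ 2))
    (ℚₚ.+-mono-≤ (ℕ→ℚ-mono {2} {2 + n} (s≤s (s≤s z≤n))) (0≤fraction bs)))))
accepts-sound k (answer -[1+ n ] bs) <2 eq = ℚₚ.≤-trans
  (subst (fromℤ -[1+ n ] ℚ.+ fraction bs ℚ.≤_) (ℚₚ.+-inverseˡ 1ℚ)
    (ℚₚ.+-mono-≤ (ℚₚ.neg-antimono-≤ (1≤ℕ→ℚ-suc n)) (fraction≤1 bs)))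
  (0≤half^ k)

accepts-complete : ∀ k v → answer-value v ℚ.< half^ k → accepts k v ≡ true
accepts-complete k (answer (+ 0) bs) <h with clear k (List.map just bs) in eq
... | true  = refl
... | false = ⊥-elim (ℚₚ.<-irrefl refl (ℚₚ.<-≤-trans <h
  (subst (half^ k ℚ.≤_) (sym (ℚₚ.+-identityˡ (fraction bs))) (clear-false k bs eq))))
accepts-complete k (answer (+ suc n) bs) <h = ⊥-elim (ℚₚ.<-irrefl refl (ℚₚ.<-≤-trans <h
  (ℚₚ.≤-trans (half^≤1 k) (subst (ℚ._≤ ℕ→ℚ (suc n) ℚ.+ fraction bs) (ℚₚ.+-identityʳ 1ℚ)
    (ℚₚ.+-mono-≤ (1≤ℕ→ℚ-suc n) (0≤fraction bs))))))
accepts-complete k (answer -[1+ n ] bs) <h = refl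

-- Probabilities

module _ {n} {w : Vec Bool n → ℚ} (0≤w : ∀ a → 0ℚ ℚ.≤ w a) where

  Pr-𝟙 : ∀ A → Pr w A ≡ sumCube n (λ a → 𝟙 (A a) ℚ.* w a)
  Pr-𝟙 A = sumCube-cong n λ a → if-weight (A a) (w a)

  Pr-subadditive : ∀ A B C → (∀ a → 𝟙 (A a) ℚ.≤ 𝟙 (B a) ℚ.+ 𝟙 (C a)) → Pr w A ℚ.≤ Pr w B ℚ.+ Pr w C
  Pr-subadditive A B C le = begin
    Pr w A                                                     ≡⟨ Pr-𝟙 A ⟩
    sumCube n (λ a → 𝟙 (A a) ℚ.* w a)                          ≤⟨ sumCube-mono n (λ a → ℚₚ.≤-trans (*-monoʳ (w a) (0≤w a) (le a))
                                                                    (ℚₚ.≤-reflexive (ℚₚ.*-distribʳ-+ (w a) (𝟙 (B a)) (𝟙 (C a))))) ⟩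
    sumCube n (λ a → 𝟙 (B a) ℚ.* w a ℚ.+ 𝟙 (C a) ℚ.* w a)      ≡⟨ sumCube-+ n _ _ ⟩
    sumCube n (λ a → 𝟙 (B a) ℚ.* w a) ℚ.+ sumCube n (λ a → 𝟙 (C a) ℚ.* w a)
                                                               ≡⟨ cong₂ ℚ._+_ (Pr-𝟙 B) (Pr-𝟙 C) ⟨
    Pr w B ℚ.+ Pr w C                                          ∎
    where open ℚₚ.≤-Reasoning

  Pr-mono : ∀ A B → (∀ a → 𝟙 (A a) ℚ.≤ 𝟙 (B a)) → Pr w A ℚ.≤ Pr w B
  Pr-mono A B le = subst₂ ℚ._≤_ (sym (Pr-𝟙 A)) (sym (Pr-𝟙 B)) (sumCube-mono n λ a → *-monoʳ (w a) (0≤w a) (le a))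

Pr-none : ∀ {n} {w : Vec Bool n → ℚ} A → (∀ a → A a ≡ false) → Pr w A ≡ 0ℚ
Pr-none {n} {w} A never = trans (sumCube-cong n λ a → cong (λ b → if b then w a else 0ℚ) (never a)) (sumCube-0 n)

module _ {n} (D : Distribution n) where
  open Distribution D

  Pr≤1 : ∀ k A → Pr (approx k) A ℚ.≤ 1ℚ
  Pr≤1 k A = subst (Pr (approx k) A ℚ.≤_) (total k) (sumCube-mono n λ a → below (A a) (nonneg k a))
    where
    below : ∀ b {w} → 0ℚ ℚ.≤ w → (if b then w else 0ℚ) ℚ.≤ w
    below true  _   = ℚₚ.≤-refl
    below false 0≤w = 0≤w

  Pr-approx : ∀ j k A → Pr (approx j) A ℚ.≤ Pr (approx k) A ℚ.+ (1/1+ j ℚ.+ 1/1+ k)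
  Pr-approx j k A = begin
    Pr (approx j) A                                       ≤⟨ sumCube-mono n (λ a → pointwise (A a) (approx j a) (approx k a)) ⟩
    sumCube n (λ a → (if A a then approx k a else 0ℚ) ℚ.+ ℚ.∣ approx j a ℚ.- approx k a ∣)
                                                          ≡⟨ sumCube-+ n _ _ ⟩
    Pr (approx k) A ℚ.+ sumCube n (λ a → ℚ.∣ approx j a ℚ.- approx k a ∣)
                                                          ≤⟨ ℚₚ.+-monoʳ-≤ (Pr (approx k) A) (cauchy j k) ⟩
    Pr (approx k) A ℚ.+ (1/1+ j ℚ.+ 1/1+ k)               ∎
    where
    open ℚₚ.≤-Reasoning
    p≤∣p∣ : ∀ p → p ℚ.≤ ℚ.∣ p ∣
    p≤∣p∣ p = subst₂ ℚ._≤_ (solve 1 (λ p → ⊟ (⊟ p) := p) refl p) (ℚₚ.∣-p∣≡∣p∣ p) (-p≤∣p∣ (ℚ.- p))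
    pointwise : ∀ b v w → (if b then v else 0ℚ) ℚ.≤ (if b then w else 0ℚ) ℚ.+ ℚ.∣ v ℚ.- w ∣
    pointwise true  v w = subst (ℚ._≤ w ℚ.+ ℚ.∣ v ℚ.- w ∣) (solve 2 (λ v w → w ⊞ (v ⊞ ⊟ w) := v) refl v w) (ℚₚ.+-monoʳ-≤ w (p≤∣p∣ (v ℚ.- w)))
    pointwise false v w = subst (0ℚ ℚ.≤_) (sym (ℚₚ.+-identityˡ ℚ.∣ v ℚ.- w ∣)) (ℚₚ.0≤∣p∣ (v ℚ.- w))

precision : ℕ → ℕ
precision t = ℕ.pred (2 ^ t)

1/1+precision : ∀ t → 1/1+ precision t ≡ half^ t
1/1+precision t = begin
  u                                  ≡⟨ ℚₚ.*-identityʳ u ⟨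
  u ℚ.* 1ℚ                           ≡⟨ cong (u ℚ.*_) (half^-inverse t) ⟨
  u ℚ.* (half^ t ℚ.* T)              ≡⟨ solve 3 (λ u h T → u ⊠ (h ⊠ T) := (u ⊠ T) ⊠ h) refl u (half^ t) T ⟩
  u ℚ.* T ℚ.* half^ t                ≡⟨ cong (λ m → u ℚ.* ℕ→ℚ m ℚ.* half^ t) (ℕₚ.suc-pred (2 ^ t) {{ℕₚ.m^n≢0 2 t}}) ⟨
  u ℚ.* ℕ→ℚ (suc (precision t)) ℚ.* half^ t
                                     ≡⟨ cong (ℚ._* half^ t) (unit-fraction (suc (precision t))) ⟩
  1ℚ ℚ.* half^ t                     ≡⟨ ℚₚ.*-identityˡ (half^ t) ⟩
  half^ t                            ∎
  where
  open ≡-Reasoning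
  u T : ℚ
  u = 1/1+ precision t
  T = ℕ→ℚ (2 ^ t)

-- Conjunctions and disjunctions of literals

symbols : ∀ {n} → Vec Bool n → List Symbol
symbols a = List.map just (toList a)

violates : ∀ {n} → List ℕ → Vec Bool n → Bool
violates []       a = false
violates (i ∷ is) a = violated true i (symbols a) ∨ violates is a

-- f is the conjunction (d = true) of the candidates in the list, or the
-- disjunction (d = false) of their negations.
Literals : ∀ {n} → Bool → (Vec Bool n → Bool) → Set
Literals {n} d f = Σ[ is ∈ List ℕ ] (All (_< 2 * suc n) is × (∀ a → f a ≡ verdict d (not (violates is a))))

violates-++ : ∀ {n} is js (a : Vec Bool n) → violates (is ++ js) a ≡ violates is a ∨ violates js a
violates-++ []       js a = refl
violates-++ (i ∷ is) js a with violated true i (symbols a)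
... | true  = refl
... | false = violates-++ is js a

-- Doubling by recursion, so that `violated` and `lookup` unfold in step.
positive negative : ℕ → ℕ
positive zero    = 0
positive (suc x) = suc (suc (positive x))
negative x = suc (positive x)

positive≡ : ∀ x → positive x ≡ 2 * x
positive≡ zero    = refl
positive≡ (suc x) = trans (cong (λ m → suc (suc m)) (positive≡ x)) (sym (ℕₚ.*-suc 2 x))

negative< : ∀ {x n} → x < n → negative x < 2 * suc n
negative< {x} {n} x<n = begin-strict
  suc (positive x)     ≡⟨ cong suc (positive≡ x) ⟩
  suc (2 * x)          <⟨ ℕₚ.≤-reflexive (sym (ℕₚ.*-suc 2 x)) ⟩
  2 * suc x            ≤⟨ ℕₚ.*-monoʳ-≤ 2 (ℕₚ.≤-trans x<n (ℕₚ.n≤1+n n)) ⟩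
  2 * suc n            ∎
  where open ℕₚ.≤-Reasoning

positive< : ∀ {x n} → x ≤ n → positive x < 2 * suc n
positive< {x} {n} x≤n = begin-strict
  positive x           ≡⟨ positive≡ x ⟩
  2 * x                <⟨ ℕₚ.*-monoʳ-< 2 (s≤s x≤n) ⟩
  2 * suc n            ∎
  where open ℕₚ.≤-Reasoning

violated-positive : ∀ {n} (x : Fin n) (a : Vec Bool n) → violated true (positive (toℕ x)) (symbols a) ≡ not (lookup a x)
violated-positive zero    (true ∷ a)  = refl
violated-positive zero    (false ∷ a) = refl
violated-positive (suc x) (_ ∷ a)     = violated-positive x a

violated-negative : ∀ {n} (x : Fin n) (a : Vec Bool n) → violated true (negative (toℕ x)) (symbols a) ≡ lookup a x
violated-negative zero    (true ∷ a)  = refl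
violated-negative zero    (false ∷ a) = refl
violated-negative (suc x) (_ ∷ a)     = violated-negative x a

-- This candidate reads the blank behind a. It supplies the constant ⊥ to conjunctions and, dually,
-- ⊤ to disjunctions.
violated-end : ∀ {n} (a : Vec Bool n) → violated true (positive n) (symbols a) ≡ true
violated-end []      = refl
violated-end (_ ∷ a) = violated-end a

single : ∀ {n} d {f : Vec Bool n → Bool} i → i < 2 * suc n → (∀ a → f a ≡ verdict d (not (violated true i (symbols a)))) → Literals d f
single d i i< eq = i ∷ [] , i< ∷ [] , λ a → trans (eq a) (cong (verdict d ∘ not) (sym (∨-identityʳ _)))

∧-literals : ∀ {n} (φ : Formula ⟨∧,⊤,⊥⟩ n) → Literals true (evalFormula φ)
∧-literals (var x) = single true (positive (toℕ x)) (positive< (ℕₚ.<⇒≤ (Finₚ.toℕ<n x)))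
  λ a → trans (sym (value (lookup a x))) (cong (verdict true ∘ not) (sym (violated-positive x a)))
  where
  value : ∀ b → verdict true (not (not b)) ≡ b
  value true  = refl
  value false = refl
∧-literals {n} (node 0F (φ ∷ ψ ∷ [])) with ∧-literals φ | ∧-literals ψ
... | is , is< , is≡ | js , js< , js≡ = is ++ js , Allₚ.++⁺ is< js< ,
  λ a → trans (cong₂ _∧_ (is≡ a) (js≡ a)) (trans (value (violates is a) (violates js a)) (cong (verdict true ∘ not) (sym (violates-++ is js a))))
  where
  value : ∀ x y → verdict true (not x) ∧ verdict true (not y) ≡ verdict true (not (x ∨ y))
  value true  y = refl
  value false y = refl
∧-literals (node 1F []) = [] , [] , λ a → refl
∧-literals {n} (node 2F []) = single true (positive n) (positive< ℕₚ.≤-refl) λ a → cong (verdict true ∘ not) (sym (violated-end a))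

∨-literals : ∀ {n} (φ : Formula ⟨∨,⊤,⊥⟩ n) → Literals false (evalFormula φ)
∨-literals (var x) = single false (negative (toℕ x)) (negative< (Finₚ.toℕ<n x))
  λ a → trans (sym (value (lookup a x))) (cong (verdict false ∘ not) (sym (violated-negative x a)))
  where
  value : ∀ b → verdict false (not b) ≡ b
  value true  = refl
  value false = refl
∨-literals {n} (node 0F (φ ∷ ψ ∷ [])) with ∨-literals φ | ∨-literals ψ
... | is , is< , is≡ | js , js< , js≡ = is ++ js , Allₚ.++⁺ is< js< ,
  λ a → trans (cong₂ _∨_ (is≡ a) (js≡ a)) (trans (value (violates is a) (violates js a)) (cong (verdict false ∘ not) (sym (violates-++ is js a))))
  where
  value : ∀ x y → verdict false (not x) ∨ verdict false (not y) ≡ verdict false (not (x ∨ y))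
  value true  y = refl
  value false y = refl
∨-literals {n} (node 1F []) = single false (positive n) (positive< ℕₚ.≤-refl) λ a → cong (verdict false ∘ not) (sym (violated-end a))
∨-literals (node 2F []) = [] , [] , λ a → refl

-- Conjunctions are not closed under negation, so the induction carries the negated function along;
-- both are literals or constants.
¬-literals : ∀ {n} (φ : Formula ⟨¬,⊤,⊥⟩ n) → Literals true (evalFormula φ) × Literals true (not ∘ evalFormula φ)
¬-literals (var x) =
  ∧-literals (var x) ,
  single true (negative (toℕ x)) (negative< (Finₚ.toℕ<n x))
    λ a → trans (sym (value (lookup a x))) (cong (verdict true ∘ not) (sym (violated-negative x a)))
  where
  value : ∀ b → verdict true (not b) ≡ not b
  value true  = refl
  value false = refl
¬-literals (node 0F (φ ∷ [])) with ¬-literals φ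
... | (is , is< , is≡) , negated = negated , (is , is< , λ a → trans (not-involutive _) (is≡ a))
¬-literals (node 1F []) = ∧-literals (node 1F []) , ∧-literals (node 2F [])
¬-literals (node 2F []) = ∧-literals (node 2F []) , ∧-literals (node 1F [])

literals-cong : ∀ {n d} {f g : Vec Bool n → Bool} → (∀ a → f a ≡ g a) → Literals d f → Literals d g
literals-cong f≗g (is , is< , eq) = is , is< , λ a → trans (sym (f≗g a)) (eq a)

tractable⇒literals : ∀ {O} → Tractable O → Σ[ d ∈ Bool ] (∀ {n} (f : Vec Bool n → Bool) → f ∈[ O ] → Literals d f)
tractable⇒literals (inj₁ O⪯∧)        = true , λ f f∈ → let φ , eq = O⪯∧ f f∈ in literals-cong eq (∧-literals φ)
tractable⇒literals (inj₂ (inj₁ O⪯∨)) = false , λ f f∈ → let φ , eq = O⪯∨ f f∈ in literals-cong eq (∨-literals φ)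
tractable⇒literals (inj₂ (inj₂ O⪯¬)) = true , λ f f∈ → let φ , eq = O⪯¬ f f∈ in literals-cong eq (proj₁ (¬-literals φ))

consistent-snoc : ∀ v ms m rs → consistent v (ms ++ m ∷ []) rs ≡ consistent v ms rs ∧ not (m ∧ violated v (length ms) rs)
consistent-snoc true  []       m rs = ∧-identityʳ _
consistent-snoc false []       m rs = ∧-identityʳ _
consistent-snoc true  (x ∷ ms) m rs = trans (cong (_ ∧_) (consistent-snoc false ms m rs)) (sym (∧-assoc (not (x ∧ opposes true (proj₁ (uncons rs)))) _ _))
consistent-snoc false (x ∷ ms) m rs = trans (cong (_ ∧_) (consistent-snoc true ms m (proj₂ (uncons rs)))) (sym (∧-assoc (not (x ∧ opposes false (proj₁ (uncons rs)))) _ _))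

-- Correctness of the learner

-- `timeBound` spells out `learning-cost` at n and 1/ε. The factor 32 of `toleranceBound` comes from
-- the inverse tolerance 2^(k+1) = 32 · 2^r · 2^p.
learner : Bool → SQLearner
learner d = record
  { learner        = machineᴸ
  ; E              = queried d
  ; H              = hypotheses d
  ; timeBound      = con 5 :+ ((con 1 :+ var 2F) :+ (((con 1 :+ (con 2 :* var 0F)) :* (con 1 :+ var 0F)) :+
                       ((con 1 :+ var 0F) :* ((con 4 :* ((con 1 :+ (con 2 :* var 0F)) :+ (var 2F :+ con 4))) :+ con 13))))
  ; queryBound     = con 2 :* (con 1 :+ var 0F)
  ; toleranceBound = con 32 :* ((con 1 :+ (con 2 :* var 0F)) :* var 2F)
  }

module _ (d : Bool) {n} (f : Vec Bool n → Bool) (D : Distribution n) (𝒪 : Oracle) (k : ℕ)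
         (admissible : ∀ w τ earlier → 0ℚ ℚ.< τ →
           PrWithin D (λ a → SQLearner.χ (learner d) w a (f a)) τ (answer-value (𝒪 (query w τ) earlier))) where
  open Distribution D

  event : ℕ → Vec Bool n → Bool
  event i a = violated true i (symbols a) ∧ not (f a xor d)

  private
    -- An approximation with error 2^-(k+2), half the tolerance: answers are then off by at most ¾ ·
    -- 2^-k, strictly less than the threshold.
    j₀ : ℕ
    j₀ = precision (suc (suc k))

    τ : ℚ
    τ = tolerance 𝒪 k

    Pr₀ : (Vec Bool n → Bool) → ℚ
    Pr₀ = Pr (approx j₀)

    h : ℚ
    h = half^ k

  answer-close : ∀ w earlier → ℚ.∣ answer-value (𝒪 (query w τ) earlier) ℚ.- Pr₀ (event (length w)) ∣ ℚ.≤ ½ ℚ.* h ℚ.+ ½ ℚ.* (½ ℚ.* h)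
  answer-close w earlier = subst₂ ℚ._≤_
    (cong (λ p → ℚ.∣ answer-value (𝒪 (query w τ) earlier) ℚ.- p ∣)
      (sumCube-cong n λ a → cong (λ b → if b then approx j₀ a else 0ℚ) (decide-queried d w (toList a) (f a))))
    (cong₂ ℚ._+_ (tolerance≡ 𝒪 k) (1/1+precision (suc (suc k))))
    (admissible w τ earlier (subst (0ℚ ℚ.<_) (sym (tolerance≡ 𝒪 k)) (half^>0 (suc k))) j₀)

  private
    above : ∀ {v p e} → ℚ.∣ v ℚ.- p ∣ ℚ.≤ e → v ℚ.≤ p ℚ.+ e
    above {v} {p} {e} le = begin
      v                       ≡⟨ solve 2 (λ v p → v := p ⊞ (⊟ (⊟ (v ⊞ ⊟ p)))) refl v p ⟩
      p ℚ.+ ℚ.- (ℚ.- x)       ≤⟨ ℚₚ.+-monoʳ-≤ p (ℚₚ.≤-trans (-p≤∣p∣ (ℚ.- x)) (ℚₚ.≤-trans (ℚₚ.≤-reflexive (ℚₚ.∣-p∣≡∣p∣ x)) le)) ⟩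
      p ℚ.+ e                 ∎
      where
      open ℚₚ.≤-Reasoning
      x : ℚ
      x = v ℚ.- p

    below : ∀ {v p e} → ℚ.∣ v ℚ.- p ∣ ℚ.≤ e → p ℚ.≤ v ℚ.+ e
    below {v} {p} {e} le = begin
      p                       ≡⟨ solve 2 (λ v p → p := v ⊞ (⊟ (v ⊞ ⊟ p))) refl v p ⟩
      v ℚ.+ ℚ.- (v ℚ.- p)     ≤⟨ ℚₚ.+-monoʳ-≤ v (ℚₚ.≤-trans (-p≤∣p∣ (v ℚ.- p)) le) ⟩
      v ℚ.+ e                 ∎
      where open ℚₚ.≤-Reasoning

    ¾ : ℚ
    ¾ = ½ ℚ.+ ½ ℚ.* ½

    slack : ½ ℚ.* h ℚ.+ ½ ℚ.* (½ ℚ.* h) ≡ ¾ ℚ.* h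
    slack = solve 1 (λ h → κ ½ ⊠ h ⊞ κ ½ ⊠ (κ ½ ⊠ h) := κ ¾ ⊠ h) refl h

    0≤¾ : 0ℚ ℚ.≤ ¾
    0≤¾ = ℚₚ.≤ᵇ⇒≤ _

    ¾<1 : ¾ ℚ.< 1ℚ
    ¾<1 = toWitness {a? = ¾ ℚₚ.<? 1ℚ} _

  -- An accepted answer is at most h, so the probability is at most h + ¾ h, rounded up to 2 h.
  rejects-likely : ∀ w earlier → accepts k (𝒪 (query w τ) earlier) ≡ true → Pr₀ (event (length w)) ℚ.≤ ℕ→ℚ 2 ℚ.* h
  rejects-likely w earlier accepted = begin
    Pr₀ (event (length w))        ≤⟨ below {v} {Pr₀ (event (length w))} (answer-close w earlier) ⟩
    v ℚ.+ (½ ℚ.* h ℚ.+ ½ ℚ.* (½ ℚ.* h))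
                                  ≤⟨ ℚₚ.+-mono-≤ (accepts-sound k (𝒪 (query w τ) earlier) v<2 accepted) (ℚₚ.≤-reflexive slack) ⟩
    h ℚ.+ ¾ ℚ.* h                 ≡⟨ solve 1 (λ h → h ⊞ κ ¾ ⊠ h := κ (1ℚ ℚ.+ ¾) ⊠ h) refl h ⟩
    (1ℚ ℚ.+ ¾) ℚ.* h              ≤⟨ *-monoʳ h (0≤half^ k) (ℚₚ.≤ᵇ⇒≤ {1ℚ ℚ.+ ¾} {ℕ→ℚ 2} _) ⟩
    ℕ→ℚ 2 ℚ.* h                   ∎
    where
    open ℚₚ.≤-Reasoning
    v : ℚ
    v = answer-value (𝒪 (query w τ) earlier)
    v<2 : v ℚ.< ℕ→ℚ 2
    v<2 = begin-strict
      v                                     ≤⟨ above {v} {Pr₀ (event (length w))} (answer-close w earlier) ⟩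
      Pr₀ (event (length w)) ℚ.+ (½ ℚ.* h ℚ.+ ½ ℚ.* (½ ℚ.* h))
                                            ≤⟨ ℚₚ.+-mono-≤ (Pr≤1 D j₀ (event (length w)))
                                                 (ℚₚ.≤-trans (ℚₚ.≤-reflexive slack) (*-monoˡ ¾ 0≤¾ (half^≤1 k))) ⟩
      1ℚ ℚ.+ ¾ ℚ.* 1ℚ                       <⟨ toWitness {a? = (1ℚ ℚ.+ ¾ ℚ.* 1ℚ) ℚₚ.<? ℕ→ℚ 2} _ ⟩
      ℕ→ℚ 2                                 ∎

  accepts-impossible : ∀ w earlier → (∀ a → event (length w) a ≡ false) → accepts k (𝒪 (query w τ) earlier) ≡ true
  accepts-impossible w earlier never = accepts-complete k (𝒪 (query w τ) earlier) (begin-strict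
    answer-value (𝒪 (query w τ) earlier)              ≤⟨ above {answer-value (𝒪 (query w τ) earlier)} {Pr₀ (event (length w))} (answer-close w earlier) ⟩
    Pr₀ (event (length w)) ℚ.+ (½ ℚ.* h ℚ.+ ½ ℚ.* (½ ℚ.* h))
                                                      ≡⟨ cong₂ ℚ._+_ (Pr-none {w = approx j₀} (event (length w)) never) slack ⟩
    0ℚ ℚ.+ ¾ ℚ.* h                                    ≡⟨ ℚₚ.+-identityˡ (¾ ℚ.* h) ⟩
    ¾ ℚ.* h                                           <⟨ ℚₚ.*-monoˡ-<-pos h {{ℚ.positive (half^>0 k)}} ¾<1 ⟩
    1ℚ ℚ.* h                                          ≡⟨ ℚₚ.*-identityˡ h ⟩
    h                                                 ∎)
    where open ℚₚ.≤-Reasoning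

  satisfied : List Bool → Vec Bool n → Bool
  satisfied ms a = consistent true (reverse ms) (symbols a)

  satisfied-∷ : ∀ m ms a → satisfied (m ∷ ms) a ≡ satisfied ms a ∧ not (m ∧ violated true (length ms) (symbols a))
  satisfied-∷ m ms a = begin
    consistent true (reverse (m ∷ ms)) (symbols a)          ≡⟨ cong (λ xs → consistent true xs (symbols a)) (Listₚ.unfold-reverse m ms) ⟩
    consistent true (reverse ms ++ m ∷ []) (symbols a)      ≡⟨ consistent-snoc true (reverse ms) m (symbols a) ⟩
    satisfied ms a ∧ not (m ∧ violated true (length (reverse ms)) (symbols a))
      ≡⟨ cong (λ l → satisfied ms a ∧ not (m ∧ violated true l (symbols a))) (Listₚ.length-reverse ms) ⟩
    satisfied ms a ∧ not (m ∧ violated true (length ms) (symbols a)) ∎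
    where open ≡-Reasoning

  wrong : List Bool → Vec Bool n → Bool
  wrong ms a = not (satisfied ms a) ∧ not (f a xor d)

  -- Union bound along the trace: a new mark adds only points at which its candidate fails while f
  -- has value d, and none if it is false.
  wrong-bound : ∀ {ms qs} → Trace 𝒪 k ms qs → Pr₀ (wrong ms) ℚ.≤ ℕ→ℚ (length ms) ℚ.* (ℕ→ℚ 2 ℚ.* h)
  wrong-bound [] = ℚₚ.≤-reflexive (trans (Pr-none {w = approx j₀} (wrong []) λ a → refl) (sym (ℚₚ.*-zeroˡ (ℕ→ℚ 2 ℚ.* h))))
  wrong-bound (more {ms} {qs} tr) = begin
    Pr₀ (wrong (m ∷ ms))
      ≤⟨ Pr-subadditive (nonneg j₀) (wrong (m ∷ ms)) (wrong ms) (λ a → m ∧ event (length ms) a) split ⟩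
    Pr₀ (wrong ms) ℚ.+ Pr₀ (λ a → m ∧ event (length ms) a)
      ≤⟨ ℚₚ.+-mono-≤ (wrong-bound tr) (newest m refl) ⟩
    ℕ→ℚ (length ms) ℚ.* (ℕ→ℚ 2 ℚ.* h) ℚ.+ ℕ→ℚ 2 ℚ.* h
      ≡⟨ solve 2 (λ l t → l ⊠ t ⊞ t := (κ 1ℚ ⊞ l) ⊠ t) refl (ℕ→ℚ (length ms)) (ℕ→ℚ 2 ℚ.* h) ⟩
    (1ℚ ℚ.+ ℕ→ℚ (length ms)) ℚ.* (ℕ→ℚ 2 ℚ.* h)
      ≡⟨ cong (ℚ._* (ℕ→ℚ 2 ℚ.* h)) (ℕ→ℚ-suc (length ms)) ⟨
    ℕ→ℚ (suc (length ms)) ℚ.* (ℕ→ℚ 2 ℚ.* h) ∎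
    where
    open ℚₚ.≤-Reasoning
    m : Bool
    m = accepts k (𝒪 (query ms τ) qs)

    newest : ∀ b → b ≡ m → Pr₀ (λ a → b ∧ event (length ms) a) ℚ.≤ ℕ→ℚ 2 ℚ.* h
    newest true  eq = rejects-likely ms qs (sym eq)
    newest false eq = subst (ℚ._≤ ℕ→ℚ 2 ℚ.* h) (sym (Pr-none {w = approx j₀} (λ a → false) λ a → refl))
                        (*-nonneg (0≤ℕ→ℚ 2) (0≤half^ k))

    cases : ∀ s m v e → 𝟙 (not (s ∧ not (m ∧ v)) ∧ e) ℚ.≤ 𝟙 (not s ∧ e) ℚ.+ 𝟙 (m ∧ v ∧ e)
    cases false m     v     e     = subst (ℚ._≤ 𝟙 e ℚ.+ 𝟙 (m ∧ v ∧ e)) (ℚₚ.+-identityʳ (𝟙 e)) (ℚₚ.+-monoʳ-≤ (𝟙 e) (0≤𝟙 (m ∧ v ∧ e)))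
    cases true  false v     e     = ℚₚ.≤-refl
    cases true  true  false e     = ℚₚ.≤-refl
    cases true  true  true  e     = ℚₚ.≤-reflexive (sym (ℚₚ.+-identityˡ (𝟙 e)))

    split : ∀ a → 𝟙 (wrong (m ∷ ms) a) ℚ.≤ 𝟙 (wrong ms a) ℚ.+ 𝟙 (m ∧ event (length ms) a)
    split a = subst (λ s → 𝟙 (not s ∧ not (f a xor d)) ℚ.≤ 𝟙 (wrong ms a) ℚ.+ 𝟙 (m ∧ event (length ms) a))
      (sym (satisfied-∷ m ms a)) (cases (satisfied ms a) m (violated true (length ms) (symbols a)) (not (f a xor d)))

  -- A candidate that never fails while f has value d gets an answer below the threshold and is
  -- kept, so every point meeting the kept candidates satisfies it.
  complete : ∀ {ms qs} → Trace 𝒪 k ms qs → ∀ i → (∀ a → event i a ≡ false) → i < length ms →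
    ∀ a → satisfied ms a ≡ true → violated true i (symbols a) ≡ false
  complete (more {ms} {qs} tr) i never i< a sat with i ℕₚ.≟ length ms
  ... | yes refl = newest (satisfied ms a) (accepts k (𝒪 (query ms τ) qs)) (accepts-impossible ms qs never)
                     (trans (sym (satisfied-∷ _ ms a)) sat)
    where
    newest : ∀ s m {v} → m ≡ true → s ∧ not (m ∧ v) ≡ true → v ≡ false
    newest true true {false} _ _ = refl
  ... | no i≢ = complete tr i never (ℕₚ.≤∧≢⇒< (ℕₚ.≤-pred i<) i≢) a
                  (earlier (satisfied ms a) (trans (sym (satisfied-∷ _ ms a)) sat))
    where
    earlier : ∀ s {t} → s ∧ t ≡ true → s ≡ true
    earlier true _ = refl

  module _ (literals : Literals d f) {ms qs} (trace : Trace 𝒪 k ms qs) (length≡ : length ms ≡ 2 * suc n) where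

    error : Vec Bool n → Bool
    error a = SQLearner.hypothesis (learner d) ms a xor f a

    unviolated : ∀ a → satisfied ms a ≡ true → f a ≡ d
    unviolated a sat = trans (f≡ a) (cong (verdict d ∘ not) (avoids is is< λ b v → v))
      where
      is : List ℕ
      is = proj₁ literals
      is< : All (_< 2 * suc n) is
      is< = proj₁ (proj₂ literals)
      f≡ : ∀ b → f b ≡ verdict d (not (violates is b))
      f≡ = proj₂ (proj₂ literals)

      never : ∀ i → (∀ (b : Vec Bool n) → violated true i (symbols b) ≡ true → violates is b ≡ true) → ∀ b → event i b ≡ false
      never i implies b with violated true i (symbols b) in v
      ... | false = refl
      ... | true  = trans (cong (λ y → not (y xor d)) (trans (f≡ b) (cong (verdict d ∘ not) (implies b v)))) (differs d)
        where
        differs : ∀ d → not (not d xor d) ≡ false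
        differs true  = refl
        differs false = refl

      avoids : ∀ js → All (_< 2 * suc n) js → (∀ (b : Vec Bool n) → violates js b ≡ true → violates is b ≡ true) → violates js a ≡ false
      avoids []       []         implies = refl
      avoids (j ∷ js) (j< ∷ js<) implies = cong₂ _∨_
        (complete trace j (never j λ b v → implies b (cong (_∨ violates js b) v)) (subst (j <_) (sym length≡) j<) a sat)
        (avoids js js< λ b v → implies b (trans (cong (violated true j (symbols b) ∨_) v) (∨-zeroʳ (violated true j (symbols b)))))

    -- Errors are one-sided: no candidate that makes up f is lost, so the hypothesis takes the value
    -- d only where f does.
    error≤wrong : ∀ a → 𝟙 (error a) ℚ.≤ 𝟙 (wrong ms a)
    error≤wrong a = subst (λ y → 𝟙 (y xor f a) ℚ.≤ 𝟙 (wrong ms a)) (sym (decide-hypotheses d ms (toList a)))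
      (cases d (satisfied ms a) (f a) (unviolated a))
      where
      cases : ∀ d s y → (s ≡ true → y ≡ d) → 𝟙 ((if s then d else not d) xor y) ℚ.≤ 𝟙 (not s ∧ not (y xor d))
      cases true  false true  _ = ℚₚ.≤-refl
      cases true  false false _ = ℚₚ.≤-refl
      cases false false true  _ = ℚₚ.≤-refl
      cases false false false _ = ℚₚ.≤-refl
      cases d     true  y     eq with eq refl
      cases true  true  .true  eq | refl = ℚₚ.≤-refl
      cases false true  .false eq | refl = ℚₚ.≤-refl

    -- The budget 2^-(p+1) is split in two: one half for the error under the approximation `j₀`, the
    -- other for passing from it to the given approximation.
    accurate : ∀ r p {ε} → k ≡ r + (p + 4) → n < 2 ^ r → half^ (suc p) ℚ.≤ ε → PrAtMost D error ε
    accurate r p {ε} refl n< ≤ε k′ = begin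
      Pr (approx k′) error                                   ≤⟨ Pr-approx D k′ j₀ error ⟩
      Pr₀ error ℚ.+ (1/1+ k′ ℚ.+ 1/1+ j₀)                    ≤⟨ ℚₚ.+-mono-≤ main (ℚₚ.+-monoʳ-≤ (1/1+ k′) fine) ⟩
      q ℚ.+ (1/1+ k′ ℚ.+ q)                                  ≡⟨ solve 2 (λ t x → κ ½ ⊠ t ⊞ (x ⊞ κ ½ ⊠ t) := t ⊞ x) refl (half^ (suc p)) (1/1+ k′) ⟩
      half^ (suc p) ℚ.+ 1/1+ k′                              ≤⟨ ℚₚ.+-monoˡ-≤ (1/1+ k′) ≤ε ⟩
      ε ℚ.+ 1/1+ k′                                          ∎
      where
      open ℚₚ.≤-Reasoning
      q R : ℚ
      q = half^ (suc (suc p))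
      R = ℕ→ℚ (2 ^ r)

      fine : 1/1+ j₀ ℚ.≤ q
      fine = ℚₚ.≤-trans (ℚₚ.≤-reflexive (trans (1/1+precision (suc (suc k))) (cong half^ (arrange r p))))
                        (half^-antimono (r + 4) (suc (suc p)))
        where
        arrange : ∀ r p → 2 + (r + (p + 4)) ≡ (r + 4) + (2 + p)
        arrange = solve-∀

      main : Pr₀ error ℚ.≤ q
      main = begin
        Pr₀ error                                            ≤⟨ Pr-mono (nonneg j₀) error (wrong ms) error≤wrong ⟩
        Pr₀ (wrong ms)                                       ≤⟨ wrong-bound trace ⟩
        ℕ→ℚ (length ms) ℚ.* (ℕ→ℚ 2 ℚ.* h)                    ≤⟨ *-monoʳ (ℕ→ℚ 2 ℚ.* h) (*-nonneg (0≤ℕ→ℚ 2) (0≤half^ k))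
                                                                  (ℕ→ℚ-mono {length ms} {2 * 2 ^ r} (ℕₚ.≤-trans (ℕₚ.≤-reflexive length≡) (ℕₚ.*-monoʳ-≤ 2 n<))) ⟩
        ℕ→ℚ (2 * 2 ^ r) ℚ.* (ℕ→ℚ 2 ℚ.* h)                    ≡⟨ cong₂ (λ x y → x ℚ.* (ℕ→ℚ 2 ℚ.* y)) (ℕ→ℚ-* 2 (2 ^ r))
                                                                  (trans (half^-+ r (p + 4)) (cong (half^ r ℚ.*_) (half^-+ p 4))) ⟩
        ℕ→ℚ 2 ℚ.* R ℚ.* (ℕ→ℚ 2 ℚ.* (half^ r ℚ.* (half^ p ℚ.* half^ 4)))
          ≡⟨ solve 3 (λ R hr hp → κ (ℕ→ℚ 2) ⊠ R ⊠ (κ (ℕ→ℚ 2) ⊠ (hr ⊠ (hp ⊠ κ (half^ 4)))) := (hr ⊠ R) ⊠ (κ ½ ⊠ (κ ½ ⊠ hp))) refl R (half^ r) (half^ p) ⟩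
        half^ r ℚ.* R ℚ.* q                                  ≡⟨ trans (cong (ℚ._* q) (half^-inverse r)) (ℚₚ.*-identityˡ q) ⟩
        q                                                    ∎

trace-length : ∀ {𝒪 k ms qs} → Trace 𝒪 k ms qs → length qs ≡ length ms
trace-length []        = refl
trace-length (more tr) = cong suc (trace-length tr)

trace-tolerances : ∀ {𝒪 k ms qs} {P : ℚ → Set} → P (tolerance 𝒪 k) → Trace 𝒪 k ms qs → All (P ∘ Query.tolerance) qs
trace-tolerances p []        = []
trace-tolerances p (more tr) = p ∷ trace-tolerances p tr

tolerance-bound : ∀ 𝒪 n r p e {k} → k ≡ r + (p + 4) → 2 ^ r ≤ suc (2 * n) → 2 ^ p ≤ e →
  1ℚ ℚ.≤ tolerance 𝒪 k ℚ.* ℕ→ℚ (32 * (suc (2 * n) * e))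
tolerance-bound 𝒪 n r p e {k} refl r≤ p≤ = begin
  1ℚ                                                          ≡⟨ half^-inverse (suc k) ⟨
  half^ (suc k) ℚ.* ℕ→ℚ (2 ^ suc k)                           ≤⟨ *-monoˡ (half^ (suc k)) (0≤half^ (suc k)) (ℕ→ℚ-mono {2 ^ suc k} {bound} enough) ⟩
  half^ (suc k) ℚ.* ℕ→ℚ bound                                 ≡⟨ cong (ℚ._* ℕ→ℚ bound) (tolerance≡ 𝒪 k) ⟨
  tolerance 𝒪 k ℚ.* ℕ→ℚ bound                                 ∎
  where
  open ℚₚ.≤-Reasoning
  bound : ℕ
  bound = 32 * (suc (2 * n) * e)

  enough : 2 ^ suc (r + (p + 4)) ≤ bound
  enough = ℕₚ.≤-trans (ℕₚ.≤-reflexive (trans (cong (2 *_) (trans (ℕₚ.^-distribˡ-+-* 2 r (p + 4)) (cong (2 ^ r *_) (ℕₚ.^-distribˡ-+-* 2 p 4))))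
      (arrange (2 ^ r) (2 ^ p))))
    (ℕₚ.*-monoʳ-≤ 32 (ℕₚ.*-mono-≤ r≤ p≤))
    where
    arrange : ∀ x y → 2 * (x * (y * 16)) ≡ 32 * (x * y)
    arrange = solve-∀

certain : ∀ t δs → 1ℚ ℚ.- fraction δs ℚ.≤ Pr (uniform t) (λ _ → true)
certain t δs = ℚₚ.≤-trans
  (subst (1ℚ ℚ.- fraction δs ℚ.≤_) (ℚₚ.+-identityʳ 1ℚ) (ℚₚ.+-monoʳ-≤ 1ℚ (ℚₚ.neg-antimono-≤ (0≤fraction δs))))
  (ℚₚ.≤-reflexive (sym (trans (sumCube-cong t (uniform≡half^ t)) (sumCube-half^ t))))

literals⇒learns : ∀ d {n} (f : Vec Bool n → Bool) → Literals d f → ∀ s (D : Distribution n) εs δs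
  (ε>0 : 0ℚ ℚ.< fraction εs) (δ>0 : 0ℚ ℚ.< fraction δs) (𝒪 : Oracle) →
  Succeeds (learner d) s f D εs δs ε>0 δ>0 𝒪
literals⇒learns d {n} f literals s D εs δs ε>0 δ>0 𝒪 admissible =
  efficient , (λ _ → true) , (λ cs _ → accurately cs) , certain R.steps δs
  where
  module R = Run (learner d) s f D εs δs ε>0 δ>0 𝒪
  open Execution machineᴸ

  p : ℕ
  p = leading-zeros εs

  2^p≤ : 2 ^ p ≤ R.1/ε
  2^p≤ = reciprocal-bound (fraction εs) ε>0 p (fraction-leading-upper εs)

  finished : ∀ (cs : Vec Bool R.steps) → Halted (R.final cs) × Outcome 𝒪 n εs (R.final cs)
  finished = finishes-run 𝒪 (learner-finishes 𝒪 n s εs δs)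
    (learning-cost-mono n {p} {R.1/ε} (ℕₚ.≤-trans (ℕₚ.<⇒≤ (n<2^n p)) 2^p≤))

  efficient : ∀ cs → R.Efficient cs
  efficient cs = proj₁ (finished cs) ,
    ℕₚ.≤-reflexive (trans (trace-length trace) length≡) ,
    trace-tolerances {P = λ τ → 1ℚ ℚ.≤ τ ℚ.* ℕ→ℚ (32 * (suc (2 * n) * R.1/ε))} (tolerance-bound 𝒪 n r p R.1/ε k≡ 2^r≤ 2^p≤) trace
    where open Outcome (proj₂ (finished cs))

  accurately : ∀ cs → R.Accurate cs
  accurately cs = accurate d f D 𝒪 k admissible literals trace length≡ r p k≡ n<2^r (fraction-leading-lower εs ε>0)
    where open Outcome (proj₂ (finished cs))

tractable⇒learnable : ∀ {𝒞 O} → (∀ {n} (c : RepresentationClass.Member 𝒞 n) → RepresentationClass.eval 𝒞 c ∈[ O ]) →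
  Tractable O → EfficientlySQLearnable 𝒞
tractable⇒learnable {𝒞} eval∈ tractable = learner (proj₁ form) , λ s c _ D εs δs ε>0 δ>0 𝒪 admissible →
  literals⇒learns (proj₁ form) (RepresentationClass.eval 𝒞 c) (proj₂ form _ (eval∈ c)) s D εs δs ε>0 δ>0 𝒪 admissible
  where form = tractable⇒literals tractable

theorem1p6 : CryptographicAssumptions → (O : Basis) →
    (EfficientlySQLearnable (PL O) ⇔ (O ⪯ ⟨∧,⊤,⊥⟩ ⊎ O ⪯ ⟨∨,⊤,⊥⟩ ⊎ O ⪯ ⟨¬,⊤,⊥⟩))
    × (EfficientlySQLearnable (CIR O) ⇔ (O ⪯ ⟨∧,⊤,⊥⟩ ⊎ O ⪯ ⟨∨,⊤,⊥⟩ ⊎ O ⪯ ⟨¬,⊤,⊥⟩))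
theorem1p6 _ O =
  mk⇔ (learnable⇒tractable (PL-expresses O)) (tractable⇒learnable λ φ → φ , λ _ → refl) ,
  mk⇔ (learnable⇒tractable (CIR-expresses O)) (tractable⇒learnable circuit∈)
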